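{- Let $(G,\sigma)$ be a signed graph where $G$ is a near triangulation with outer facial cycle $C=v_1v_2\cdots v_k$, and let $e=v_1v_2$. Then $G-e$ has a $\sigma$-nice orientation, i.e., an orientation $D$ of $G-e$ such that (1) $|\sigma EE(D)|\neq|\sigma OE(D)|$, and (2) $v_1$ and $v_2$ have outdegree $0$ in $D$, $v_i$ has outdegree at most $2$ for each $i\in\{3,\dots,k\}$, and every interior vertex (vertex not on $C$) has outdegree at most $4$.
   Context: A signed graph $(G,\sigma)$ consists of a finite simple graph $G$ and $\sigma\colon E(G)\to\{+1,-1\}$; edges with $\sigma=+1$ are positive. A near triangulation is a plane graph whose outer face is bounded by a cycle (the outer facial cycle) and all of whose inner faces are bounded by triangles. For an orientation $D$ of a subgraph $G'$ of $G$ (here $G'=G-e$), an Eulerian subdigraph of $D$ is a spanning subdigraph (not necessarily connected, possibly edgeless) in which every vertex has indegree equal to outdegree; it is $\sigma$-even (resp. $\sigma$-odd) if it contains an even (resp. odd) number of edges $f$ with $\sigma(f)=+1$. $\sigma EE(D)$ and $\sigma OE(D)$ denote the sets of $\sigma$-even and $\sigma$-odd Eulerian subdigraphs of $D$. -}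

module Defs where

open import Data.Bool using (Bool; true; false; _∧_; not; T)
open import Data.Nat using (ℕ; zero; suc; _+_; _*_; _∸_; _≤_; _≡ᵇ_; _%_)
open import Data.Nat.DivMod using (m%n<n)
open import Data.Fin using (Fin; toℕ; fromℕ<; _≟_)
open import Data.List using (List; []; _∷_; map; _++_; length; filterᵇ; allFin; cartesianProduct)
open import Data.Bool.ListAction using (all)
open import Data.Product using (_×_; _,_; proj₁; proj₂; Σ; ∃)
open import Relation.Nullary.Decidable using (⌊_⌋)
open import Relation.Binary.PropositionalEquality using (_≡_; _≢_)
open import Relation.Nullary using (¬_)
import Data.Sum
import Data.Nat

record SimpleGraph (n : ℕ) : Set where
  field
    adj   : Fin n → Fin n → Bool
    symm  : ∀ u v → adj u v ≡ adj v u
    irrefl : ∀ v → adj v v ≡ false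

open SimpleGraph public

allPairs : (n : ℕ) → List (Fin n × Fin n)
allPairs n = cartesianProduct (allFin n) (allFin n)

darts : ∀ {n} → SimpleGraph n → List (Fin n × Fin n)
darts {n} G = filterᵇ (λ p → adj G (proj₁ p) (proj₂ p)) (allPairs n)

edgeCount : ∀ {n} → SimpleGraph n → ℕ
edgeCount {n} G =
  length (filterᵇ (λ p → adj G (proj₁ p) (proj₂ p) ∧ ⌊ toℕ (proj₁ p) Data.Nat.<? toℕ (proj₂ p) ⌋)
                  (allPairs n))

data Reachable {n} (G : SimpleGraph n) : Fin n → Fin n → Set where
  here : ∀ {v} → Reachable G v v
  step : ∀ {u w v} → adj G u w ≡ true → Reachable G w v → Reachable G u v

Connected : ∀ {n} → SimpleGraph n → Set
Connected {n} G = ∀ (u v : Fin n) → Reachable G u v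

iter : ∀ {A : Set} → ℕ → (A → A) → A → A
iter zero    f x = x
iter (suc m) f x = f (iter m f x)

record RotationSystem {n} (G : SimpleGraph n) : Set where
  field
    rot       : Fin n → Fin n → Fin n
    rot-adj   : ∀ v u → adj G v u ≡ true → adj G v (rot v u) ≡ true
    rot-inj   : ∀ v u w → adj G v u ≡ true → adj G v w ≡ true →
                rot v u ≡ rot v w → u ≡ w
    rot-cyclic : ∀ v u w → adj G v u ≡ true → adj G v w ≡ true →
                 ∃ λ m → iter m (rot v) u ≡ w

open RotationSystem public

faceStep : ∀ {n} {G : SimpleGraph n} → RotationSystem G → Fin n × Fin n → Fin n × Fin n
faceStep R (u , v) = (v , rot R v u)

csuc : ∀ {k} → Fin (suc k) → Fin (suc k)
csuc {k} i = fromℕ< (m%n<n (suc (toℕ i)) (suc k))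

-- Near triangulation with outer facial cycle C = c 0 , c 1 , … , c (k-1),
-- k = 3 + m.  A plane embedding is a rotation system of a connected
-- graph satisfying Euler's formula V - E + F = 2.  The faces are: one
-- outer face whose boundary walk is C, and all other faces (orbits of
-- faceStep) are triangles.  With F = 1 + (|darts| - k)/3 Euler's
-- formula reads 3(V + 1) + (|darts| - k) = 3(E + 2).

record NearTriangulation {n} (G : SimpleGraph n) (m : ℕ) (c : Fin (3 + m) → Fin n) : Set where
  field
    connected : Connected G
    cycle-inj : ∀ i j → c i ≡ c j → i ≡ j
    cycle-adj : ∀ i → adj G (c i) (c (csuc i)) ≡ true
    embedding : RotationSystem G
    outer-face : ∀ i → faceStep embedding (c i , c (csuc i)) ≡ (c (csuc i) , c (csuc (csuc i)))
    inner-faces : ∀ u v → adj G u v ≡ true → (∀ i → (u , v) ≢ (c i , c (csuc i))) →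
                  iter 3 (faceStep embedding) (u , v) ≡ (u , v)
    euler : 3 * (n + 1) + (length (darts G) ∸ (3 + m)) ≡ 3 * (edgeCount G + 2)

record OrientationMinus {n} (G : SimpleGraph n) (a b : Fin n) : Set where
  field
    arc     : Fin n → Fin n → Bool
    arc-edge : ∀ u v → arc u v ≡ true → adj G u v ≡ true
    arc-not-e₁ : arc a b ≡ false
    arc-not-e₂ : arc b a ≡ false
    arc-one : ∀ u v → adj G u v ≡ true → ¬ ((u ≡ a × v ≡ b) Data.Sum.⊎ (u ≡ b × v ≡ a)) →
              (arc u v ≡ true × arc v u ≡ false) Data.Sum.⊎ (arc u v ≡ false × arc v u ≡ true)

open OrientationMinus public

arcs : ∀ {n} {G : SimpleGraph n} {a b} → OrientationMinus G a b → List (Fin n × Fin n)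
arcs {n} D = filterᵇ (λ p → arc D (proj₁ p) (proj₂ p)) (allPairs n)

outdeg : ∀ {n} {G : SimpleGraph n} {a b} → OrientationMinus G a b → Fin n → ℕ
outdeg {n} D u = length (filterᵇ (λ v → arc D u v) (allFin n))

-- spanning subdigraphs = subsets of the arc set
subsets : ∀ {A : Set} → List A → List (List A)
subsets []       = [] ∷ []
subsets (x ∷ xs) = map (x ∷_) (subsets xs) ++ subsets xs

countᵇ : ∀ {A : Set} → (A → Bool) → List A → ℕ
countᵇ p xs = length (filterᵇ p xs)

isEulerian : ∀ {n} → List (Fin n × Fin n) → Bool
isEulerian {n} S =
  all (λ v → countᵇ (λ p → ⌊ proj₁ p ≟ v ⌋) S ≡ᵇ countᵇ (λ p → ⌊ proj₂ p ≟ v ⌋) S) (allFin n)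

-- number of positive edges (σ true = positive)
positives : ∀ {n} → (Fin n → Fin n → Bool) → List (Fin n × Fin n) → ℕ
positives σ S = countᵇ (λ p → σ (proj₁ p) (proj₂ p)) S

isEvenᵇ : ℕ → Bool
isEvenᵇ k = k % 2 ≡ᵇ 0

EulerianSubs : ∀ {n} {G : SimpleGraph n} {a b} → OrientationMinus G a b → List (List (Fin n × Fin n))
EulerianSubs D = filterᵇ isEulerian (subsets (arcs D))

σEE : ∀ {n} {G : SimpleGraph n} {a b} → (Fin n → Fin n → Bool) → OrientationMinus G a b → ℕ
σEE σ D = countᵇ (λ S → isEvenᵇ (positives σ S)) (EulerianSubs D)

σOE : ∀ {n} {G : SimpleGraph n} {a b} → (Fin n → Fin n → Bool) → OrientationMinus G a b → ℕ
σOE σ D = countᵇ (λ S → not (isEvenᵇ (positives σ S))) (EulerianSubs D)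

{-# OPTIONS --safe #-}

-- Condition (1) says that a coefficient of the polynomial ∏ (x_u ± x_v), with a
-- minus sign for the positive edges, is nonzero: reversing an Eulerian subdigraph
-- gives another orientation with the same outdegrees, so |σEE| - |σOE| is the
-- coefficient of ∏ x_v ^ outdeg v.  One therefore looks for a monomial of small
-- degrees with a nonzero coefficient, by induction on the disk bounded by C.
-- Let x be the neighbour of v₂ on C other than v₁, and rotate around x, starting at
-- v₂, through interior neighbours us until the next neighbour w on C.  The chord xw
-- cuts off one disk, and removing the fan of x leaves another, bounded by the us and
-- the rest of C.  A good monomial m of the latter extends to the fan: if some m·u/w
-- with u in us has a nonzero coefficient, then m·u·∏us·x works, with the spoke xw
-- pointing to x; otherwise m·∏us·x² works, since all terms but one cancel.  The two
-- disks share no edges, and homogeneity makes the coefficients multiply.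
-- That a chord cuts the disk in two is a discrete Jordan theorem: grow a spanning
-- tree from the cycle minus one edge e and a dual tree from the outer face avoiding
-- both; by Euler's formula the dual tree cannot reach all faces, and the faces which
-- it does reach are bounded by the cycle, as a boundary cannot dead-end in a tree.

module Submission where

open import Defs
open import Data.Bool using (Bool; true; false; not; T; if_then_else_; _∧_; _xor_)
import Data.Bool.Properties as Boolₚ
open import Data.Bool.ListAction using (all)
open import Data.Nat using (ℕ; zero; suc; z≤n; s≤s; _+_; _*_; _∸_; _≤_; _<_; _<?_; _≡ᵇ_; _%_)
import Data.Nat.Properties as ℕₚ
open import Data.Nat.DivMod using (m%n<n; m<n⇒m%n≡m; n%n≡0)
open import Data.Nat.Tactic.RingSolver using () renaming (solve-∀ to solve-∀ℕ)
open import Data.Integer as ℤ using (ℤ; +_; 0ℤ; 1ℤ; -1ℤ)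
import Data.Integer.Properties as ℤₚ
open import Data.Integer.Tactic.RingSolver using (solve-∀)
open import Data.Fin using (Fin; zero; suc; _≟_; toℕ; fromℕ; inject₁)
import Data.Fin.Properties as Finₚ
open import Data.Fin.Properties using (any?; all?)
open import Data.Fin.Relation.Unary.Top using (View; view; ‵fromℕ; ‵inject₁)
open import Data.List using (List; []; _∷_; _++_; length; map; filter; filterᵇ; allFin; tabulate)
open import Data.List.Properties using (++-assoc; length-++; length-map; length-tabulate)
open import Data.List.Membership.Propositional using (_∈_; _∉_)
open import Data.List.Membership.Propositional.Properties
  using (∈-allFin; ∈-∃++; ∈-++⁺ˡ; ∈-++⁺ʳ; ∈-++⁻; ∈-filter⁺; ∈-filter⁻; ∈-cartesianProduct⁺;
         ∈-map⁺; ∈-map⁻; ∈-tabulate⁺; ∈-tabulate⁻)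
open import Data.List.Membership.Propositional.Properties.WithK using (unique∧set⇒bag)
import Data.List.Membership.DecPropositional
open import Data.List.Relation.Binary.BagAndSetEquality using (∼bag⇒↭)
open import Data.List.Relation.Binary.Permutation.Propositional as ↭ using (_↭_)
open import Data.List.Relation.Binary.Pointwise using (Pointwise; []; _∷_)
open import Data.List.Relation.Unary.Any using (here; there)
open import Data.List.Relation.Unary.All using (All; []; _∷_)
import Data.List.Relation.Unary.All as All
open import Data.List.Relation.Unary.AllPairs using (AllPairs; []; _∷_)
import Data.List.Relation.Unary.AllPairs as AllPairs
import Data.List.Relation.Unary.AllPairs.Properties as AllPairsₚ
open import Data.List.Relation.Unary.Unique.Propositional using (Unique)
import Data.List.Relation.Unary.Unique.Propositional.Properties as Unique
open import Data.Product using (_×_; _,_; proj₁; proj₂; ∃; ∃₂; Σ; swap)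
open import Data.Product.Properties using (≡-dec; ,-injectiveˡ; ,-injectiveʳ)
open import Data.Sum using (_⊎_; inj₁; inj₂; [_,_]′)
open import Data.Empty using (⊥; ⊥-elim)
open import Relation.Nullary using (¬_; Dec; yes; no; does; ¬?; _×-dec_; _⊎-dec_)
open import Relation.Nullary.Decidable using (⌊_⌋; decidable-stable)
open import Relation.Unary using (Decidable)
open import Relation.Binary.PropositionalEquality
open import Function using (_∘_; id; mk⇔)

-- Coefficients of products of binomials

-- The induction statement is `Nice`: the root edge is left out of the product, its two ends have
-- exponent 0, and all exponents are at most 2 on the boundary and at most 4 everywhere. The chord
-- disk enters with xw as its root edge. So its monomial has exponent 0 at x and w, the only
-- vertices shared with the rest, and gluing it on raises no exponent; the factor of xw itself comes
-- from the fan. The bound 4 is 2 + 2: a vertex of us lies on the boundary of the disk left by the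
-- fan, where its exponent is at most 2, and the fan multiplies by it once within ∏us and at most
-- once more as the exceptional u. The obstacle is topological: after removal of the fan both parts
-- must be disks again, while the embedding is given only by rotations and an Euler count. A disk is
-- therefore a set of darts closed under `faceStep` together with a simple closed walk.

module Monomials {n : ℕ} (σ : Fin n → Fin n → Bool) where

  V = Fin n
  E = V × V

  δ : V → V → ℤ
  δ u v = if does (u ≟ v) then 1ℤ else 0ℤ

  δ-self : ∀ u → δ u u ≡ 1ℤ
  δ-self u with u ≟ u
  ... | yes _ = refl
  ... | no u≢u = ⊥-elim (u≢u refl)

  δ-other : ∀ {u v} → u ≢ v → δ u v ≡ 0ℤ
  δ-other {u} {v} u≢v with u ≟ v
  ... | yes u≡v = ⊥-elim (u≢v u≡v)
  ... | no _ = refl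

  0≤δ : ∀ u v → 0ℤ ℤ.≤ δ u v
  0≤δ u v with u ≟ v
  ... | yes _ = ℤ.+≤+ z≤n
  ... | no _ = ℤ.+≤+ z≤n

  δ≤1 : ∀ u v → δ u v ℤ.≤ 1ℤ
  δ≤1 u v with u ≟ v
  ... | yes _ = ℤ.+≤+ (s≤s z≤n)
  ... | no _ = ℤ.+≤+ z≤n

  infixl 6 _⊖_ _⊕_
  _⊖_ _⊕_ : (V → ℤ) → V → V → ℤ
  (d ⊖ u) v = d v ℤ.- δ u v
  (d ⊕ u) v = d v ℤ.+ δ u v

  indicator : ∀ {P : Set} → Dec P → ℤ
  indicator p = if does p then 1ℤ else 0ℤ

  indicator-true : ∀ {P : Set} (p : Dec P) → P → indicator p ≡ 1ℤ
  indicator-true (yes _) _ = refl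
  indicator-true (no ¬p) p = ⊥-elim (¬p p)

  indicator-false : ∀ {P : Set} (p : Dec P) → ¬ P → indicator p ≡ 0ℤ
  indicator-false (yes p) ¬p = ⊥-elim (¬p p)
  indicator-false (no _) _ = refl

  indicator≢0 : ∀ {P : Set} (p : Dec P) → indicator p ≢ 0ℤ → P
  indicator≢0 (yes p) _ = p
  indicator≢0 (no _) ne = ⊥-elim (ne refl)

  indicator-⇔ : ∀ {P Q : Set} (p : Dec P) (q : Dec Q) → (P → Q) → (Q → P) → indicator p ≡ indicator q
  indicator-⇔ (yes p) q to from = sym (indicator-true q (to p))
  indicator-⇔ (no ¬p) q to from = sym (indicator-false q (¬p ∘ from))

  zero? : (d : V → ℤ) → Dec (∀ v → d v ≡ 0ℤ)
  zero? d = all? (λ v → d v ℤ.≟ 0ℤ)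

  unit : (V → ℤ) → ℤ
  unit d = indicator (zero? d)

  unit≢0 : ∀ {d} → unit d ≢ 0ℤ → ∀ v → d v ≡ 0ℤ
  unit≢0 {d} = indicator≢0 (zero? d)

  sgn : V → V → ℤ
  sgn u v = if σ u v then -1ℤ else 1ℤ

  -- coef L d is the coefficient of ∏ x_v ^ d v in ∏ (x_u + sgn u v · x_v),
  -- the product ranging over the (u , v) in L.  Exponents are integers, so
  -- that multiplication by a variable is an invertible shift.
  coef : List E → (V → ℤ) → ℤ
  coef [] d = unit d
  coef ((u , v) ∷ L) d = coef L (d ⊖ u) ℤ.+ sgn u v ℤ.* coef L (d ⊖ v)

  coef-cong : ∀ L {d d′} → (∀ v → d v ≡ d′ v) → coef L d ≡ coef L d′
  coef-cong [] {d} {d′} eq = indicator-⇔ (zero? d) (zero? d′) (λ z v → trans (sym (eq v)) (z v)) (λ z v → trans (eq v) (z v))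
  coef-cong ((u , v) ∷ L) eq =
    cong₂ (λ a b → a ℤ.+ sgn u v ℤ.* b)
      (coef-cong L (λ w → cong (ℤ._- δ u w) (eq w)))
      (coef-cong L (λ w → cong (ℤ._- δ v w) (eq w)))

  private
    exchange : ∀ L d a b → coef L (d ⊖ a ⊖ b) ≡ coef L (d ⊖ b ⊖ a)
    exchange L d a b = coef-cong L (λ v → lemma (d v) (δ a v) (δ b v))
      where
        lemma : ∀ x y z → x ℤ.- y ℤ.- z ≡ x ℤ.- z ℤ.- y
        lemma = solve-∀

  -- The induction builds its product disk by disk, whereas `arcs` lists the edges in the order of
  -- all pairs; this makes the two comparable. In the swap case both binomials are expanded and the
  -- two middle terms exchanged.
  coef-↭ : ∀ {L L′} → L ↭ L′ → ∀ d → coef L d ≡ coef L′ d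
  coef-↭ ↭.refl d = refl
  coef-↭ (↭.prep (u , v) p) d =
    cong₂ (λ a b → a ℤ.+ sgn u v ℤ.* b) (coef-↭ p (d ⊖ u)) (coef-↭ p (d ⊖ v))
  coef-↭ {_ ∷ _ ∷ L} {_ ∷ _ ∷ L′} (↭.swap (u , v) (x , y) p) d = begin
      (c (u ∙ x) ℤ.+ t ℤ.* c (u ∙ y)) ℤ.+ s ℤ.* (c (v ∙ x) ℤ.+ t ℤ.* c (v ∙ y))
    ≡⟨ rearrange (c (u ∙ x)) (c (u ∙ y)) (c (v ∙ x)) (c (v ∙ y)) s t ⟩
      (c (u ∙ x) ℤ.+ s ℤ.* c (v ∙ x)) ℤ.+ t ℤ.* (c (u ∙ y) ℤ.+ s ℤ.* c (v ∙ y))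
    ≡⟨ cong₂ (λ a b → a ℤ.+ t ℤ.* b)
         (cong₂ (λ a b → a ℤ.+ s ℤ.* b) (move u x) (move v x))
         (cong₂ (λ a b → a ℤ.+ s ℤ.* b) (move u y) (move v y)) ⟩
      (c′ (x ∙ u) ℤ.+ s ℤ.* c′ (x ∙ v)) ℤ.+ t ℤ.* (c′ (y ∙ u) ℤ.+ s ℤ.* c′ (y ∙ v))
    ∎
    where
      open ≡-Reasoning
      s = sgn u v
      t = sgn x y
      c = coef L
      c′ = coef L′
      _∙_ : V → V → V → ℤ
      a ∙ b = d ⊖ a ⊖ b
      rearrange : ∀ a b e f s t → (a ℤ.+ t ℤ.* b) ℤ.+ s ℤ.* (e ℤ.+ t ℤ.* f) ≡
                                  (a ℤ.+ s ℤ.* e) ℤ.+ t ℤ.* (b ℤ.+ s ℤ.* f)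
      rearrange = solve-∀
      move : ∀ a b → c (a ∙ b) ≡ c′ (b ∙ a)
      move a b = trans (exchange L d a b) (coef-↭ p (b ∙ a))
  coef-↭ (↭.trans p q) d = trans (coef-↭ p d) (coef-↭ q d)

  sgn-≢0 : ∀ u v {x} → x ≢ 0ℤ → sgn u v ℤ.* x ≢ 0ℤ
  sgn-≢0 u v {x} x≢0 eq with σ u v
  ... | true = x≢0 (ℤₚ.neg-injective (trans (sym (ℤₚ.-1*i≡-i x)) eq))
  ... | false = x≢0 (trans (sym (ℤₚ.*-identityˡ x)) eq)

  sum≢0 : ∀ {a s b} → a ℤ.+ s ℤ.* b ≢ 0ℤ → a ≢ 0ℤ ⊎ b ≢ 0ℤ
  sum≢0 {a} {s} {b} ne with a ℤ.≟ 0ℤ | b ℤ.≟ 0ℤ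
  ... | no a≢0 | _ = inj₁ a≢0
  ... | yes _ | no b≢0 = inj₂ b≢0
  ... | yes refl | yes refl = ⊥-elim (ne (trans (ℤₚ.+-identityˡ _) (ℤₚ.*-zeroʳ s)))

  coef-∷≢0 : ∀ u v L d → coef ((u , v) ∷ L) d ≢ 0ℤ → coef L (d ⊖ u) ≢ 0ℤ ⊎ coef L (d ⊖ v) ≢ 0ℤ
  coef-∷≢0 u v L d = sum≢0 {s = sgn u v}

  private
    undo-minus : ∀ x y → x ℤ.- y ℤ.+ y ≡ x
    undo-minus = solve-∀

    undo-plus : ∀ x y → x ℤ.+ y ℤ.- y ≡ x
    undo-plus = solve-∀

  coef-nonneg : ∀ L d → coef L d ≢ 0ℤ → ∀ v → 0ℤ ℤ.≤ d v
  coef-nonneg [] d ne v = ℤₚ.≤-reflexive (sym (unit≢0 ne v))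
  coef-nonneg ((a , b) ∷ L) d ne v with coef-∷≢0 a b L d ne
  ... | inj₁ ne′ = subst (0ℤ ℤ.≤_) (undo-minus (d v) (δ a v))
                     (ℤₚ.+-mono-≤ (coef-nonneg L (d ⊖ a) ne′ v) (0≤δ a v))
  ... | inj₂ ne′ = subst (0ℤ ℤ.≤_) (undo-minus (d v) (δ b v))
                     (ℤₚ.+-mono-≤ (coef-nonneg L (d ⊖ b) ne′ v) (0≤δ b v))

  -- Exponents may become negative, but a product of binomials is a polynomial: a summand that takes
  -- a variable more often than the monomial contains it contributes nothing. The choices forced at
  -- b and x in the fan argument are obtained this way.
  coef-neg : ∀ L d v → d v ≡ -1ℤ → coef L d ≡ 0ℤ
  coef-neg L d v eq with coef L d ℤ.≟ 0ℤ
  ... | yes z = z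
  ... | no ne with subst (0ℤ ℤ.≤_) eq (coef-nonneg L d ne v)
  ...   | ()

  Touches : V → E → Set
  Touches v (a , b) = a ≡ v ⊎ b ≡ v

  Avoids : V → List E → Set
  Avoids v L = ∀ e → e ∈ L → ¬ Touches v e

  -- A variable enters a monomial only through a factor that contains it. The second alternative
  -- keeps such a factor, which later locates v in a disk.
  coef-support : ∀ L d → coef L d ≢ 0ℤ → ∀ v → d v ≡ 0ℤ ⊎ ∃ λ e → e ∈ L × Touches v e
  coef-support [] d ne v = inj₁ (unit≢0 ne v)
  coef-support ((a , b) ∷ L) d ne v with a ≟ v | b ≟ v
  ... | yes a≡v | _ = inj₂ (_ , here refl , inj₁ a≡v)
  ... | no _ | yes b≡v = inj₂ (_ , here refl , inj₂ b≡v)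
  ... | no a≢v | no b≢v with coef-∷≢0 a b L d ne
  ...   | inj₁ ne′ with coef-support L (d ⊖ a) ne′ v
  ...     | inj₂ (e , e∈ , t) = inj₂ (e , there e∈ , t)
  ...     | inj₁ eq = inj₁ (trans (sym (undo-minus (d v) (δ a v)))
                             (cong₂ ℤ._+_ eq (δ-other a≢v)))
  coef-support ((a , b) ∷ L) d ne v | no a≢v | no b≢v | inj₂ ne′ with coef-support L (d ⊖ b) ne′ v
  ...     | inj₂ (e , e∈ , t) = inj₂ (e , there e∈ , t)
  ...     | inj₁ eq = inj₁ (trans (sym (undo-minus (d v) (δ b v)))
                             (cong₂ ℤ._+_ eq (δ-other b≢v)))

  coef-avoids : ∀ L d → coef L d ≢ 0ℤ → ∀ v → Avoids v L → d v ≡ 0ℤ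
  coef-avoids L d ne v av with coef-support L d ne v
  ... | inj₁ z = z
  ... | inj₂ (e , e∈ , t) = ⊥-elim (av e e∈ t)

  total : ∀ {m} → (Fin m → ℤ) → ℤ
  total {zero} d = 0ℤ
  total {suc m} d = d zero ℤ.+ total (d ∘ suc)

  private
    total-cong : ∀ {m} {d d′ : Fin m → ℤ} → (∀ v → d v ≡ d′ v) → total d ≡ total d′
    total-cong {zero} eq = refl
    total-cong {suc m} eq = cong₂ ℤ._+_ (eq zero) (total-cong (eq ∘ suc))

    total-+ : ∀ {m} (d d′ : Fin m → ℤ) → total (λ v → d v ℤ.+ d′ v) ≡ total d ℤ.+ total d′
    total-+ {zero} d d′ = refl
    total-+ {suc m} d d′ rewrite total-+ (d ∘ suc) (d′ ∘ suc) =
      lemma (d zero) (d′ zero) (total (d ∘ suc)) (total (d′ ∘ suc))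
      where
        lemma : ∀ a b x y → a ℤ.+ b ℤ.+ (x ℤ.+ y) ≡ a ℤ.+ x ℤ.+ (b ℤ.+ y)
        lemma = solve-∀

    total-zero : ∀ {m} {d : Fin m → ℤ} → (∀ v → d v ≡ 0ℤ) → total d ≡ 0ℤ
    total-zero {zero} z = refl
    total-zero {suc m} z = cong₂ ℤ._+_ (z zero) (total-zero (z ∘ suc))

    total-indicator : ∀ {m} (u : Fin m) (f : Fin m → ℤ) → f u ≡ 1ℤ → (∀ v → u ≢ v → f v ≡ 0ℤ) → total f ≡ 1ℤ
    total-indicator zero f one z = cong₂ ℤ._+_ one (total-zero (λ v → z (suc v) λ ()))
    total-indicator (suc u) f one z =
      cong₂ ℤ._+_ (z zero λ ()) (total-indicator u (f ∘ suc) one (λ v ne → z (suc v) (λ { refl → ne refl })))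

    total-⊖ : ∀ d u → total (d ⊖ u) ℤ.+ 1ℤ ≡ total d
    total-⊖ d u = begin
      total (d ⊖ u) ℤ.+ 1ℤ              ≡⟨ cong (λ x → total (d ⊖ u) ℤ.+ x)
                                             (sym (total-indicator u (δ u) (δ-self u) (λ _ → δ-other))) ⟩
      total (d ⊖ u) ℤ.+ total (δ u)      ≡⟨ sym (total-+ (d ⊖ u) (δ u)) ⟩
      total (λ v → (d ⊖ u) v ℤ.+ δ u v)  ≡⟨ total-cong (λ v → undo-minus (d v) (δ u v)) ⟩
      total d                            ∎
      where open ≡-Reasoning

    nonneg-sum : ∀ {a b} → 0ℤ ℤ.≤ a → 0ℤ ℤ.≤ b → a ℤ.+ b ≡ 0ℤ → a ≡ 0ℤ × b ≡ 0ℤ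
    nonneg-sum {+ zero} {+ zero} _ _ _ = refl , refl

    0≤total : ∀ {m} (d : Fin m → ℤ) → (∀ v → 0ℤ ℤ.≤ d v) → 0ℤ ℤ.≤ total d
    0≤total {zero} d _ = ℤₚ.≤-refl
    0≤total {suc m} d nn = ℤₚ.+-mono-≤ (nn zero) (0≤total (d ∘ suc) (nn ∘ suc))

    total≡0 : ∀ {m} (d : Fin m → ℤ) → (∀ v → 0ℤ ℤ.≤ d v) → total d ≡ 0ℤ → ∀ v → d v ≡ 0ℤ
    total≡0 {suc m} d nn eq with nonneg-sum (nn zero) (0≤total (d ∘ suc) (nn ∘ suc)) eq
    ... | z , zs = λ { zero → z ; (suc v) → total≡0 (d ∘ suc) (nn ∘ suc) zs v }

  -- Every binomial has degree one. This count is what lets `coef-++` identify the monomial of the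
  -- second factor although the two factors may share variables.
  coef-homogeneous : ∀ L d → coef L d ≢ 0ℤ → total d ≡ + length L
  coef-homogeneous [] d ne = total-zero (unit≢0 ne)
  coef-homogeneous ((a , b) ∷ L) d ne with coef-∷≢0 a b L d ne
  ... | inj₁ ne′ = trans (sym (total-⊖ d a))
                     (trans (cong (ℤ._+ 1ℤ) (coef-homogeneous L _ ne′)) (ℤₚ.+-comm (+ length L) 1ℤ))
  ... | inj₂ ne′ = trans (sym (total-⊖ d b))
                     (trans (cong (ℤ._+ 1ℤ) (coef-homogeneous L _ ne′)) (ℤₚ.+-comm (+ length L) 1ℤ))

  infixl 6 _⊞_
  _⊞_ : (V → ℤ) → (V → ℤ) → V → ℤ
  (d ⊞ d′) v = d v ℤ.+ d′ v

  -- No other pair of monomials contributes to d ⊞ d′: by homogeneity the second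
  -- factor can only supply d′.
  coef-++ : ∀ L L′ d d′ → coef L′ d′ ≢ 0ℤ → (∀ v → d′ v ≡ 0ℤ ⊎ (Avoids v L × d v ≡ 0ℤ)) →
            coef (L ++ L′) (d ⊞ d′) ≡ coef L d ℤ.* coef L′ d′
  coef-++ [] L′ d d′ ne sep = go (zero? d) (coef L′ (d ⊞ d′) ℤ.≟ 0ℤ)
    where
      nn : coef L′ (d ⊞ d′) ≢ 0ℤ → ∀ v → 0ℤ ℤ.≤ d v
      nn ne′ v with sep v
      ... | inj₁ z = subst (0ℤ ℤ.≤_) (trans (cong (λ x → d v ℤ.+ x) z) (ℤₚ.+-identityʳ _)) (coef-nonneg L′ _ ne′ v)
      ... | inj₂ (_ , z) = ℤₚ.≤-reflexive (sym z)
      cancel : ∀ a b → a ℤ.+ b ≡ b → a ≡ 0ℤ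
      cancel a b eq = trans (sym (undo-plus a b)) (trans (cong (ℤ._- b) eq) (ℤₚ.+-inverseʳ b))
      go : (z : Dec (∀ v → d v ≡ 0ℤ)) → Dec (coef L′ (d ⊞ d′) ≡ 0ℤ) →
           coef L′ (d ⊞ d′) ≡ indicator z ℤ.* coef L′ d′
      go (yes z) _ = trans (coef-cong L′ (λ v → trans (cong (ℤ._+ d′ v) (z v)) (ℤₚ.+-identityˡ _)))
                       (sym (ℤₚ.*-identityˡ _))
      go (no _) (yes z) = trans z (sym (ℤₚ.*-zeroˡ (coef L′ d′)))
      -- Both `d ⊞ d′` and `d′` have nonzero coefficients in `L′`, hence the same degree, so `d`
      -- sums to zero. Being nonnegative, it vanishes.
      go (no ¬z) (no ne′) = ⊥-elim (¬z (total≡0 d (nn ne′)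
        (cancel (total d) (total d′)
          (trans (sym (total-+ d d′))
            (trans (coef-homogeneous L′ _ ne′) (sym (coef-homogeneous L′ _ ne)))))))
  coef-++ ((a , b) ∷ L) L′ d d′ ne sep = begin
      coef (L ++ L′) ((d ⊞ d′) ⊖ a) ℤ.+ sgn a b ℤ.* coef (L ++ L′) ((d ⊞ d′) ⊖ b)
    ≡⟨ cong₂ (λ x y → x ℤ.+ sgn a b ℤ.* y) (part a (inj₁ refl)) (part b (inj₂ refl)) ⟩
      coef L (d ⊖ a) ℤ.* coef L′ d′ ℤ.+ sgn a b ℤ.* (coef L (d ⊖ b) ℤ.* coef L′ d′)
    ≡⟨ factor (coef L (d ⊖ a)) (coef L (d ⊖ b)) (coef L′ d′) (sgn a b) ⟩
      (coef L (d ⊖ a) ℤ.+ sgn a b ℤ.* coef L (d ⊖ b)) ℤ.* coef L′ d′ ∎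
    where
      open ≡-Reasoning
      factor : ∀ x y z s → x ℤ.* z ℤ.+ s ℤ.* (y ℤ.* z) ≡ (x ℤ.+ s ℤ.* y) ℤ.* z
      factor = solve-∀
      commute : ∀ x y z → x ℤ.+ y ℤ.- z ≡ x ℤ.- z ℤ.+ y
      commute = solve-∀
      part : ∀ w → Touches w (a , b) → coef (L ++ L′) ((d ⊞ d′) ⊖ w) ≡ coef L (d ⊖ w) ℤ.* coef L′ d′
      part w t = trans (coef-cong (L ++ L′) (λ v → commute (d v) (d′ v) (δ w v)))
                   (coef-++ L L′ (d ⊖ w) d′ ne sep′)
        where
          sep′ : ∀ v → d′ v ≡ 0ℤ ⊎ (Avoids v L × (d ⊖ w) v ≡ 0ℤ)
          sep′ v with sep v
          ... | inj₁ z = inj₁ z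
          ... | inj₂ (av , z) = inj₂ ((λ e e∈ → av e (there e∈)) ,
                trans (cong₂ ℤ._-_ z (δ-other {w} {v} (λ { refl → av _ (here refl) t }))) refl)

  *-≢0 : ∀ {a b} → a ≢ 0ℤ → b ≢ 0ℤ → a ℤ.* b ≢ 0ℤ
  *-≢0 {a} a≢0 b≢0 eq with ℤₚ.i*j≡0⇒i≡0∨j≡0 a eq
  ... | inj₁ z = a≢0 z
  ... | inj₂ z = b≢0 z

-- Extending a monomial over a fan

module Fan {n : ℕ} (σ : Fin n → Fin n → Bool) where
  open Monomials σ

  spokes : V → List V → List E
  spokes x = map (x ,_)

  mult : List V → V → ℤ
  mult [] v = 0ℤ
  mult (u ∷ us) v = δ u v ℤ.+ mult us v

  mult-∉ : ∀ us {v} → v ∉ us → mult us v ≡ 0ℤ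
  mult-∉ [] _ = refl
  mult-∉ (u ∷ us) {v} v∉ = cong₂ ℤ._+_ (δ-other {u} {v} (λ { refl → v∉ (here refl) })) (mult-∉ us (v∉ ∘ there))

  mult-unique : ∀ us → Unique us → ∀ v → mult us v ℤ.≤ 1ℤ
  mult-unique [] _ v = ℤ.+≤+ z≤n
  mult-unique (u ∷ us) (u≢ ∷ uq) v with u ≟ v
  ... | yes refl = ℤₚ.≤-reflexive (cong (λ x → 1ℤ ℤ.+ x) (mult-∉ us (λ u∈ → All.lookup u≢ u∈ refl)))
  ... | no _ = subst (ℤ._≤ 1ℤ) (sym (ℤₚ.+-identityˡ _)) (mult-unique us uq v)

  infixl 6 _⊕*_
  _⊕*_ : (V → ℤ) → List V → V → ℤ
  (d ⊕* us) v = d v ℤ.+ mult us v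

  -- With exponent zero at x every spoke is forced to supply its outer end, so a single term
  -- survives; k is the product of the signs of the spokes.
  spokes-reversed : ∀ x us L d → x ∉ us → d x ≡ 0ℤ →
    ∃ λ k → k ≢ 0ℤ × coef (spokes x us ++ L) (d ⊕* us) ≡ k ℤ.* coef L d
  spokes-reversed x [] L d x∉ z = 1ℤ , (λ ()) ,
    trans (coef-cong L (λ v → ℤₚ.+-identityʳ (d v))) (sym (ℤₚ.*-identityˡ _))
  spokes-reversed x (u ∷ us) L d x∉ z with spokes-reversed x us L d (x∉ ∘ there) z
  ... | k , k≢0 , eq = sgn x u ℤ.* k , sgn-≢0 x u k≢0 , (begin
      coef Q ((d ⊕* (u ∷ us)) ⊖ x) ℤ.+ sgn x u ℤ.* coef Q ((d ⊕* (u ∷ us)) ⊖ u)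
    ≡⟨ cong₂ (λ a b → a ℤ.+ sgn x u ℤ.* b) (coef-neg Q _ x negative)
         (trans (coef-cong Q (λ v → shift (d v) (δ u v) (mult us v))) eq) ⟩
      0ℤ ℤ.+ sgn x u ℤ.* (k ℤ.* coef L d)
    ≡⟨ trans (ℤₚ.+-identityˡ _) (sym (ℤₚ.*-assoc (sgn x u) k (coef L d))) ⟩
      (sgn x u ℤ.* k) ℤ.* coef L d ∎)
    where
      open ≡-Reasoning
      Q = spokes x us ++ L
      shift : ∀ a b c → a ℤ.+ (b ℤ.+ c) ℤ.- b ≡ a ℤ.+ c
      shift = solve-∀
      negative : ((d ⊕* (u ∷ us)) ⊖ x) x ≡ -1ℤ
      negative rewrite z | mult-∉ (u ∷ us) x∉ | δ-self x = refl

  -- There is one x to place and L cannot supply it, so exactly one spoke does. The outer end u of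
  -- that spoke, which ∏us asks for, then has to come from L.
  spokes-one-forward : ∀ x us L d → x ∉ us → Avoids x L → d x ≡ 0ℤ →
    coef (spokes x us ++ L) (d ⊕ x ⊕* us) ≢ 0ℤ → ∃ λ u → u ∈ us × coef L (d ⊕ u) ≢ 0ℤ
  spokes-one-forward x [] L d x∉ av z ne with coef-avoids L _ ne x av
  ... | eq rewrite z | δ-self x with eq
  ...   | ()
  spokes-one-forward x (u ∷ us) L d x∉ av z ne with coef-∷≢0 x u (spokes x us ++ L) (d ⊕ x ⊕* (u ∷ us)) ne
  ... | inj₁ ne′ with spokes-reversed x us L (d ⊕ u) (x∉ ∘ there) du-x
    where
      du-x : (d ⊕ u) x ≡ 0ℤ
      du-x = cong₂ ℤ._+_ z (δ-other {u} {x} (λ { refl → x∉ (here refl) }))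
  ...   | k , _ , eq = u , here refl , λ zero → ne′ (begin
            coef (spokes x us ++ L) ((d ⊕ x ⊕* (u ∷ us)) ⊖ x)
          ≡⟨ coef-cong (spokes x us ++ L) (λ v → shift (d v) (δ x v) (δ u v) (mult us v)) ⟩
            coef (spokes x us ++ L) (d ⊕ u ⊕* us)
          ≡⟨ eq ⟩
            k ℤ.* coef L (d ⊕ u)
          ≡⟨ trans (cong (λ t → k ℤ.* t) zero) (ℤₚ.*-zeroʳ k) ⟩
            0ℤ ∎)
    where
      open ≡-Reasoning
      shift : ∀ a b c e → a ℤ.+ b ℤ.+ (c ℤ.+ e) ℤ.- b ≡ a ℤ.+ c ℤ.+ e
      shift = solve-∀
  spokes-one-forward x (u ∷ us) L d x∉ av z ne | inj₂ ne′
    with spokes-one-forward x us L d (x∉ ∘ there) av z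
           (λ zero → ne′ (trans (coef-cong (spokes x us ++ L) (λ v → shift (d v) (δ x v) (δ u v) (mult us v))) zero))
    where
      shift : ∀ a b c e → a ℤ.+ b ℤ.+ (c ℤ.+ e) ℤ.- c ≡ a ℤ.+ b ℤ.+ e
      shift = solve-∀
  ... | u′ , u′∈ , ne″ = u′ , there u′∈ , ne″

  -- The case distinction is made on a whole signed sum: the coefficient of x · ∏us · m/w in the
  -- spokes and L adds up, with signs, the coefficients of m·u/w in L over all u. If the sum
  -- vanishes, so does the one unwanted term of the first case; if not, some summand is nonzero and
  -- provides the u of the second.
  fan : ∀ x b w us L d → x ∉ us → Avoids x L → x ≢ b → x ≢ w → b ∉ us → Unique us →
    coef L d ≢ 0ℤ → d b ≡ 0ℤ →
    ∃ λ d′ → coef ((x , b) ∷ (x , w) ∷ spokes x us ++ L) d′ ≢ 0ℤ ×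
      d′ x ℤ.≤ + 2 ×
      (∀ v → v ≢ x → v ∉ us → d′ v ≡ d v) ×
      (∀ v → v ≢ x → d′ v ℤ.≤ d v ℤ.+ + 2)
  fan x b w us L d x∉ av x≢b x≢w b∉ uq ne db = go (coef Q ((d ⊖ w) ⊕ x ⊕* us) ℤ.≟ 0ℤ)
    where
      open ≡-Reasoning
      Q = spokes x us ++ L
      dx : d x ≡ 0ℤ
      dx = coef-avoids L d ne x av
      dwx : (d ⊖ w) x ≡ 0ℤ
      dwx = cong₂ ℤ._-_ dx (δ-other {w} {x} (λ { refl → x≢w refl }))

      -- As b has exponent zero, the factor of xb has to supply x.
      drop-b : ∀ d′ → d′ b ≡ 0ℤ → coef ((x , w) ∷ Q) (d′ ⊖ x) ≢ 0ℤ → coef ((x , b) ∷ (x , w) ∷ Q) d′ ≢ 0ℤ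
      drop-b d′ z ne′ eq = ne′ (begin
          coef ((x , w) ∷ Q) (d′ ⊖ x)
        ≡⟨ sym (ℤₚ.+-identityʳ _) ⟩
          coef ((x , w) ∷ Q) (d′ ⊖ x) ℤ.+ 0ℤ
        ≡⟨ cong (λ t → coef ((x , w) ∷ Q) (d′ ⊖ x) ℤ.+ t) (sym (trans
             (cong (λ t → sgn x b ℤ.* t) (coef-neg ((x , w) ∷ Q) (d′ ⊖ b) b (cong₂ ℤ._-_ z (δ-self b))))
             (ℤₚ.*-zeroʳ (sgn x b)))) ⟩
          coef ((x , b) ∷ (x , w) ∷ Q) d′
        ≡⟨ eq ⟩
          0ℤ ∎)

      go : Dec (coef Q ((d ⊖ w) ⊕ x ⊕* us) ≡ 0ℤ) → _
      go (yes vanish) = d′ , drop-b d′ d′b ne′ , d′x , other , bound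
        where
          -- Here xb and xw both supply x. If xw supplied w instead, one x would be left to the
          -- spokes, and that contribution is the vanishing sum.
          d′ = (d ⊕* us) ⊕ x ⊕ x
          d′b : d′ b ≡ 0ℤ
          d′b rewrite db | mult-∉ us b∉ | δ-other x≢b = refl
          d′x : d′ x ℤ.≤ + 2
          d′x rewrite dx | mult-∉ us x∉ | δ-self x = ℤₚ.≤-refl
          other : ∀ v → v ≢ x → v ∉ us → d′ v ≡ d v
          other v v≢x v∉ rewrite mult-∉ us v∉ | δ-other (v≢x ∘ sym) =
            trans (ℤₚ.+-identityʳ _) (trans (ℤₚ.+-identityʳ _) (ℤₚ.+-identityʳ _))
          bound : ∀ v → v ≢ x → d′ v ℤ.≤ d v ℤ.+ + 2
          bound v v≢x rewrite δ-other (v≢x ∘ sym) | ℤₚ.+-identityʳ (d v ℤ.+ mult us v)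
            | ℤₚ.+-identityʳ (d v ℤ.+ mult us v) =
            ℤₚ.+-monoʳ-≤ (d v) (ℤₚ.≤-trans (mult-unique us uq v) (ℤ.+≤+ (s≤s z≤n)))
          shift₁ : ∀ a b c → a ℤ.+ b ℤ.+ c ℤ.+ c ℤ.- c ℤ.- c ≡ a ℤ.+ b
          shift₁ = solve-∀
          shift₂ : ∀ a b c e → a ℤ.+ b ℤ.+ c ℤ.+ c ℤ.- c ℤ.- e ≡ a ℤ.- e ℤ.+ c ℤ.+ b
          shift₂ = solve-∀
          ne′ : coef ((x , w) ∷ Q) (d′ ⊖ x) ≢ 0ℤ
          ne′ eq with spokes-reversed x us L d x∉ dx
          ... | k , k≢0 , eqk = *-≢0 k≢0 ne (begin
              k ℤ.* coef L d              ≡⟨ sym eqk ⟩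
              coef Q (d ⊕* us)            ≡⟨ sym (ℤₚ.+-identityʳ _) ⟩
              coef Q (d ⊕* us) ℤ.+ 0ℤ     ≡⟨ cong₂ ℤ._+_
                                              (sym (coef-cong Q (λ v → shift₁ (d v) (mult us v) (δ x v))))
                                              (sym (trans (cong (λ t → sgn x w ℤ.* t)
                                                (trans (coef-cong Q (λ v → shift₂ (d v) (mult us v) (δ x v) (δ w v))) vanish))
                                                (ℤₚ.*-zeroʳ (sgn x w)))) ⟩
              coef ((x , w) ∷ Q) (d′ ⊖ x) ≡⟨ eq ⟩
              0ℤ                          ∎)
      go (no nonzero) with spokes-one-forward x us L (d ⊖ w) x∉ av dwx nonzero
      ... | u , u∈ , neu = d′ , drop-b d′ d′b ne′ , d′x , other , bound
        where
          -- The single x is used up by xb, so xw has to supply w; L then supplies one w less and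
          -- one u more.
          d′ = (d ⊕ u ⊕* us) ⊕ x
          d′b : d′ b ≡ 0ℤ
          d′b rewrite db | δ-other {u} {b} (λ { refl → b∉ u∈ }) | mult-∉ us b∉ | δ-other x≢b = refl
          u≢x : u ≢ x
          u≢x refl = x∉ u∈
          d′x : d′ x ℤ.≤ + 2
          d′x rewrite dx | δ-other u≢x | mult-∉ us x∉ | δ-self x = ℤ.+≤+ (s≤s z≤n)
          other : ∀ v → v ≢ x → v ∉ us → d′ v ≡ d v
          other v v≢x v∉ rewrite δ-other {u} {v} (λ { refl → v∉ u∈ }) | mult-∉ us v∉ | δ-other (v≢x ∘ sym) =
            trans (ℤₚ.+-identityʳ _) (trans (ℤₚ.+-identityʳ _) (ℤₚ.+-identityʳ _))
          bound : ∀ v → v ≢ x → d′ v ℤ.≤ d v ℤ.+ + 2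
          bound v v≢x rewrite δ-other (v≢x ∘ sym) | ℤₚ.+-identityʳ (d v ℤ.+ δ u v ℤ.+ mult us v)
            | ℤₚ.+-assoc (d v) (δ u v) (mult us v) =
            ℤₚ.+-monoʳ-≤ (d v) (ℤₚ.+-mono-≤ (δ≤1 u v) (mult-unique us uq v))
          shift₁ : ∀ a b c e → a ℤ.+ b ℤ.+ c ℤ.+ e ℤ.- e ℤ.- e ≡ a ℤ.+ b ℤ.+ c ℤ.- e
          shift₁ = solve-∀
          shift₂ : ∀ a b c e f → a ℤ.+ b ℤ.+ c ℤ.+ e ℤ.- e ℤ.- f ≡ a ℤ.- f ℤ.+ b ℤ.+ c
          shift₂ = solve-∀
          dwux : (d ⊖ w ⊕ u) x ≡ 0ℤ
          dwux = cong₂ ℤ._+_ dwx (δ-other u≢x)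
          negative : (d′ ⊖ x ⊖ x) x ≡ -1ℤ
          negative rewrite dx | δ-other u≢x | mult-∉ us x∉ | δ-self x = refl
          ne′ : coef ((x , w) ∷ Q) (d′ ⊖ x) ≢ 0ℤ
          ne′ eq with spokes-reversed x us L (d ⊖ w ⊕ u) x∉ dwux
          ... | k , k≢0 , eqk = sgn-≢0 x w (*-≢0 k≢0 neu) (begin
              sgn x w ℤ.* (k ℤ.* coef L (d ⊖ w ⊕ u))    ≡⟨ cong (λ t → sgn x w ℤ.* t) (sym eqk) ⟩
              sgn x w ℤ.* coef Q (d ⊖ w ⊕ u ⊕* us)      ≡⟨ sym (ℤₚ.+-identityˡ _) ⟩
              0ℤ ℤ.+ sgn x w ℤ.* coef Q (d ⊖ w ⊕ u ⊕* us)
                ≡⟨ cong₂ (λ s t → s ℤ.+ sgn x w ℤ.* t) (sym (coef-neg Q _ x negative))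
                     (sym (coef-cong Q (λ v → shift₂ (d v) (δ u v) (mult us v) (δ x v) (δ w v)))) ⟩
              coef ((x , w) ∷ Q) (d′ ⊖ x)               ≡⟨ eq ⟩
              0ℤ                                        ∎)

-- Eulerian subdigraphs as terms of a coefficient

module Orientations {n : ℕ} (σ : Fin n → Fin n → Bool) where
  open Monomials σ

  sumOver : ∀ {A : Set} → (A → ℤ) → List A → ℤ
  sumOver f [] = 0ℤ
  sumOver f (x ∷ xs) = f x ℤ.+ sumOver f xs

  sumOver-++ : ∀ {A : Set} (f : A → ℤ) xs ys → sumOver f (xs ++ ys) ≡ sumOver f xs ℤ.+ sumOver f ys
  sumOver-++ f [] ys = sym (ℤₚ.+-identityˡ _)
  sumOver-++ f (x ∷ xs) ys = trans (cong (λ t → f x ℤ.+ t) (sumOver-++ f xs ys))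
                               (sym (ℤₚ.+-assoc (f x) _ _))

  sumOver-map : ∀ {A B : Set} (f : A → ℤ) (f′ : B → ℤ) (g : B → A) (k : ℤ) →
    (∀ x → f (g x) ≡ k ℤ.* f′ x) → ∀ xs → sumOver f (map g xs) ≡ k ℤ.* sumOver f′ xs
  sumOver-map f f′ g k eq [] = sym (ℤₚ.*-zeroʳ k)
  sumOver-map f f′ g k eq (x ∷ xs) =
    trans (cong₂ ℤ._+_ (eq x) (sumOver-map f f′ g k eq xs)) (sym (ℤₚ.*-distribˡ-+ k _ _))

  sumOver-cong : ∀ {A : Set} {f g : A → ℤ} → (∀ x → f x ≡ g x) → ∀ xs → sumOver f xs ≡ sumOver g xs
  sumOver-cong eq [] = refl
  sumOver-cong eq (x ∷ xs) = cong₂ ℤ._+_ (eq x) (sumOver-cong eq xs)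

  net : List E → V → ℤ
  net [] v = 0ℤ
  net ((a , b) ∷ S) v = δ a v ℤ.- δ b v ℤ.+ net S v

  tails : List E → V → ℤ
  tails [] v = 0ℤ
  tails ((a , b) ∷ S) v = δ a v ℤ.+ tails S v

  weight : List E → ℤ
  weight [] = 1ℤ
  weight ((a , b) ∷ S) = sgn a b ℤ.* weight S

  -- To expand the product over a list A of arcs is to choose the set S of arcs that supply their
  -- heads, the others supplying their tails. This is the contribution of the choice S, where e is
  -- the excess of the outdegrees in A over the wanted exponents.
  term : (V → ℤ) → List E → ℤ
  term e S = indicator (zero? (λ v → net S v ℤ.- e v)) ℤ.* weight S

  private
    term-cong : ∀ {e e′} → (∀ v → e v ≡ e′ v) → ∀ S → term e S ≡ term e′ S
    term-cong eq S = cong (ℤ._* weight S) (indicator-⇔ (zero? _) (zero? _)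
      (λ z v → trans (cong (λ t → net S v ℤ.- t) (sym (eq v))) (z v))
      (λ z v → trans (cong (λ t → net S v ℤ.- t) (eq v)) (z v)))

    term-∷ : ∀ e a b S → term e ((a , b) ∷ S) ≡ sgn a b ℤ.* term (e ⊖ a ⊕ b) S
    term-∷ e a b S = trans
      (cong (ℤ._* (sgn a b ℤ.* weight S)) (indicator-⇔ (zero? _) (zero? _)
        (λ z v → trans (sym (lemma (δ a v) (δ b v) (net S v) (e v))) (z v))
        (λ z v → trans (lemma (δ a v) (δ b v) (net S v) (e v)) (z v))))
      (reorder (indicator (zero? _)) (sgn a b) (weight S))
      where
        lemma : ∀ a b s e → a ℤ.- b ℤ.+ s ℤ.- e ≡ s ℤ.- (e ℤ.- a ℤ.+ b)
        lemma = solve-∀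
        reorder : ∀ i s w → i ℤ.* (s ℤ.* w) ≡ s ℤ.* (i ℤ.* w)
        reorder = solve-∀

  -- Reversing the arcs of S changes the outdegrees by - net S.
  coef-subsets : ∀ A d → coef A d ≡ sumOver (term (λ v → tails A v ℤ.- d v)) (subsets A)
  coef-subsets [] d = trans
    (indicator-⇔ (zero? d) (zero? _)
      (λ z v → cong (λ t → 0ℤ ℤ.- (0ℤ ℤ.- t)) (z v))
      (λ z v → trans (sym (double (d v))) (z v)))
    (sym (trans (ℤₚ.+-identityʳ _) (ℤₚ.*-identityʳ _)))
    where
      double : ∀ x → 0ℤ ℤ.- (0ℤ ℤ.- x) ≡ x
      double = solve-∀
  coef-subsets ((a , b) ∷ A) d = begin
      coef A (d ⊖ a) ℤ.+ sgn a b ℤ.* coef A (d ⊖ b)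
    ≡⟨ cong₂ (λ s t → s ℤ.+ sgn a b ℤ.* t) (coef-subsets A (d ⊖ a)) (coef-subsets A (d ⊖ b)) ⟩
      sumOver (term (λ v → tails A v ℤ.- (d ⊖ a) v)) (subsets A) ℤ.+
      sgn a b ℤ.* sumOver (term (λ v → tails A v ℤ.- (d ⊖ b) v)) (subsets A)
    ≡⟨ cong₂ ℤ._+_ (sumOver-cong (term-cong (λ v → kept (tails A v) (d v) (δ a v))) (subsets A))
         (sym (sumOver-map (term e) _ ((a , b) ∷_) (sgn a b)
           (λ S → trans (term-∷ e a b S)
             (cong (λ t → sgn a b ℤ.* t) (term-cong (λ v → flipped (tails A v) (d v) (δ a v) (δ b v)) S)))
           (subsets A))) ⟩
      sumOver (term e) (subsets A) ℤ.+ sumOver (term e) (map ((a , b) ∷_) (subsets A))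
    ≡⟨ trans (ℤₚ.+-comm _ (sumOver (term e) (map ((a , b) ∷_) (subsets A))))
         (sym (sumOver-++ (term e) (map ((a , b) ∷_) (subsets A)) (subsets A))) ⟩
      sumOver (term e) (subsets ((a , b) ∷ A)) ∎
    where
      open ≡-Reasoning
      e : V → ℤ
      e v = tails ((a , b) ∷ A) v ℤ.- d v
      kept : ∀ t d a → t ℤ.- (d ℤ.- a) ≡ a ℤ.+ t ℤ.- d
      kept = solve-∀
      flipped : ∀ t d a b → a ℤ.+ t ℤ.- d ℤ.- a ℤ.+ b ≡ t ℤ.- (d ℤ.- b)
      flipped = solve-∀

  private
    all-true : ∀ {A : Set} (p : A → Bool) xs → (∀ x → x ∈ xs → p x ≡ true) → all p xs ≡ true
    all-true p [] h = refl
    all-true p (x ∷ xs) h rewrite h x (here refl) = all-true p xs (λ y y∈ → h y (there y∈))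

    true-all : ∀ {A : Set} (p : A → Bool) xs → all p xs ≡ true → ∀ x → x ∈ xs → p x ≡ true
    true-all p (x ∷ xs) h y y∈ with p x in eq
    true-all p (x ∷ xs) h y (here refl) | true = eq
    true-all p (x ∷ xs) h y (there y∈) | true = true-all p xs h y y∈
    true-all p (x ∷ xs) () y y∈ | false

    ≡ᵇ-true : ∀ a b → a ≡ b → (a ≡ᵇ b) ≡ true
    ≡ᵇ-true zero zero _ = refl
    ≡ᵇ-true (suc a) (suc b) eq = ≡ᵇ-true a b (ℕₚ.suc-injective eq)

    true-≡ᵇ : ∀ a b → (a ≡ᵇ b) ≡ true → a ≡ b
    true-≡ᵇ zero zero _ = refl
    true-≡ᵇ (suc a) (suc b) eq = cong suc (true-≡ᵇ a b eq)

  outdegree indegree : List E → V → ℕ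
  outdegree S v = countᵇ (λ p → ⌊ proj₁ p ≟ v ⌋) S
  indegree S v = countᵇ (λ p → ⌊ proj₂ p ≟ v ⌋) S

  tails-outdegree : ∀ S v → tails S v ≡ + outdegree S v
  tails-outdegree [] v = refl
  tails-outdegree ((a , b) ∷ S) v with a ≟ v
  ... | yes _ = cong (λ t → 1ℤ ℤ.+ t) (tails-outdegree S v)
  ... | no _ = trans (ℤₚ.+-identityˡ _) (tails-outdegree S v)

  net-degrees : ∀ S v → net S v ≡ + outdegree S v ℤ.- + indegree S v
  net-degrees [] v = refl
  net-degrees ((a , b) ∷ S) v with a ≟ v | b ≟ v | net-degrees S v
  ... | yes _ | yes _ | eq = trans (cong (λ t → 0ℤ ℤ.+ t) eq) (lemma (+ outdegree S v) (+ indegree S v))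
    where
      lemma : ∀ o i → 0ℤ ℤ.+ (o ℤ.- i) ≡ (1ℤ ℤ.+ o) ℤ.- (1ℤ ℤ.+ i)
      lemma = solve-∀
  ... | yes _ | no _ | eq = trans (cong (λ t → 1ℤ ℤ.+ t) eq) (lemma (+ outdegree S v) (+ indegree S v))
    where
      lemma : ∀ o i → 1ℤ ℤ.+ (o ℤ.- i) ≡ (1ℤ ℤ.+ o) ℤ.- i
      lemma = solve-∀
  ... | no _ | yes _ | eq = trans (cong (λ t → -1ℤ ℤ.+ t) eq) (lemma (+ outdegree S v) (+ indegree S v))
    where
      lemma : ∀ o i → -1ℤ ℤ.+ (o ℤ.- i) ≡ o ℤ.- (1ℤ ℤ.+ i)
      lemma = solve-∀
  ... | no _ | no _ | eq = trans (ℤₚ.+-identityˡ _) eq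

  isEulerian-net : ∀ S → isEulerian S ≡ true → ∀ v → net S v ≡ 0ℤ
  isEulerian-net S eq v = trans (net-degrees S v)
    (trans (cong (λ t → + t ℤ.- + indegree S v)
      (true-≡ᵇ (outdegree S v) (indegree S v) (true-all _ (allFin n) eq v (∈-allFin v))))
      (ℤₚ.+-inverseʳ (+ indegree S v)))

  net-isEulerian : ∀ S → (∀ v → net S v ≡ 0ℤ) → isEulerian S ≡ true
  net-isEulerian S z = all-true _ (allFin n) (λ v _ → ≡ᵇ-true (outdegree S v) (indegree S v)
    (ℤₚ.+-injective (ℤₚ.i-j≡0⇒i≡j _ _ (trans (sym (net-degrees S v)) (z v)))))

  isEvenᵇ-suc : ∀ k → isEvenᵇ (suc k) ≡ not (isEvenᵇ k)
  isEvenᵇ-suc zero = refl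
  isEvenᵇ-suc (suc zero) = refl
  isEvenᵇ-suc (suc (suc k)) = isEvenᵇ-suc k

  weight-parity : ∀ S → weight S ≡ (if isEvenᵇ (positives σ S) then 1ℤ else -1ℤ)
  weight-parity [] = refl
  weight-parity ((a , b) ∷ S) with σ a b
  ... | false = trans (ℤₚ.*-identityˡ _) (weight-parity S)
  ... | true rewrite isEvenᵇ-suc (positives σ S) | weight-parity S with isEvenᵇ (positives σ S)
  ...   | true = refl
  ...   | false = refl

  private
    evens odds : List (List E) → ℕ
    evens Ss = countᵇ (λ S → isEvenᵇ (positives σ S)) (filterᵇ isEulerian Ss)
    odds Ss = countᵇ (λ S → not (isEvenᵇ (positives σ S))) (filterᵇ isEulerian Ss)

    excess : ∀ (f : List E → ℤ) →
      (∀ S → isEulerian S ≡ false → f S ≡ 0ℤ) →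
      (∀ S → isEulerian S ≡ true → f S ≡ (if isEvenᵇ (positives σ S) then 1ℤ else -1ℤ)) →
      ∀ Ss → sumOver f Ss ≡ + evens Ss ℤ.- + odds Ss
    excess f f₀ f₁ [] = refl
    excess f f₀ f₁ (S ∷ Ss) with isEulerian S in eq
    ... | false = trans (cong₂ ℤ._+_ (f₀ S eq) (excess f f₀ f₁ Ss)) (ℤₚ.+-identityˡ _)
    ... | true with isEvenᵇ (positives σ S) | f₁ S eq
    ...   | true | eq′ = trans (cong₂ ℤ._+_ eq′ (excess f f₀ f₁ Ss)) (lemma (+ evens Ss) (+ odds Ss))
      where
        lemma : ∀ o i → 1ℤ ℤ.+ (o ℤ.- i) ≡ (1ℤ ℤ.+ o) ℤ.- i
        lemma = solve-∀
    ...   | false | eq′ = trans (cong₂ ℤ._+_ eq′ (excess f f₀ f₁ Ss)) (lemma (+ evens Ss) (+ odds Ss))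
      where
        lemma : ∀ o i → -1ℤ ℤ.+ (o ℤ.- i) ≡ o ℤ.- (1ℤ ℤ.+ i)
        lemma = solve-∀

  -- For the outdegrees of D itself the excess is zero, so exactly the Eulerian subsets contribute,
  -- each with the parity sign of its positive edges.
  coef-Eulerian : ∀ {G : SimpleGraph n} {a b} (D : OrientationMinus G a b) →
    coef (arcs D) (tails (arcs D)) ≡ + σEE σ D ℤ.- + σOE σ D
  coef-Eulerian D = trans (coef-subsets (arcs D) (tails (arcs D)))
    (excess (term balanced) f₀ f₁ (subsets (arcs D)))
    where
      balanced : V → ℤ
      balanced v = tails (arcs D) v ℤ.- tails (arcs D) v
      drop-balanced : ∀ S v → net S v ℤ.- balanced v ≡ net S v
      drop-balanced S v = lemma (net S v) (tails (arcs D) v)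
        where
          lemma : ∀ s t → s ℤ.- (t ℤ.- t) ≡ s
          lemma = solve-∀
      f₀ : ∀ S → isEulerian S ≡ false → term balanced S ≡ 0ℤ
      f₀ S eq = trans (cong (ℤ._* weight S) (indicator-false (zero? _)
        (λ z → case≢ (trans (sym eq) (net-isEulerian S (λ v → trans (sym (drop-balanced S v)) (z v)))))))
        (ℤₚ.*-zeroˡ (weight S))
        where
          case≢ : false ≢ true
          case≢ ()
      f₁ : ∀ S → isEulerian S ≡ true → term balanced S ≡ (if isEvenᵇ (positives σ S) then 1ℤ else -1ℤ)
      f₁ S eq = trans (cong (ℤ._* weight S) (indicator-true (zero? _)
        (λ v → trans (drop-balanced S v) (isEulerian-net S eq v))))
        (trans (ℤₚ.*-identityˡ _) (weight-parity S))

  coef≢0⇒σEE≢σOE : ∀ {G : SimpleGraph n} {a b} (D : OrientationMinus G a b) →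
    coef (arcs D) (tails (arcs D)) ≢ 0ℤ → σEE σ D ≢ σOE σ D
  coef≢0⇒σEE≢σOE D ne eq = ne (trans (coef-Eulerian D)
    (trans (cong (λ t → + t ℤ.- + σOE σ D) eq) (ℤₚ.+-inverseʳ (+ σOE σ D))))

-- Lists, links and rotation systems

module Lists where

  unique-⊆-length : ∀ {A : Set} {xs ys : List A} → Unique xs → (∀ {x} → x ∈ xs → x ∈ ys) → length xs ≤ length ys
  unique-⊆-length [] _ = z≤n
  unique-⊆-length {xs = x ∷ xs} (x≢ ∷ uq) sub with ∈-∃++ (sub (here refl))
  ... | l , r , refl = subst (suc (length xs) ≤_) (sym length-eq) (s≤s (unique-⊆-length uq sub′))
    where
      length-eq : length (l ++ x ∷ r) ≡ suc (length (l ++ r))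
      length-eq rewrite length-++ l {x ∷ r} | length-++ l {r} = ℕₚ.+-suc (length l) (length r)
      sub′ : ∀ {z} → z ∈ xs → z ∈ l ++ r
      sub′ z∈ with ∈-++⁻ l (sub (there z∈))
      ... | inj₁ z∈l = ∈-++⁺ˡ z∈l
      ... | inj₂ (here refl) = ⊥-elim (All.lookup x≢ z∈ refl)
      ... | inj₂ (there z∈r) = ∈-++⁺ʳ l z∈r

  module _ {A : Set} {P Q : A → Set} (P? : Decidable P) (Q? : Decidable Q) (P⊆Q : ∀ {x} → P x → Q x) where

    length-filter-≤ : ∀ xs → length (filter P? xs) ≤ length (filter Q? xs)
    length-filter-≤ [] = z≤n
    length-filter-≤ (x ∷ xs) with P? x | Q? x
    ... | yes _ | yes _ = s≤s (length-filter-≤ xs)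
    ... | yes p | no ¬q = ⊥-elim (¬q (P⊆Q p))
    ... | no _ | yes _ = ℕₚ.m≤n⇒m≤1+n (length-filter-≤ xs)
    ... | no _ | no _ = length-filter-≤ xs

    length-filter-< : ∀ {x} xs → x ∈ xs → Q x → ¬ P x → length (filter P? xs) < length (filter Q? xs)
    length-filter-< (x ∷ xs) (here refl) q ¬p with P? x | Q? x
    ... | yes p | _ = ⊥-elim (¬p p)
    ... | no _ | yes _ = s≤s (length-filter-≤ xs)
    ... | no _ | no ¬q = ⊥-elim (¬q q)
    length-filter-< (y ∷ xs) (there x∈) q ¬p with P? y | Q? y
    ... | yes _ | yes _ = s≤s (length-filter-< xs x∈ q ¬p)
    ... | yes p | no ¬q = ⊥-elim (¬q (P⊆Q p))
    ... | no _ | yes _ = ℕₚ.m≤n⇒m≤1+n (length-filter-< xs x∈ q ¬p)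
    ... | no _ | no _ = length-filter-< xs x∈ q ¬p

  ∈-filterᵇ⁺ : ∀ {A : Set} (p : A → Bool) {x xs} → x ∈ xs → p x ≡ true → x ∈ filterᵇ p xs
  ∈-filterᵇ⁺ p x∈ px = ∈-filter⁺ _ x∈ (subst T (sym px) _)

  ∈-filterᵇ⁻ : ∀ {A : Set} (p : A → Bool) {x xs} → x ∈ filterᵇ p xs → x ∈ xs × p x ≡ true
  ∈-filterᵇ⁻ p {xs = xs} x∈ with ∈-filter⁻ (λ x → Boolₚ.T? (p x)) {xs = xs} x∈
  ... | x∈xs , t = x∈xs , T-true t
    where
      T-true : ∀ {b} → T b → b ≡ true
      T-true {true} _ = refl

  links : ∀ {A : Set} → List A → List (A × A)
  links [] = []
  links (x ∷ []) = []
  links (x ∷ y ∷ l) = (x , y) ∷ links (y ∷ l)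

  -- The darts of the closed walk through a list. A singleton yields a loop, and a pair yields both
  -- darts of one edge, which is how a degenerate disk is bounded.
  clinks : ∀ {A : Set} → List A → List (A × A)
  clinks [] = []
  clinks (b ∷ q) = links (b ∷ q ++ b ∷ [])

  module _ {A : Set} where

    links-++⁺ˡ : ∀ {e} l {w : A} r → e ∈ links (l ++ w ∷ []) → e ∈ links (l ++ w ∷ r)
    links-++⁺ˡ (x ∷ []) r (here eq) = here eq
    links-++⁺ˡ (x ∷ y ∷ l) r (here eq) = here eq
    links-++⁺ˡ (x ∷ y ∷ l) r (there e∈) = there (links-++⁺ˡ (y ∷ l) r e∈)

    links-++ : ∀ {e} (l : List A) {r} → e ∈ links l → e ∈ links (l ++ r)
    links-++ (x ∷ y ∷ l) (here eq) = here eq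
    links-++ (x ∷ y ∷ l) (there e∈) = there (links-++ (y ∷ l) e∈)

    links⊆clinks : ∀ {e} (p : List A) → e ∈ links p → e ∈ clinks p
    links⊆clinks (b ∷ q) = links-++ (b ∷ q)

    links-∷ : ∀ {e} {x : A} l → e ∈ links l → e ∈ links (x ∷ l)
    links-∷ (y ∷ l) e∈ = there e∈

    links-++⁺ʳ : ∀ {e} (l : List A) {r} → e ∈ links r → e ∈ links (l ++ r)
    links-++⁺ʳ [] e∈ = e∈
    links-++⁺ʳ (x ∷ l) e∈ = links-∷ (l ++ _) (links-++⁺ʳ l e∈)

    links-++⁻ : ∀ {e} l {w : A} r → e ∈ links (l ++ w ∷ r) → e ∈ links (l ++ w ∷ []) ⊎ e ∈ links (w ∷ r)
    links-++⁻ [] r e∈ = inj₂ e∈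
    links-++⁻ (x ∷ []) r (here eq) = inj₁ (here eq)
    links-++⁻ (x ∷ []) r (there e∈) = inj₂ e∈
    links-++⁻ (x ∷ y ∷ l) r (here eq) = inj₁ (here eq)
    links-++⁻ (x ∷ y ∷ l) r (there e∈) with links-++⁻ (y ∷ l) r e∈
    ... | inj₁ e∈l = inj₁ (there e∈l)
    ... | inj₂ e∈r = inj₂ e∈r

    links-source : ∀ {u v : A} l {z} → (u , v) ∈ links (l ++ z ∷ []) → u ∈ l
    links-source (x ∷ []) (here refl) = here refl
    links-source (x ∷ y ∷ l) (here refl) = here refl
    links-source (x ∷ y ∷ l) (there e∈) = there (links-source (y ∷ l) e∈)

    links-target : ∀ {u v x : A} l → (u , v) ∈ links (x ∷ l) → v ∈ l
    links-target (y ∷ l) (here refl) = here refl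
    links-target (y ∷ l) (there e∈) = there (links-target l e∈)

    links-source-unique : ∀ {u v v′ : A} l {z} → Unique l →
      (u , v) ∈ links (l ++ z ∷ []) → (u , v′) ∈ links (l ++ z ∷ []) → v ≡ v′
    links-source-unique (x ∷ []) _ (here refl) (here refl) = refl
    links-source-unique (x ∷ y ∷ l) _ (here refl) (here refl) = refl
    links-source-unique (x ∷ y ∷ l) (x≢ ∷ _) (here refl) (there e∈) =
      ⊥-elim (All.lookup x≢ (links-source (y ∷ l) e∈) refl)
    links-source-unique (x ∷ y ∷ l) (x≢ ∷ _) (there e∈) (here refl) =
      ⊥-elim (All.lookup x≢ (links-source (y ∷ l) e∈) refl)
    links-source-unique (x ∷ y ∷ l) (_ ∷ uq) (there e∈) (there e∈′) = links-source-unique (y ∷ l) uq e∈ e∈′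

    clinks-source : ∀ {u v : A} p → (u , v) ∈ clinks p → u ∈ p
    clinks-source (b ∷ q) = links-source (b ∷ q)

    clinks-source-unique : ∀ {u v v′ : A} p → Unique p → (u , v) ∈ clinks p → (u , v′) ∈ clinks p → v ≡ v′
    clinks-source-unique (b ∷ q) = links-source-unique (b ∷ q)

    successor : ∀ {u : A} l {z} → u ∈ l → ∃ λ v → (u , v) ∈ links (l ++ z ∷ [])
    successor (x ∷ []) (here refl) = _ , here refl
    successor (x ∷ y ∷ l) (here refl) = y , here refl
    successor (x ∷ y ∷ l) (there u∈) with successor (y ∷ l) u∈
    ... | v , e∈ = v , there e∈

    csuccessor : ∀ {u : A} p → u ∈ p → ∃ λ v → (u , v) ∈ clinks p
    csuccessor (b ∷ q) = successor (b ∷ q)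

    unique-++⁻ : ∀ (l : List A) {r} → Unique (l ++ r) → Unique l × Unique r × (∀ {z} → z ∈ l → z ∉ r)
    unique-++⁻ [] uq = [] , uq , λ ()
    unique-++⁻ (x ∷ l) (x≢ ∷ uq) with unique-++⁻ l uq
    ... | ul , ur , disj =
      All.tabulate (λ z∈ → All.lookup x≢ (∈-++⁺ˡ z∈)) ∷ ul , ur ,
      λ { (here refl) z∈r → All.lookup x≢ (∈-++⁺ʳ l z∈r) refl ; (there z∈) → disj z∈ }

    unique-++⁺ : ∀ {l r : List A} → Unique l → Unique r → (∀ {z} → z ∈ l → z ∉ r) → Unique (l ++ r)
    unique-++⁺ ul ur disj = Unique.++⁺ ul ur (λ (z∈l , z∈r) → disj z∈l z∈r)

    infix 4 _∈~_
    _∈~_ : A × A → List (A × A) → Set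
    e ∈~ L = e ∈ L ⊎ swap e ∈ L

    ∈~-swap : ∀ {e L} → e ∈~ L → swap e ∈~ L
    ∈~-swap (inj₁ e∈) = inj₂ e∈
    ∈~-swap (inj₂ e∈) = inj₁ e∈

    infix 4 _≁_
    _≁_ : A × A → A × A → Set
    e ≁ f = e ≢ f × swap e ≢ f

    ∉~⇒≁ : ∀ {e L} → ¬ (e ∈~ L) → All (e ≁_) L
    ∉~⇒≁ e∉ = All.tabulate (λ f∈ → (λ { refl → e∉ (inj₁ f∈) }) , (λ { refl → e∉ (inj₂ f∈) }))

open Lists

-- Face sets, their boundaries, and forests

module Rotation {n : ℕ} (G : SimpleGraph n) (R : RotationSystem G) where

  V = Fin n
  E = V × V

  Adj : V → V → Set
  Adj u v = adj G u v ≡ true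

  adj-sym : ∀ {u v} → Adj u v → Adj v u
  adj-sym {u} {v} a = trans (symm G v u) a

  adj⇒≢ : ∀ {u v} → Adj u v → u ≢ v
  adj⇒≢ {u} a refl with trans (sym a) (irrefl G u)
  ... | ()

  r : V → V → V
  r = rot R

  r-adj : ∀ {u v} → Adj u v → Adj v (r v u)
  r-adj a = rot-adj R _ _ (adj-sym a)

  -- Sets of faces are represented by sets of darts closed under faceStep.
  Closed : (V → V → Bool) → Set
  Closed X = ∀ {u v} → Adj u v → X u v ≡ X v (r v u)

  -- Rotating around v from a to b, membership drops between some c and its successor `r v c`. As (c
  -- , v) and (v , `r v c`) belong to one face, the edge vc has X on one side only.
  leaving-dart : ∀ {X} → Closed X → ∀ {v a b} → Adj v a → Adj v b → X v a ≡ true → X v b ≡ false →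
    ∃ λ c → Adj v c × X v c ≡ true × X c v ≡ false
  leaving-dart {X} closed {v} {a} {b} aa ab Xa Xb with rot-cyclic R v a b aa ab
  ... | m , refl = go m Xb
    where
      adj-iter : ∀ m → Adj v (iter m (r v) a)
      adj-iter zero = aa
      adj-iter (suc m) = rot-adj R v _ (adj-iter m)
      go : ∀ m → X v (iter m (r v) a) ≡ false → _
      go zero Xm with trans (sym Xa) Xm
      ... | ()
      go (suc m) Xm with X v (iter m (r v) a) in eq
      ... | false = go m eq
      ... | true = iter m (r v) a , adj-iter m , eq , trans (closed (adj-sym (adj-iter m))) Xm

  not-closed : ∀ {X} → Closed X → Closed (λ u v → not (X u v))
  not-closed closed a = cong not (closed a)

  not-true : ∀ {b} → not b ≡ true → b ≡ false
  not-true {false} _ = refl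

  not-false : ∀ {b} → not b ≡ false → b ≡ true
  not-false {true} _ = refl

  -- This is `leaving-dart` for the complement: a boundary that enters v leaves it with X on the
  -- same side.
  boundary-continues : ∀ {X} → Closed X → ∀ {u v} → Adj u v → X v u ≡ true → X u v ≡ false →
    ∃ λ c → Adj v c × X c v ≡ true × X v c ≡ false
  boundary-continues {X} closed {u} {v} a Xvu Xuv
    with leaving-dart (not-closed closed) {v} {r v u} {u} (r-adj a) (adj-sym a)
           (cong not (trans (sym (closed a)) Xuv)) (cong not Xvu)
  ... | c , ac , Xvc , Xcv = c , ac , not-false Xcv , not-true Xvc

  -- The boundary cannot end at v: the edge on which it goes on is a different one, since X takes
  -- different values on the darts from v to u and to c.
  boundary-turns : ∀ {X} → Closed X → ∀ {u v} → Adj u v → X u v ≢ X v u →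
    ∃ λ c → c ≢ u × Adj v c × X v c ≢ X c v
  boundary-turns {X} closed {u} {v} a ne with X u v in eq | X v u in eq′
  ... | true | true = ⊥-elim (ne refl)
  ... | false | false = ⊥-elim (ne refl)
  ... | true | false with leaving-dart closed {v} {r v u} {u} (r-adj a) (adj-sym a) (trans (sym (closed a)) eq) eq′
  ...   | c , ac , Xvc , Xcv = c , (λ { refl → true≢false (trans (sym Xvc) eq′) }) , ac ,
            (λ e → true≢false (trans (sym Xvc) (trans e Xcv)))
    where
      true≢false : true ≢ false
      true≢false ()
  boundary-turns {X} closed {u} {v} a ne | false | true with boundary-continues closed a eq′ eq
  ...   | c , ac , Xcv , Xvc = c , (λ { refl → false≢true (trans (sym Xvc) eq′) }) , ac ,
            (λ e → false≢true (trans (sym Xvc) (trans e Xcv)))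
    where
      false≢true : false ≢ true
      false≢true ()

  -- Membership is now preserved by rotation around a vertex and by reversal of a dart, so one value
  -- spreads along the paths of the connected graph.
  no-boundary⇒constant : ∀ {X} → Closed X → Connected G → (∀ u v → Adj u v → X u v ≡ X v u) →
    ∀ u v u′ v′ → Adj u v → Adj u′ v′ → X u v ≡ X u′ v′
  no-boundary⇒constant {X} closed connected balanced u v u′ v′ a a′ = go (connected u u′) v a
    where
      rotate : ∀ u v → Adj u v → ∀ m → Adj u (iter m (r u) v) × X u v ≡ X u (iter m (r u) v)
      rotate u v a zero = a , refl
      rotate u v a (suc m) with rotate u v a m
      ... | am , eq = rot-adj R u _ am , trans eq (trans (balanced u _ am) (closed (adj-sym am)))
      around : ∀ u v w → Adj u v → Adj u w → X u v ≡ X u w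
      around u v w a a′ with rot-cyclic R u v w a a′
      ... | m , refl = proj₂ (rotate u v a m)
      go : ∀ {u} → Reachable G u u′ → ∀ v → Adj u v → X u v ≡ X u′ v′
      go here v a = around _ v v′ a a′
      go (step {u} {w} aw path) v a =
        trans (around u v w a aw) (trans (balanced u w aw) (go path u (adj-sym aw)))

  -- Grow W₀ W ts: the forest ts connects the vertices of W to those of W₀.
  data Grow (W₀ : List V) : List V → List E → Set where
    start : Grow W₀ W₀ []
    grow  : ∀ {W ts p v} → Grow W₀ W ts → p ∈ W → v ∉ W → Adj p v → Grow W₀ (v ∷ W) ((p , v) ∷ ts)

  grow-⊆ : ∀ {W₀ W ts} → Grow W₀ W ts → ∀ {v} → v ∈ W₀ → v ∈ W
  grow-⊆ start v∈ = v∈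
  grow-⊆ (grow g _ _ _) v∈ = there (grow-⊆ g v∈)

  grow-ends : ∀ {W₀ W ts} → Grow W₀ W ts → ∀ {u v} → (u , v) ∈ ts → u ∈ W × v ∈ W × v ∉ W₀
  grow-ends (grow g p∈ v∉ _) (here refl) = there p∈ , here refl , v∉ ∘ grow-⊆ g
  grow-ends (grow g _ _ _) (there e∈) with grow-ends g e∈
  ... | u∈ , v∈ , v∉ = there u∈ , there v∈ , v∉

  grow-adj : ∀ {W₀ W ts} → Grow W₀ W ts → ∀ {u v} → (u , v) ∈ ts → Adj u v
  grow-adj (grow _ _ _ a) (here refl) = a
  grow-adj (grow g _ _ _) (there e∈) = grow-adj g e∈

  grow-length : ∀ {W₀ W ts} → Grow W₀ W ts → length W ≡ length ts + length W₀
  grow-length start = refl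
  grow-length (grow g _ _ _) = cong suc (grow-length g)

  grow-unique : ∀ {W₀ W ts} → Grow W₀ W ts → AllPairs _≁_ ts
  grow-unique start = []
  grow-unique (grow g p∈ v∉ _) =
    ∉~⇒≁ (λ { (inj₁ e∈) → v∉ (proj₁ (proj₂ (grow-ends g e∈))) ; (inj₂ e∈) → v∉ (proj₁ (grow-ends g e∈)) })
    ∷ grow-unique g

  grow-trans : ∀ {W₀ W₁ W₂ ts₁ ts₂} → Grow W₀ W₁ ts₁ → Grow W₁ W₂ ts₂ → Grow W₀ W₂ (ts₂ ++ ts₁)
  grow-trans g start = g
  grow-trans g (grow g′ p∈ v∉ a) = grow (grow-trans g g′) p∈ v∉ a

  grow-path : ∀ {W₀ W ts} y l → Grow W₀ W ts → y ∈ W → Unique l → (∀ {z} → z ∈ l → z ∉ W) →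
    (∀ {u v} → (u , v) ∈ links (y ∷ l) → Adj u v) →
    ∃₂ λ W′ ts′ → Grow W₀ W′ ts′ × (∀ {z} → z ∈ W ⊎ z ∈ l → z ∈ W′) ×
      (∀ {e} → e ∈ ts′ → e ∈ ts ⊎ e ∈ links (y ∷ l))
  grow-path y [] g y∈ _ _ _ = _ , _ , g , [ id , (λ ()) ]′ , inj₁
  grow-path y (z ∷ l) g y∈ (z≢ ∷ uq) new a
    with grow-path z l (grow g y∈ (new (here refl)) (a (here refl))) (here refl) uq
           (λ z′∈ → λ { (here refl) → All.lookup z≢ z′∈ refl ; (there z′∈W) → new (there z′∈) z′∈W })
           (a ∘ there)
  ... | W′ , ts′ , g′ , sup , sub = W′ , ts′ , g′ ,
    (λ { (inj₁ z∈) → sup (inj₁ (there z∈))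
       ; (inj₂ (here refl)) → sup (inj₁ (here refl))
       ; (inj₂ (there z∈)) → sup (inj₂ z∈) }) ,
    (λ e∈ → [ (λ { (here refl) → inj₂ (here refl) ; (there e∈ts) → inj₁ e∈ts }) , inj₂ ∘ there ]′ (sub e∈))

  open import Data.List.Membership.DecPropositional (_≟_ {n}) using (_∈?_)

  grow-reach : ∀ {W₀ W ts u v} → Grow W₀ W ts → u ∈ W → Reachable G u v →
    ∃₂ λ W′ ts′ → Grow W₀ W′ ts′ × v ∈ W′ × (∀ {z} → z ∈ W → z ∈ W′)
  grow-reach g u∈ here = _ , _ , g , u∈ , id
  grow-reach {W = W} g u∈ (step {w = w} a path) with w ∈? W
  ... | yes w∈ = grow-reach g w∈ path
  ... | no w∉ with grow-reach (grow g u∈ w∉ a) (here refl) path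
  ...   | W′ , ts′ , g′ , v∈ , sup = W′ , ts′ , g′ , v∈ , sup ∘ there

  grow-spanning : Connected G → ∀ {W x} → x ∈ W → ∃₂ λ W′ ts → Grow W W′ ts × (∀ v → v ∈ W′)
  grow-spanning connected {W} {x} x∈ with go (allFin n)
    where
      go : ∀ vs → ∃₂ λ W′ ts → Grow W W′ ts × (∀ {v} → v ∈ vs → v ∈ W′)
      go [] = W , [] , start , λ ()
      go (v ∷ vs) with go vs
      ... | W′ , ts , g , all with grow-reach g (grow-⊆ g x∈) (connected x v)
      ...   | W″ , ts′ , g′ , v∈ , sup = W″ , ts′ , g′ , λ { (here refl) → v∈ ; (there z∈) → sup (all z∈) }
  ... | W′ , ts , g , all = W′ , ts , g , λ v → all (∈-allFin v)

  -- A forest edge in the boundary would let it dead-end at the leaf added last.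
  boundary-avoids-forest : ∀ {X} → Closed X → ∀ {W₀ W ts} → Grow W₀ W ts → (B : V → V → Set) →
    (∀ {u v} → B u v → u ∈ W₀ × v ∈ W₀) →
    (∀ {u v} → Adj u v → X u v ≢ X v u → B u v ⊎ (u , v) ∈~ ts) →
    ∀ {u v} → Adj u v → X u v ≢ X v u → B u v
  boundary-avoids-forest closed start B BW sub a ne with sub a ne
  ... | inj₁ b = b
  ... | inj₂ (inj₁ ())
  ... | inj₂ (inj₂ ())
  boundary-avoids-forest {X} closed (grow {W} {ts} {p} {v} g p∈ v∉ ap) B BW sub =
      boundary-avoids-forest closed g B BW sub′
    where
      p≢v : p ≢ v
      p≢v = adj⇒≢ ap
      leaf : ¬ (X p v ≢ X v p)
      leaf ne with boundary-turns closed ap ne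
      ... | c , c≢p , ac , nec with sub ac nec
      ...   | inj₁ b = v∉ (grow-⊆ g (proj₁ (BW b)))
      ...   | inj₂ (inj₁ (here eq)) = p≢v (sym (,-injectiveˡ eq))
      ...   | inj₂ (inj₁ (there e∈)) = v∉ (proj₁ (grow-ends g e∈))
      ...   | inj₂ (inj₂ (here eq)) = c≢p (,-injectiveˡ eq)
      ...   | inj₂ (inj₂ (there e∈)) = v∉ (proj₁ (proj₂ (grow-ends g e∈)))
      sub′ : ∀ {u u′} → Adj u u′ → X u u′ ≢ X u′ u → B u u′ ⊎ (u , u′) ∈~ ts
      sub′ a ne with sub a ne
      ... | inj₁ b = inj₁ b
      ... | inj₂ (inj₁ (here refl)) = ⊥-elim (leaf ne)
      ... | inj₂ (inj₁ (there e∈)) = inj₂ (inj₁ e∈)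
      ... | inj₂ (inj₂ (here refl)) = ⊥-elim (leaf (ne ∘ sym))
      ... | inj₂ (inj₂ (there e∈)) = inj₂ (inj₂ e∈)

  -- `edgeCount` counts the darts that go upwards in index. Turning every dart of L upwards keeps
  -- them distinct, because `_≁_` also excludes reversals.
  length-≤-edgeCount : ∀ {L} → AllPairs _≁_ L → (∀ {u v} → (u , v) ∈ L → Adj u v) → length L ≤ edgeCount G
  length-≤-edgeCount {L} uq a = subst (_≤ edgeCount G) (length-map norm L)
    (unique-⊆-length (AllPairsₚ.map⁺ (norm-unique uq)) normal)
    where
      orient : ∀ {P : Set} → Dec P → E → E
      orient (yes _) e = e
      orient (no _) e = swap e
      norm : E → E
      norm (u , v) = orient (toℕ u <? toℕ v) (u , v)
      orient-≢ : ∀ {P Q : Set} (p : Dec P) (q : Dec Q) e f → e ≁ f → orient p e ≢ orient q f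
      orient-≢ (yes _) (yes _) e f (e≢ , _) = e≢
      orient-≢ (yes _) (no _) e f (_ , e≢) = λ { refl → e≢ refl }
      orient-≢ (no _) (yes _) e f (_ , e≢) = e≢
      orient-≢ (no _) (no _) e f (e≢ , _) = λ { refl → e≢ refl }
      norm-unique : ∀ {L} → AllPairs _≁_ L → AllPairs (λ e f → norm e ≢ norm f) L
      norm-unique [] = []
      norm-unique (e≁ ∷ uq) = All.map (orient-≢ (_ <? _) (_ <? _) _ _) e≁ ∷ norm-unique uq
      edges : List E
      edges = filterᵇ (λ p → adj G (proj₁ p) (proj₂ p) ∧ ⌊ toℕ (proj₁ p) <? toℕ (proj₂ p) ⌋) (allPairs n)
      edge : ∀ {u v} → Adj u v → toℕ u < toℕ v → (u , v) ∈ edges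
      edge {u} {v} a lt = ∈-filterᵇ⁺ _ (∈-cartesianProduct⁺ (∈-allFin u) (∈-allFin v))
                            (cong₂ _∧_ a (isYes-true (toℕ u <? toℕ v) lt))
        where
          isYes-true : ∀ {P : Set} (p : Dec P) → P → ⌊ p ⌋ ≡ true
          isYes-true (yes _) _ = refl
          isYes-true (no ¬p) p = ⊥-elim (¬p p)
      oriented : ∀ {u v} → Adj u v → (p : Dec (toℕ u < toℕ v)) → orient p (u , v) ∈ edges
      oriented a (yes lt) = edge a lt
      oriented a (no ≮) =
        edge (adj-sym a) (ℕₚ.≤∧≢⇒< (ℕₚ.≮⇒≥ ≮) (λ eq → adj⇒≢ a (sym (Finₚ.toℕ-injective eq))))
      normal : ∀ {e} → e ∈ map norm L → e ∈ edges
      normal e∈ with ∈-map⁻ norm e∈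
      ... | (u , v) , uv∈ , refl = oriented (a uv∈) (toℕ u <? toℕ v)

-- Euler's formula and the discrete Jordan theorem

module Sphere {n m : ℕ} (G : SimpleGraph n) (c : Fin (3 + m) → Fin n) (N : NearTriangulation G m c) where

  open NearTriangulation N
  open Rotation G embedding public

  open import Data.List.Membership.DecPropositional (≡-dec (_≟_ {n}) (_≟_ {n})) using (_∈?_)

  outer : List E
  outer = map (λ i → c i , c (csuc i)) (allFin (3 + m))

  ∈-outer : ∀ i → (c i , c (csuc i)) ∈ outer
  ∈-outer i = ∈-map⁺ _ (∈-allFin i)

  outer-next : ∀ {u v} → (u , v) ∈ outer → (v , r v u) ∈ outer
  outer-next e∈ with ∈-map⁻ _ e∈
  ... | i , _ , refl = subst (_∈ outer) (sym (outer-face i)) (∈-outer (csuc i))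

  inner-triangle : ∀ {u v} → Adj u v → (u , v) ∉ outer → r (r v u) v ≡ u × r u (r v u) ≡ v
  inner-triangle {u} {v} a ∉o with inner-faces u v a (λ i eq → ∉o (subst (_∈ outer) (sym eq) (∈-outer i)))
  ... | eq = ,-injectiveˡ eq , trans (cong (λ t → r t (r v u)) (sym (,-injectiveˡ eq))) (,-injectiveʳ eq)

  inner-next : ∀ {u v} → Adj u v → (u , v) ∉ outer → (v , r v u) ∉ outer
  inner-next {u} {v} a ∉o o∈ with inner-triangle a ∉o
  ... | eq₁ , eq₂ = ∉o (subst (_∈ outer) (cong₂ _,_ refl eq₂)
                         (subst (λ t → (t , r t (r v u)) ∈ outer) eq₁ (outer-next (outer-next o∈))))

  -- The faces in X are those reached from the outer face by crossing the edges es, avoiding bs.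
  data Cross (bs : List E) : List E → List E → Set where
    start : Cross bs outer []
    cross : ∀ {X es u v} → Cross bs X es → Adj u v → (u , v) ∉ X → (v , u) ∈ X → ¬ ((u , v) ∈~ bs) →
      Cross bs ((u , v) ∷ (v , r v u) ∷ (r v u , u) ∷ X) ((u , v) ∷ es)

  module _ {bs : List E} where

    cross-outer : ∀ {X es} → Cross bs X es → ∀ {e} → e ∈ outer → e ∈ X
    cross-outer start e∈ = e∈
    cross-outer (cross x _ _ _ _) e∈ = there (there (there (cross-outer x e∈)))

    cross-next : ∀ {X es} → Cross bs X es → ∀ {u v} → (u , v) ∈ X → (v , r v u) ∈ X
    cross-next start e∈ = outer-next e∈
    cross-next (cross x a ∉X _ _) (here refl) = there (here refl)
    cross-next (cross {u = u} {v} x a ∉X _ _) (there (here refl)) =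
      there (there (here (cong (r v u ,_) (proj₁ (inner-triangle a (∉X ∘ cross-outer x))))))
    cross-next (cross {u = u} {v} x a ∉X _ _) (there (there (here refl))) =
      here (cong (u ,_) (proj₂ (inner-triangle a (∉X ∘ cross-outer x))))
    cross-next (cross x _ _ _ _) (there (there (there e∈))) = there (there (there (cross-next x e∈)))

    -- A face other than the outer one is a triangle, so two further steps from the second dart come
    -- back to the first.
    cross-previous : ∀ {X es} → Cross bs X es → ∀ {u v} → Adj u v → (v , r v u) ∈ X → (u , v) ∈ X
    cross-previous {X} x {u} {v} a e∈ with (u , v) ∈? X
    ... | yes e∈X = e∈X
    ... | no e∉X with inner-triangle a (e∉X ∘ cross-outer x)
    ...   | eq₁ , eq₂ = subst (_∈ X) (cong₂ _,_ refl eq₂)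
                          (subst (λ t → (t , r t (r v u)) ∈ X) eq₁ (cross-next x (cross-next x e∈)))

    cross-length : ∀ {X es} → Cross bs X es → length X ≡ 3 * length es + (3 + m)
    cross-length start = trans (length-map _ (allFin (3 + m))) (length-tabulate {n = 3 + m} id)
    cross-length (cross {es = es} x _ _ _ _) = trans (cong (λ t → 3 + t) (cross-length x)) (lemma (length es) m)
      where
        lemma : ∀ a b → 3 + (3 * a + (3 + b)) ≡ 3 * suc a + (3 + b)
        lemma = solve-∀ℕ

    cross-edges : ∀ {X es} → Cross bs X es → ∀ {u v} → (u , v) ∈ es →
      Adj u v × (u , v) ∈ X × (v , u) ∈ X × ¬ ((u , v) ∈~ bs)
    cross-edges (cross x a _ e∈ ∉bs) (here refl) = a , here refl , there (there (there e∈)) , ∉bs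
    cross-edges (cross x _ _ _ _) (there e∈) with cross-edges x e∈
    ... | a , uv∈ , vu∈ , ∉bs = a , there (there (there uv∈)) , there (there (there vu∈)) , ∉bs

    cross-unique : ∀ {X es} → Cross bs X es → AllPairs _≁_ es
    cross-unique start = []
    cross-unique (cross x _ e∉ _ _) =
      ∉~⇒≁ (λ { (inj₁ e∈) → e∉ (proj₁ (proj₂ (cross-edges x e∈)))
              ; (inj₂ e∈) → e∉ (proj₁ (proj₂ (proj₂ (cross-edges x e∈)))) })
      ∷ cross-unique x

    Frontier : List E → V → V → Set
    Frontier X u v = Adj u v × (u , v) ∉ X × (v , u) ∈ X × ¬ ((u , v) ∈~ bs)

    frontier? : ∀ X → Dec (∃₂ (Frontier X))
    frontier? X = any? (λ u → any? (λ v →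
      (adj G u v Boolₚ.≟ true) ×-dec ¬? ((u , v) ∈? X) ×-dec ((v , u) ∈? X) ×-dec
      ¬? ((u , v) ∈? bs ⊎-dec (v , u) ∈? bs)))

    unreached : List E → ℕ
    unreached X = length (filter (λ e → ¬? (e ∈? X)) (allPairs n))

    -- Each crossing adds a dart that was missing, so the number of unreached darts bounds the
    -- number of crossings.
    cross-maximal : ∃₂ λ X es → Cross bs X es × (∀ {u v} → Adj u v → (u , v) ∉ X → (v , u) ∈ X → (u , v) ∈~ bs)
    cross-maximal = go (unreached outer) start ℕₚ.≤-refl
      where
        go : ∀ fuel {X es} → Cross bs X es → unreached X ≤ fuel →
          ∃₂ λ X es → Cross bs X es × (∀ {u v} → Adj u v → (u , v) ∉ X → (v , u) ∈ X → (u , v) ∈~ bs)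
        go fuel {X} {es} x le with frontier? X
        ... | no ¬f = X , es , x , λ {u} {v} a ∉X ∈X →
              decidable-stable ((u , v) ∈? bs ⊎-dec (v , u) ∈? bs) (λ ∉bs → ¬f (u , v , a , ∉X , ∈X , ∉bs))
        ... | yes (u , v , a , ∉X , ∈X , ∉bs)
          with fuel | ℕₚ.≤-trans (length-filter-<
                 (λ e → ¬? (e ∈? ((u , v) ∷ (v , r v u) ∷ (r v u , u) ∷ X))) (λ e → ¬? (e ∈? X))
                 (λ ∉X′ e∈ → ∉X′ (there (there (there e∈)))) (allPairs n)
                 (∈-cartesianProduct⁺ (∈-allFin u) (∈-allFin v)) ∉X (λ ∉X′ → ∉X′ (here refl))) le
        ...   | suc fuel′ | s≤s le′ = go fuel′ (cross x a ∉X ∈X ∉bs) le′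

  abstract

    member : List E → V → V → Bool
    member X u v = ⌊ (u , v) ∈? X ⌋

    member⁺ : ∀ {X u v} → (u , v) ∈ X → member X u v ≡ true
    member⁺ {X} {u} {v} e∈ with (u , v) ∈? X
    ... | yes _ = refl
    ... | no e∉ = ⊥-elim (e∉ e∈)

    member⁻ : ∀ {X u v} → member X u v ≡ true → (u , v) ∈ X
    member⁻ {X} {u} {v} eq with (u , v) ∈? X
    ... | yes e∈ = e∈

    member-≢ : ∀ {X u v} → member X u v ≢ member X v u → ((u , v) ∉ X × (v , u) ∈ X) ⊎ ((v , u) ∉ X × (u , v) ∈ X)
    member-≢ {X} {u} {v} ne with (u , v) ∈? X | (v , u) ∈? X
    ... | yes _ | yes _ = ⊥-elim (ne refl)
    ... | yes e∈ | no e∉ = inj₂ (e∉ , e∈)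
    ... | no e∉ | yes e∈ = inj₁ (e∉ , e∈)
    ... | no _ | no _ = ⊥-elim (ne refl)

    member-closed : ∀ {X} → (∀ {u v} → Adj u v → (u , v) ∈ X → (v , r v u) ∈ X) →
      (∀ {u v} → Adj u v → (v , r v u) ∈ X → (u , v) ∈ X) → Closed (member X)
    member-closed {X} next previous {u} {v} a with (u , v) ∈? X | (v , r v u) ∈? X
    ... | yes _ | yes _ = refl
    ... | yes e∈ | no e∉ = ⊥-elim (e∉ (next a e∈))
    ... | no e∉ | yes e∈ = ⊥-elim (e∉ (previous a e∈))
    ... | no _ | no _ = refl

  cross-closed : ∀ {bs X es} → Cross bs X es → Closed (member X)
  cross-closed x = member-closed (λ _ → cross-next x) (cross-previous x)

  module _ {bs X es} (x : Cross bs X es) where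

    -- Euler's formula: a spanning tree, its dual tree and one more edge cannot be disjoint.
    not-everything : ∀ {W x₀ ts e} → Grow (x₀ ∷ []) W ts → (∀ v → v ∈ W) → bs ≡ e ∷ ts → Adj (proj₁ e) (proj₂ e) →
      ¬ (e ∈~ ts) → (∀ {u v} → Adj u v → (u , v) ∈ X) → ⊥
    not-everything {W} {ts = ts} {e} g spanning refl ae e∉ all =
      ℕₚ.<-irrefl refl (ℕₚ.<-≤-trans enough (ℕₚ.+-monoˡ-≤ 1 too-many))
      where
        edges : List E
        edges = es ++ e ∷ ts
        edges-unique : AllPairs _≁_ edges
        edges-unique = AllPairsₚ.++⁺ (cross-unique x) (∉~⇒≁ e∉ ∷ grow-unique g)
          (All.tabulate (λ e∈ → ∉~⇒≁ (proj₂ (proj₂ (proj₂ (cross-edges x e∈))))))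
        edges-adj : ∀ {u v} → (u , v) ∈ edges → Adj u v
        edges-adj e∈ with ∈-++⁻ es e∈
        ... | inj₁ e∈es = proj₁ (cross-edges x e∈es)
        ... | inj₂ (here refl) = ae
        ... | inj₂ (there e∈ts) = grow-adj g e∈ts
        n≤ : n ≤ length ts + 1
        n≤ = subst₂ _≤_ (length-tabulate {n = n} id) (grow-length g)
               (unique-⊆-length (Unique.allFin⁺ n) (λ {v} _ → spanning v))
        bound : length es + suc (length ts) ≤ edgeCount G
        bound = subst (_≤ edgeCount G) (length-++ es) (length-≤-edgeCount edges-unique edges-adj)
        -- The spanning tree has n - 1 edges, e is one more, and the crossed edges avoid all of
        -- these.
        too-many : n + length es ≤ edgeCount G
        too-many = ℕₚ.≤-trans (ℕₚ.+-monoˡ-≤ (length es) n≤)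
                     (ℕₚ.≤-trans (ℕₚ.≤-reflexive (lemma (length ts) (length es))) bound)
          where
            lemma : ∀ a b → a + 1 + b ≡ b + suc a
            lemma = solve-∀ℕ
        darts≤ : length (darts G) ≤ 3 * length es + (3 + m)
        darts≤ = subst (length (darts G) ≤_) (cross-length x)
          (unique-⊆-length (Unique.filter⁺ _ (Unique.cartesianProduct⁺ (Unique.allFin⁺ n) (Unique.allFin⁺ n)))
            (λ {e} e∈ → all (proj₂ (∈-filterᵇ⁻ (λ p → adj G (proj₁ p) (proj₂ p)) {xs = allPairs n} e∈))))
        -- If all darts are reached, there are at most as many inner faces as crossings, and Euler's
        -- formula gives E + 2 ≤ n + |es| + 1, one more than the edge count permits.
        euler≤ : 3 * (edgeCount G + 2) ≤ 3 * (n + length es + 1)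
        euler≤ = ℕₚ.≤-trans (ℕₚ.≤-reflexive (sym euler))
          (ℕₚ.≤-trans (ℕₚ.+-monoʳ-≤ (3 * (n + 1))
              (ℕₚ.≤-trans (ℕₚ.∸-monoˡ-≤ (3 + m) darts≤) (ℕₚ.≤-reflexive (ℕₚ.m+n∸n≡m (3 * length es) (3 + m)))))
            (ℕₚ.≤-reflexive (lemma n (length es))))
          where
            lemma : ∀ a b → 3 * (a + 1) + 3 * b ≡ 3 * (a + b + 1)
            lemma = solve-∀ℕ
        enough : edgeCount G + 1 < n + length es + 1
        enough = ℕₚ.≤-trans (ℕₚ.≤-reflexive (lemma (edgeCount G))) (ℕₚ.*-cancelˡ-≤ 3 euler≤)
          where
            lemma : ∀ a → suc (a + 1) ≡ a + 2
            lemma = solve-∀ℕ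

  -- The tree grows in two stages, first along the path from x to w, then to the remaining vertices,
  -- because leaves are stripped from it twice. Stripping the second stage only shows that the
  -- boundary of X lies on the cycle. If X did not differ across the edge wx, the whole tree could
  -- be stripped, leaving no boundary, so that X would contain every dart.
  jordan : ∀ x y r₁ w → Unique (x ∷ y ∷ r₁ ++ w ∷ []) →
    (∀ {u v} → (u , v) ∈ clinks (x ∷ y ∷ r₁ ++ w ∷ []) → Adj u v) →
    ∃ λ X → Closed X × (∀ {u v} → Adj u v → X u v ≢ X v u → (u , v) ∈~ clinks (x ∷ y ∷ r₁ ++ w ∷ [])) ×
      X x w ≢ X w x
  jordan x y r₁ w uq@(x≢ ∷ uq′@(y≢ ∷ _)) adjacent
    with grow-path x (y ∷ r₁ ++ w ∷ []) start (here refl) uq′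
           (λ { z∈ (here refl) → All.lookup x≢ z∈ refl ; _ (there ()) })
           (λ e∈ → adjacent (links⊆clinks (x ∷ y ∷ r₁ ++ w ∷ []) e∈))
  ... | W₁ , ts₁ , g₁ , sup₁ , sub₁ with grow-spanning connected {W₁} (sup₁ (inj₁ (here refl)))
  ...   | W₂ , ts₂ , g₂ , spanning = result
    where
      cycle : List E
      cycle = clinks (x ∷ y ∷ r₁ ++ w ∷ [])
      closing : (w , x) ∈ cycle
      closing = subst (λ l → (w , x) ∈ links l) (sym (++-assoc (x ∷ y ∷ r₁) (w ∷ []) (x ∷ [])))
                  (links-++⁺ʳ (x ∷ y ∷ r₁) (here refl))
      path⊆ : ∀ {e} → e ∈ ts₁ → e ∈ links (x ∷ y ∷ r₁ ++ w ∷ [])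
      path⊆ e∈ with sub₁ e∈
      ... | inj₂ e∈l = e∈l
      w∈ : w ∈ y ∷ r₁ ++ w ∷ []
      w∈ = ∈-++⁺ʳ (y ∷ r₁) (here refl)
      -- As y comes between x and w on a simple path, the path contains the edge xw in neither
      -- direction.
      chord∉path : ∀ {e} → e ∈ ts₁ → e ≢ (x , w) × e ≢ (w , x)
      chord∉path e∈ =
        (λ { refl → All.lookup y≢ (∈-++⁺ʳ r₁ (here refl))
               (sym (links-source-unique (x ∷ y ∷ r₁) (proj₁ (unique-++⁻ (x ∷ y ∷ r₁) uq)) (path⊆ e∈) (here refl))) }) ,
        (λ { refl → All.lookup x≢ (links-target (y ∷ r₁ ++ w ∷ []) (path⊆ e∈)) refl })
      ts : List E
      ts = ts₂ ++ ts₁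
      chord∉ : ¬ ((w , x) ∈~ ts)
      chord∉ (inj₁ e∈) with ∈-++⁻ ts₂ e∈
      ... | inj₁ e∈₂ = proj₂ (proj₂ (grow-ends g₂ e∈₂)) (sup₁ (inj₁ (here refl)))
      ... | inj₂ e∈₁ = proj₂ (chord∉path e∈₁) refl
      chord∉ (inj₂ e∈) with ∈-++⁻ ts₂ e∈
      ... | inj₁ e∈₂ = proj₂ (proj₂ (grow-ends g₂ e∈₂)) (sup₁ (inj₂ w∈))
      ... | inj₂ e∈₁ = proj₁ (chord∉path e∈₁) refl
      g : Grow (x ∷ []) W₂ ts
      g = grow-trans g₁ g₂
      result : ∃ λ X → Closed X × (∀ {u v} → Adj u v → X u v ≢ X v u → (u , v) ∈~ cycle) × X x w ≢ X w x
      result with cross-maximal {(w , x) ∷ ts}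
      ... | X , es , cr , maximal = member X , cross-closed cr , on-cycle , separated
        where
          boundary : ∀ {u v} → Adj u v → member X u v ≢ member X v u → (u , v) ∈~ (w , x) ∷ ts
          boundary a ne with member-≢ ne
          ... | inj₁ (∉X , ∈X) = maximal a ∉X ∈X
          ... | inj₂ (∉X , ∈X) = ∈~-swap (maximal (adj-sym a) ∉X ∈X)
          OnCycle : V → V → Set
          OnCycle u v = (u , v) ∈~ cycle
          source∈ : ∀ {u v} → (u , v) ∈ cycle → u ∈ W₁
          source∈ e∈ with clinks-source (x ∷ y ∷ r₁ ++ w ∷ []) e∈
          ... | here refl = sup₁ (inj₁ (here refl))
          ... | there u∈ = sup₁ (inj₂ u∈)
          target∈ : ∀ {u v} → (u , v) ∈ cycle → v ∈ W₁
          target∈ e∈ with ∈-++⁻ (y ∷ r₁ ++ w ∷ []) (links-target ((y ∷ r₁ ++ w ∷ []) ++ x ∷ []) e∈)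
          ... | inj₁ v∈ = sup₁ (inj₂ v∈)
          ... | inj₂ (here refl) = sup₁ (inj₁ (here refl))
          -- Only `ts₂` is stripped: it was grown from vertices including all those of the cycle, so
          -- the edges of the cycle may stay.
          on-cycle : ∀ {u v} → Adj u v → member X u v ≢ member X v u → (u , v) ∈~ cycle
          on-cycle = boundary-avoids-forest (cross-closed cr) g₂ OnCycle
            (λ { (inj₁ e∈) → source∈ e∈ , target∈ e∈ ; (inj₂ e∈) → target∈ e∈ , source∈ e∈ })
            (λ a ne → classify (boundary a ne))
            where
              classify⁺ : ∀ {e} → e ∈ (w , x) ∷ ts → e ∈ cycle ⊎ e ∈ ts₂
              classify⁺ (here refl) = inj₁ closing
              classify⁺ (there e∈) with ∈-++⁻ ts₂ e∈
              ... | inj₁ e∈₂ = inj₂ e∈₂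
              ... | inj₂ e∈₁ = inj₁ (links⊆clinks (x ∷ y ∷ r₁ ++ w ∷ []) (path⊆ e∈₁))
              classify : ∀ {e} → e ∈~ (w , x) ∷ ts → e ∈~ cycle ⊎ e ∈~ ts₂
              classify (inj₁ e∈) = [ inj₁ ∘ inj₁ , inj₂ ∘ inj₁ ]′ (classify⁺ e∈)
              classify (inj₂ e∈) = [ inj₁ ∘ inj₂ , inj₂ ∘ inj₂ ]′ (classify⁺ e∈)
          separated : member X x w ≢ member X w x
          separated eq = not-everything cr g spanning refl (adjacent closing) chord∉ everything
            where
              -- With the chord out of the boundary, the forest `ts` over the single vertex x
              -- contains all of it, and nothing may stay.
              no-boundary : ∀ u v → Adj u v → member X u v ≡ member X v u
              no-boundary u v a = decidable-stable (member X u v Boolₚ.≟ member X v u) (λ ne →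
                boundary-avoids-forest (cross-closed cr) g (λ _ _ → ⊥) (λ ())
                  (λ a ne → inj₂ (in-forest a ne)) a ne)
                where
                  in-forest : ∀ {u v} → Adj u v → member X u v ≢ member X v u → (u , v) ∈~ ts
                  in-forest a ne with boundary a ne
                  ... | inj₁ (here refl) = ⊥-elim (ne (sym eq))
                  ... | inj₁ (there e∈) = inj₁ e∈
                  ... | inj₂ (here refl) = ⊥-elim (ne eq)
                  ... | inj₂ (there e∈) = inj₂ e∈
              everything : ∀ {u v} → Adj u v → (u , v) ∈ X
              everything {u} {v} a = member⁻ (trans (no-boundary⇒constant (cross-closed cr) connected no-boundary
                u v (c zero) (c (csuc zero)) a (cycle-adj zero)) (member⁺ (cross-outer cr (∈-outer zero))))

-- Disks in the sphere

module ClosedWalks {A : Set} where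

  -- The vertex to which the closed walk g, u, ... returns; if g is empty this is u itself.
  first : List A → A → A
  first [] u = u
  first (b ∷ _) _ = b

  first∈ : ∀ g {u} → first g u ∈ g ++ u ∷ []
  first∈ [] = here refl
  first∈ (b ∷ g) = here refl

  clinks-++ : ∀ g (u : A) l → clinks (g ++ u ∷ l) ≡ links (g ++ u ∷ l ++ first g u ∷ [])
  clinks-++ [] u l = refl
  clinks-++ (b ∷ g) u l = cong (λ t → links (b ∷ t)) (++-assoc g (u ∷ l) (b ∷ []))

  clinks-++⁻ : ∀ {e} g (u : A) l → e ∈ clinks (g ++ u ∷ l) →
    e ∈ links (g ++ u ∷ []) ⊎ e ∈ links (u ∷ l ++ first g u ∷ [])
  clinks-++⁻ {e} g u l e∈ = links-++⁻ g (l ++ first g u ∷ []) (subst (e ∈_) (clinks-++ g u l) e∈)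

  clinks-++⁺ : ∀ {e} g (u : A) l →
    e ∈ links (g ++ u ∷ []) ⊎ e ∈ links (u ∷ l ++ first g u ∷ []) → e ∈ clinks (g ++ u ∷ l)
  clinks-++⁺ {e} g u l (inj₁ e∈) =
    subst (e ∈_) (sym (clinks-++ g u l)) (links-++⁺ˡ g (l ++ first g u ∷ []) e∈)
  clinks-++⁺ {e} g u l (inj₂ e∈) = subst (e ∈_) (sym (clinks-++ g u l)) (links-++⁺ʳ g e∈)

  links-target∈ : ∀ {u v : A} l → (u , v) ∈ links l → v ∈ l
  links-target∈ (x ∷ l) e∈ = there (links-target l e∈)

  clinks-target : ∀ {u v : A} p → (u , v) ∈ clinks p → v ∈ p
  clinks-target (b ∷ q) e∈ with ∈-++⁻ q (links-target (q ++ b ∷ []) e∈)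
  ... | inj₁ v∈ = there v∈
  ... | inj₂ (here refl) = here refl

  -- On a simple closed walk each vertex has one successor: the next entry, or the head for the last
  -- entry. Since u precedes w, it follows w only if w is last and u is the head.
  closing-link : ∀ g (u : A) l w r → Unique (g ++ u ∷ l ++ w ∷ r) → (w , u) ∈ clinks (g ++ u ∷ l ++ w ∷ r) →
    g ≡ [] × r ≡ []
  closing-link g u l w [] uq e∈ = lemma g uq
      (clinks-source-unique _ uq e∈ (clinks-++⁺ g u (l ++ w ∷ [])
        (inj₂ (subst (λ t → (w , first g u) ∈ links (u ∷ t)) (sym (++-assoc l (w ∷ []) (first g u ∷ [])))
          (links-++⁺ʳ (u ∷ l) (here refl))))))
    where
      lemma : ∀ g → Unique (g ++ u ∷ l ++ w ∷ []) → u ≡ first g u → g ≡ [] × [] ≡ []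
      lemma [] _ _ = refl , refl
      lemma (b ∷ g) (b≢ ∷ _) eq = ⊥-elim (All.lookup b≢ (∈-++⁺ʳ g (here refl)) (sym eq))
  closing-link g u l w (z ∷ r) uq e∈ = ⊥-elim (All.lookup u≢ (∈-++⁺ʳ l (there (here refl))) u≡z)
    where
      u≢ : All (u ≢_) (l ++ w ∷ z ∷ r)
      u≢ with proj₁ (proj₂ (unique-++⁻ g uq))
      ... | u≢ ∷ _ = u≢
      u≡z : u ≡ z
      u≡z = clinks-source-unique _ uq e∈ (clinks-++⁺ g u (l ++ w ∷ z ∷ r)
        (inj₂ (subst (λ t → (w , z) ∈ links (u ∷ t)) (sym (++-assoc l (w ∷ z ∷ r) (first g u ∷ [])))
          (links-++⁺ʳ (u ∷ l) (here refl)))))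

  -- A simple closed walk has one link out of each vertex, so a relation that always continues and
  -- never leaves the walk has to follow it. This extends one known boundary link to a whole stretch
  -- of boundary.
  propagate : ∀ (P : A → A → Set) p s {y} → (∀ {e} → e ∈ links (y ∷ s) → e ∈ clinks p) → Unique p →
    (∀ {u v} → P u v → ∃ λ c → P v c) → (∀ {u v} → P u v → (u , v) ∈ clinks p) → ∀ {z} → P z y →
    ∀ {u v} → (u , v) ∈ links (y ∷ s) → P u v
  propagate P p (y′ ∷ s) {y} sub uq next on {z} Pz e∈ with next Pz
  ... | c , Pc with clinks-source-unique p uq (on Pc) (sub (here refl)) | e∈
  ...   | refl | here refl = Pc
  ...   | refl | there e∈′ = propagate P p s (sub ∘ there) uq next on Pc e∈′

open ClosedWalks

module Regions {n m : ℕ} (G : SimpleGraph n) (c : Fin (3 + m) → Fin n) (N : NearTriangulation G m c) where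

  open NearTriangulation N
  open Sphere G c N
  open import Data.List.Membership.DecPropositional (≡-dec (_≟_ {n}) (_≟_ {n})) using () renaming (_∈?_ to _∈ᴱ?_)
  open import Data.List.Membership.DecPropositional (_≟_ {n}) using (_∈?_)

  DartSet : Set
  DartSet = V → V → Bool

  count : DartSet → ℕ
  count S = length (filter (λ e → S (proj₁ e) (proj₂ e) Boolₚ.≟ true) (allPairs n))

  _⊆ᴰ_ : DartSet → DartSet → Set
  S ⊆ᴰ S′ = ∀ {u v} → S u v ≡ true → S′ u v ≡ true

  true≢false : ∀ {b} → b ≡ true → b ≢ false
  true≢false refl ()

  count-< : ∀ {S S′} → S ⊆ᴰ S′ → ∀ {u v} → S′ u v ≡ true → S u v ≡ false → count S < count S′
  count-< {S} {S′} sub {u} {v} t f = length-filter-< (λ e → S (proj₁ e) (proj₂ e) Boolₚ.≟ true)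
    (λ e → S′ (proj₁ e) (proj₂ e) Boolₚ.≟ true) sub (allPairs n)
    (∈-cartesianProduct⁺ (∈-allFin u) (∈-allFin v)) t (λ t′ → true≢false t′ f)

  infixl 6 _∩_
  _∩_ : DartSet → DartSet → DartSet
  (S ∩ Q) u v = S u v ∧ Q u v

  ∩⁺ : ∀ {a b} → a ≡ true → b ≡ true → a ∧ b ≡ true
  ∩⁺ refl refl = refl

  ∩-true : ∀ {a b} → a ∧ b ≡ true → a ≡ true × b ≡ true
  ∩-true {true} {true} _ = refl , refl

  ∩-false : ∀ {a b} → a ∧ b ≡ false → a ≡ false ⊎ (a ≡ true × b ≡ false)
  ∩-false {false} _ = inj₁ refl
  ∩-false {true} b = inj₂ (refl , b)

  ∩-closed : ∀ {S Q} → Closed S → Closed Q → Closed (S ∩ Q)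
  ∩-closed cS cQ a = cong₂ _∧_ (cS a) (cQ a)

  ¬true⇒false : ∀ {b} → b ≢ true → b ≡ false
  ¬true⇒false = Boolₚ.¬-not

  Full : List V → DartSet → Set
  Full p S = ∀ {u v} → (u , v) ∈ clinks p → S v u ≡ true × S u v ≡ false

  Degenerate : List V → DartSet → Set
  Degenerate p S = (∃₂ λ b a → p ≡ b ∷ a ∷ []) × (∀ u v → S u v ≡ false)

  -- S is the set of darts of the inner faces of the disk bounded by the closed
  -- walk p, which keeps them on the side of its reversed links.  A single edge
  -- counts as a disk without faces.
  record Region (p : List V) (S : DartSet) : Set where
    field
      unique   : Unique p
      inside   : ∀ {u v} → S u v ≡ true → Adj u v
      closed   : Closed S
      triangle : ∀ {u v} → S u v ≡ true → r (r v u) v ≡ u × r u (r v u) ≡ v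
      boundary : ∀ {u v} → S v u ≡ true → S u v ≡ false → (u , v) ∈ clinks p
      full     : Full p S ⊎ Degenerate p S

  -- The face behind the link (u , x) is removed. Its third corner w is either new, and the walk is
  -- rerouted through it (`peeled`), or already on the walk, and the rest falls apart into two disks
  -- (`Split`).
  module Peel {g u x l S} (region : Region (g ++ u ∷ x ∷ l) S) (full : Full (g ++ u ∷ x ∷ l) S) where

    open Region region hiding (full)

    p : List V
    p = g ++ u ∷ x ∷ l

    h : V
    h = first g u

    w : V
    w = r u x

    ux∈ : (u , x) ∈ clinks p
    ux∈ = clinks-++⁺ g u (x ∷ l) (inj₂ (here refl))

    Sxu : S x u ≡ true
    Sxu = proj₁ (full ux∈)

    Sux : S u x ≡ false
    Sux = proj₂ (full ux∈)

    Axu : Adj x u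
    Axu = inside Sxu

    Suw : S u w ≡ true
    Suw = trans (sym (closed Axu)) Sxu

    Auw : Adj u w
    Auw = inside Suw

    rwu : r w u ≡ x
    rwu = proj₁ (triangle Sxu)

    rxw : r x w ≡ u
    rxw = proj₂ (triangle Sxu)

    Swx : S w x ≡ true
    Swx = trans (sym (trans (closed Auw) (cong (S w) rwu))) Suw

    Awx : Adj w x
    Awx = inside Swx

    tri : List E
    tri = (x , u) ∷ (u , w) ∷ (w , x) ∷ []

    tri-closed : Closed (member tri)
    tri-closed = member-closed next previous
      where
        next : ∀ {a b} → Adj a b → (a , b) ∈ tri → (b , r b a) ∈ tri
        next _ (here refl) = there (here refl)
        next _ (there (here refl)) = there (there (here (cong (w ,_) rwu)))
        next _ (there (there (here refl))) = here (cong (x ,_) rxw)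
        previous : ∀ {a b} → Adj a b → (b , r b a) ∈ tri → (a , b) ∈ tri
        previous {a} ab (here eq) with ,-injectiveˡ eq
        ... | refl = there (there (here (cong (_, x)
                (rot-inj embedding x a w (adj-sym ab) (adj-sym Awx) (trans (,-injectiveʳ eq) (sym rxw))))))
        previous {a} ab (there (here eq)) with ,-injectiveˡ eq
        ... | refl = here (cong (_, u)
                (rot-inj embedding u a x (adj-sym ab) (adj-sym Axu) (,-injectiveʳ eq)))
        previous {a} ab (there (there (here eq))) with ,-injectiveˡ eq
        ... | refl = there (here (cong (_, w)
                (rot-inj embedding w a u (adj-sym ab) (adj-sym Auw) (trans (,-injectiveʳ eq) (sym rwu)))))

    A : DartSet
    A = S ∩ (λ a b → not (member tri a b))

    A-closed : Closed A
    A-closed = ∩-closed closed (not-closed tri-closed)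

    A⊆S : A ⊆ᴰ S
    A⊆S t = proj₁ (∩-true t)

    A⁺ : ∀ {a b} → S a b ≡ true → (a , b) ∉ tri → A a b ≡ true
    A⁺ {a} {b} s ∉tri = cong₂ _∧_ s (cong not (¬true⇒false {member tri a b} (∉tri ∘ member⁻ {tri})))

    A⁻ : ∀ {a b} → A a b ≡ true → (a , b) ∉ tri
    A⁻ t e∈ = true≢false (member⁺ {tri} e∈) (not-true (proj₂ (∩-true t)))

    A-tri : ∀ {a b} → (a , b) ∈ tri → A a b ≡ false
    A-tri {a} {b} e∈ = ¬true⇒false (λ t → A⁻ t e∈)

    A-outside : ∀ {a b} → S a b ≡ false → A a b ≡ false
    A-outside {a} {b} f = cong (_∧ not (member tri a b)) f

    A-false : ∀ {a b} → A a b ≡ false → S a b ≡ false ⊎ (a , b) ∈ tri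
    A-false f with ∩-false f
    ... | inj₁ f′ = inj₁ f′
    ... | inj₂ (_ , f′) = inj₂ (member⁻ {tri} (not-false f′))

    count-A : count A < count S
    count-A = count-< {A} {S} A⊆S Sxu (A-tri (here refl))

    boundary-A : ∀ {a b} → A b a ≡ true → A a b ≡ false →
      ((a , b) ∈ links (g ++ u ∷ []) ⊎ (a , b) ∈ links (x ∷ l ++ h ∷ [])) ⊎
      ((a , b) ≡ (u , w) ⊎ (a , b) ≡ (w , x))
    boundary-A {a} {b} t f with A-false f
    ... | inj₂ (here refl) = ⊥-elim (true≢false (A⊆S t) Sux)
    ... | inj₂ (there (here refl)) = inj₂ (inj₁ refl)
    ... | inj₂ (there (there (here refl))) = inj₂ (inj₂ refl)
    ... | inj₁ f′ with clinks-++⁻ g u (x ∷ l) (boundary (A⊆S t) f′)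
    ...   | inj₁ e∈ = inj₁ (inj₁ e∈)
    ...   | inj₂ (here refl) = ⊥-elim (A⁻ t (here refl))
    ...   | inj₂ (there e∈) = inj₁ (inj₂ e∈)

    u∉g : u ∉ g
    u∉g u∈ = proj₂ (proj₂ (unique-++⁻ g unique)) u∈ (here refl)

    u∉xl : u ∉ x ∷ l
    u∉xl u∈ with proj₁ (proj₂ (unique-++⁻ g unique))
    ... | u≢ ∷ _ = All.lookup u≢ u∈ refl

    links-p : ∀ {e} → e ∈ links (g ++ u ∷ []) ⊎ e ∈ links (x ∷ l ++ h ∷ []) → e ∈ clinks p
    links-p (inj₁ e∈) = clinks-++⁺ g u (x ∷ l) (inj₁ e∈)
    links-p (inj₂ e∈) = clinks-++⁺ g u (x ∷ l) (inj₂ (there e∈))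

    ux-other : ¬ ((u , x) ∈ links (g ++ u ∷ []) ⊎ (u , x) ∈ links (x ∷ l ++ h ∷ []))
    ux-other (inj₁ e∈) = u∉g (links-source g e∈)
    ux-other (inj₂ e∈) = u∉xl (links-source (x ∷ l) e∈)

    module _ (w∉ : w ∉ p) where

      private
        p′ : List V
        p′ = g ++ u ∷ w ∷ x ∷ l

      private
        old : ∀ {a b} → (a , b) ∈ links (g ++ u ∷ []) ⊎ (a , b) ∈ links (x ∷ l ++ h ∷ []) →
          A b a ≡ true × A a b ≡ false
        old e∈ = A⁺ (proj₁ (full (links-p e∈)))
            (λ { (here refl) → ux-other e∈
               ; (there (here refl)) → w∉ (clinks-source p (links-p e∈))
               ; (there (there (here refl))) → w∉ (clinks-target p (links-p e∈)) }) ,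
          A-outside (proj₂ (full (links-p e∈)))

      peeled-full : Full p′ A
      peeled-full e∈ with clinks-++⁻ g u (w ∷ x ∷ l) e∈
      ... | inj₁ e∈₁ = old (inj₁ e∈₁)
      ... | inj₂ (here refl) =
        -- If (w , u) were outside S, the edge uw would be a boundary edge and w a vertex of the
        -- walk.
        A⁺ (decidable-stable (S w u Boolₚ.≟ true) (λ ne → w∉ (clinks-source p (boundary Suw (¬true⇒false ne)))))
          (λ { (here eq) → adj⇒≢ Awx (,-injectiveˡ eq)
             ; (there (here eq)) → adj⇒≢ Auw (,-injectiveʳ eq)
             ; (there (there (here eq))) → adj⇒≢ Axu (sym (,-injectiveʳ eq)) }) ,
        A-tri (there (here refl))
      ... | inj₂ (there (here refl)) =
        A⁺ (decidable-stable (S x w Boolₚ.≟ true) (λ ne → w∉ (clinks-target p (boundary Swx (¬true⇒false ne)))))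
          (λ { (here eq) → adj⇒≢ Auw (sym (,-injectiveʳ eq))
             ; (there (here eq)) → adj⇒≢ Axu (,-injectiveˡ eq)
             ; (there (there (here eq))) → adj⇒≢ Awx (sym (,-injectiveˡ eq)) }) ,
        A-tri (there (there (here refl)))
      ... | inj₂ (there (there e∈₂)) = old (inj₂ e∈₂)

      peeled : Region p′ A
      peeled = record
        { unique = unique′
        ; inside = λ t → inside (A⊆S t)
        ; closed = A-closed
        ; triangle = λ t → triangle (A⊆S t)
        ; boundary = boundary′
        ; full = inj₁ peeled-full
        }
        where
          unique′ : Unique p′
          unique′ with unique-++⁻ g unique
          ... | ug , u≢ ∷ uxl , disj = unique-++⁺ ug
            ((adj⇒≢ Auw ∷ u≢) ∷ All.tabulate (λ z∈ → λ { refl → w∉ (∈-++⁺ʳ g (there z∈)) }) ∷ uxl)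
            (λ { z∈ (here refl) → disj z∈ (here refl)
               ; z∈ (there (here refl)) → w∉ (∈-++⁺ˡ z∈)
               ; z∈ (there (there z∈′)) → disj z∈ (there z∈′) })
          boundary′ : ∀ {a b} → A b a ≡ true → A a b ≡ false → (a , b) ∈ clinks p′
          boundary′ t f with boundary-A t f
          ... | inj₁ (inj₁ e∈) = clinks-++⁺ g u (w ∷ x ∷ l) (inj₁ e∈)
          ... | inj₁ (inj₂ e∈) = clinks-++⁺ g u (w ∷ x ∷ l) (inj₂ (there (there e∈)))
          ... | inj₂ (inj₁ refl) = clinks-++⁺ g u (w ∷ x ∷ l) (inj₂ (here refl))
          ... | inj₂ (inj₂ refl) = clinks-++⁺ g u (w ∷ x ∷ l) (inj₂ (there (here refl)))

  -- The walk meets w again after x. Without the triangle two disks remain whose walks share only w: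
  -- p₁ is closed off by the edge uw, and p₂ by the chord xw. Either of them may be a single edge.
  module Split {g u x r₁ r₂ S} (region : Region (g ++ u ∷ x ∷ r₁ ++ r u x ∷ r₂) S)
    (full : Full (g ++ u ∷ x ∷ r₁ ++ r u x ∷ r₂) S) where

    open Region region hiding (full)
    open Peel region full public

    p₁ p₂ : List V
    p₁ = g ++ u ∷ w ∷ r₂
    p₂ = x ∷ r₁ ++ w ∷ []

    private
      α β ω : List E
      α = links (g ++ u ∷ [])
      β = links (x ∷ r₁ ++ w ∷ [])
      ω = links (w ∷ r₂ ++ h ∷ [])

      rest-⁻ : ∀ {e} → e ∈ links (x ∷ (r₁ ++ w ∷ r₂) ++ h ∷ []) → e ∈ β ⊎ e ∈ ω
      rest-⁻ {e} e∈ = links-++⁻ (x ∷ r₁) (r₂ ++ h ∷ [])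
        (subst (λ t → e ∈ links (x ∷ t)) (++-assoc r₁ (w ∷ r₂) (h ∷ [])) e∈)

      rest-⁺ : ∀ {e} → e ∈ β ⊎ e ∈ ω → e ∈ links (x ∷ (r₁ ++ w ∷ r₂) ++ h ∷ [])
      rest-⁺ {e} e∈ = subst (λ t → e ∈ links (x ∷ t)) (sym (++-assoc r₁ (w ∷ r₂) (h ∷ []))) (go e∈)
        where
          go : e ∈ β ⊎ e ∈ ω → e ∈ links ((x ∷ r₁) ++ w ∷ r₂ ++ h ∷ [])
          go (inj₁ e∈β) = links-++⁺ˡ (x ∷ r₁) (r₂ ++ h ∷ []) e∈β
          go (inj₂ e∈ω) = links-++⁺ʳ (x ∷ r₁) e∈ω

      α⊆ : ∀ {e} → e ∈ α → e ∈ clinks p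
      α⊆ e∈ = links-p (inj₁ e∈)

      β⊆ : ∀ {e} → e ∈ β → e ∈ clinks p
      β⊆ e∈ = links-p (inj₂ (rest-⁺ (inj₁ e∈)))

      ω⊆ : ∀ {e} → e ∈ ω → e ∈ clinks p
      ω⊆ e∈ = links-p (inj₂ (rest-⁺ (inj₂ e∈)))

      p₁-⁻ : ∀ {e} → e ∈ clinks p₁ → e ∈ α ⊎ e ≡ (u , w) ⊎ e ∈ ω
      p₁-⁻ e∈ with clinks-++⁻ g u (w ∷ r₂) e∈
      ... | inj₁ e∈α = inj₁ e∈α
      ... | inj₂ (here refl) = inj₂ (inj₁ refl)
      ... | inj₂ (there e∈ω) = inj₂ (inj₂ e∈ω)

      p₁-⁺ : ∀ {e} → e ∈ α ⊎ e ≡ (u , w) ⊎ e ∈ ω → e ∈ clinks p₁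
      p₁-⁺ (inj₁ e∈α) = clinks-++⁺ g u (w ∷ r₂) (inj₁ e∈α)
      p₁-⁺ (inj₂ (inj₁ refl)) = clinks-++⁺ g u (w ∷ r₂) (inj₂ (here refl))
      p₁-⁺ (inj₂ (inj₂ e∈ω)) = clinks-++⁺ g u (w ∷ r₂) (inj₂ (there e∈ω))

      p₂-⁻ : ∀ {e} → e ∈ clinks p₂ → e ∈ β ⊎ e ≡ (w , x)
      p₂-⁻ {e} e∈ with links-++⁻ (x ∷ r₁) (x ∷ [])
                          (subst (λ t → e ∈ links (x ∷ t)) (++-assoc r₁ (w ∷ []) (x ∷ [])) e∈)
      ... | inj₁ e∈β = inj₁ e∈β
      ... | inj₂ (here refl) = inj₂ refl

      p₂-⁺ : ∀ {e} → e ∈ β ⊎ e ≡ (w , x) → e ∈ clinks p₂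
      p₂-⁺ {e} e∈ = subst (λ t → e ∈ links (x ∷ t)) (sym (++-assoc r₁ (w ∷ []) (x ∷ []))) (go e∈)
        where
          go : e ∈ β ⊎ e ≡ (w , x) → e ∈ links ((x ∷ r₁) ++ w ∷ x ∷ [])
          go (inj₁ e∈β) = links-++⁺ˡ (x ∷ r₁) (x ∷ []) e∈β
          go (inj₂ refl) = links-++⁺ʳ (x ∷ r₁) (here refl)

      parts : Unique g × Unique (x ∷ r₁) × Unique (w ∷ r₂) × u ∉ w ∷ r₂ × (∀ {z} → z ∈ g → z ∉ u ∷ x ∷ r₁ ++ w ∷ r₂)
        × (∀ {z} → z ∈ x ∷ r₁ → z ∉ w ∷ r₂)
      parts with unique-++⁻ g unique
      ... | ug , u≢ ∷ uxl , disj with unique-++⁻ (x ∷ r₁) uxl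
      ...   | uxr , uwr , disj′ = ug , uxr , uwr ,
        (λ u∈ → All.lookup u≢ (∈-++⁺ʳ (x ∷ r₁) u∈) refl) , disj , disj′

    unique₁ : Unique p₁
    unique₁ with parts
    ... | ug , _ , uwr , u∉ , disj , _ = unique-++⁺ ug
      (All.tabulate (λ z∈ → λ { refl → u∉ z∈ }) ∷ uwr)
      (λ { z∈ (here refl) → disj z∈ (here refl) ; z∈ (there z∈′) → disj z∈ (there (∈-++⁺ʳ (x ∷ r₁) z∈′)) })

    unique₂ : Unique p₂
    unique₂ with parts
    ... | _ , uxr , _ , _ , _ , disj = unique-++⁺ uxr ([] ∷ []) (λ { z∈ (here refl) → disj z∈ (here refl) })

    p₁∩p₂ : ∀ {z} → z ∈ p₁ → z ∈ p₂ → z ≡ w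
    p₁∩p₂ z∈₁ z∈₂ with parts | ∈-++⁻ g z∈₁ | ∈-++⁻ (x ∷ r₁) z∈₂
    ... | _ | _ | inj₂ (here refl) = refl
    ... | _ , _ , _ , _ , disj , _ | inj₁ z∈g | inj₁ z∈ = ⊥-elim (disj z∈g (there (∈-++⁺ˡ z∈)))
    ... | _ | inj₂ (here refl) | inj₁ z∈ = ⊥-elim (u∉xl (∈-++⁺ˡ z∈))
    ... | _ , _ , _ , _ , _ , disj | inj₂ (there z∈w) | inj₁ z∈ = ⊥-elim (disj z∈ z∈w)

    boundary-parts : ∀ {a b} → A b a ≡ true → A a b ≡ false → (a , b) ∈ clinks p₁ ⊎ (a , b) ∈ clinks p₂
    boundary-parts t f with boundary-A t f
    ... | inj₁ (inj₁ e∈) = inj₁ (p₁-⁺ (inj₁ e∈))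
    ... | inj₁ (inj₂ e∈) with rest-⁻ e∈
    ...   | inj₁ e∈β = inj₂ (p₂-⁺ (inj₁ e∈β))
    ...   | inj₂ e∈ω = inj₁ (p₁-⁺ (inj₂ (inj₂ e∈ω)))
    boundary-parts t f | inj₂ (inj₁ refl) = inj₁ (p₁-⁺ (inj₂ (inj₁ refl)))
    boundary-parts t f | inj₂ (inj₂ refl) = inj₂ (p₂-⁺ (inj₂ refl))

    -- A set Q of faces of the sphere on the side of p₂ away from the triangle. If r₁ is empty, p₂
    -- is one edge and Q has no faces. Otherwise the face across the chord xw belongs both to Q and
    -- to S.
    Separator : DartSet → Set
    Separator Q = Closed Q × Q x u ≡ false ×
      (∀ {a b} → Adj a b → Q a b ≢ Q b a → (a , b) ∈~ clinks p₂) ×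
      ((r₁ ≡ [] × (∀ a b → Q a b ≡ false)) ⊎ (Q x w ≡ true × S x w ≡ true))

    separator : ∃ Separator
    separator = go r₁ refl
     where
     go : ∀ l → r₁ ≡ l → ∃ Separator
     go [] eq = (λ _ _ → false) , (λ _ → refl) , refl , (λ _ ne → ⊥-elim (ne refl)) , inj₁ (eq , λ _ _ → refl)
     go (y ∷ r₁′) eq with jordan x y r₁′ w (subst (λ t → Unique (x ∷ t ++ w ∷ [])) eq unique₂) adjacent
      where
        adjacent : ∀ {a b} → (a , b) ∈ clinks (x ∷ y ∷ r₁′ ++ w ∷ []) → Adj a b
        adjacent {a} {b} e∈ with p₂-⁻ (subst (λ t → (a , b) ∈ clinks (x ∷ t ++ w ∷ [])) (sym eq) e∈)
        ... | inj₁ e∈β = adj-sym (inside (proj₁ (full (β⊆ e∈β))))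
        ... | inj₂ refl = Awx
     ... | X , X-closed , X-boundary , X-chord =
      -- The Jordan theorem does not say which side X is; taking the exclusive or with `X x u`
      -- selects the side without the triangle.
      (λ a b → X a b xor X x u) , (λ ab → cong (_xor X x u) (X-closed ab)) , Boolₚ.xor-same (X x u) ,
      (λ {a} {b} ab ne → subst (λ t → (a , b) ∈~ clinks (x ∷ t ++ w ∷ [])) (sym eq)
        (X-boundary ab (λ e → ne (cong (_xor X x u) e)))) ,
      inj₂ (xor-true (λ e → X-chord (trans e Xxu≡Xwx)) , Sxw)
      where
        xor-true : ∀ {a b} → a ≢ b → a xor b ≡ true
        xor-true {false} {false} ne = ⊥-elim (ne refl)
        xor-true {false} {true} _ = refl
        xor-true {true} {false} _ = refl
        xor-true {true} {true} ne = ⊥-elim (ne refl)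
        Xxu≡Xwx : X x u ≡ X w x
        Xxu≡Xwx = trans (X-closed Axu) (trans (X-closed Auw) (cong (X w) rwu))
        xy∈ : (x , y) ∈ clinks p
        xy∈ = β⊆ (subst (λ t → (x , y) ∈ links (x ∷ t ++ w ∷ [])) (sym eq) (here refl))
        -- Otherwise xw would be a link of the walk and w the successor of x, which is y.
        Sxw : S x w ≡ true
        Sxw = decidable-stable (S x w Boolₚ.≟ true) (λ ne →
          proj₂ (proj₂ (proj₂ (proj₂ (proj₂ parts)))) (there (subst (y ∈_) (sym eq) (here refl)))
            (here (clinks-source-unique p unique xy∈ (boundary Swx (¬true⇒false ne)))))

    module _ (Q : DartSet) (separates : Separator Q) where

      private
        Q-closed : Closed Q
        Q-closed = proj₁ separates

        Qxu : Q x u ≡ false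
        Qxu = proj₁ (proj₂ separates)

        Quw : Q u w ≡ false
        Quw = trans (sym (Q-closed Axu)) Qxu

        Q-boundary : ∀ {a b} → Adj a b → Q a b ≢ Q b a → (a , b) ∈~ clinks p₂
        Q-boundary = proj₁ (proj₂ (proj₂ separates))

        chord : (r₁ ≡ [] × (∀ a b → Q a b ≡ false)) ⊎ (Q x w ≡ true × S x w ≡ true)
        chord = proj₂ (proj₂ (proj₂ separates))

        Q-balanced : ∀ {a b} → Adj a b → a ∉ p₂ → Q a b ≡ Q b a
        Q-balanced {a} {b} ab a∉ = decidable-stable (Q a b Boolₚ.≟ Q b a) (λ ne →
          [ (λ e∈ → a∉ (clinks-source p₂ e∈)) , (λ e∈ → a∉ (clinks-target p₂ e∈)) ]′ (Q-boundary ab ne))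

        Q-around : ∀ {a b c} → a ∉ p₂ → Adj a b → Adj a c → Q a b ≡ false → Q a c ≡ false
        Q-around {a} {b} {c} a∉ ab ac f = ¬true⇒false (λ t →
          let d , ad , t′ , f′ = leaving-dart Q-closed ac ab t f
          in true≢false t′ (trans (Q-balanced ad a∉) f′))

        -- No face at a is in Q. Since Q changes only across edges of p₂, this passes between
        -- neighbours off p₂: it holds at u, and going backwards along p₁ it reaches g and then r₂.
        -- Every link of p₁ except uw ends at such a vertex, hence `Q-p₁`.
        Silent : V → Set
        Silent a = ∀ {b} → Adj a b → Q a b ≡ false

        silent-step : ∀ {a b} → Adj a b → a ∉ p₂ → Silent b → Silent a
        silent-step ab a∉ sb ac = Q-around a∉ ab ac (trans (Q-balanced ab a∉) (sb (adj-sym ab)))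

        silent-path : ∀ l z → Silent z → (∀ {a b} → (a , b) ∈ links (l ++ z ∷ []) → Adj a b) →
          (∀ {a} → a ∈ l → a ∉ p₂) → ∀ {a} → a ∈ l ++ z ∷ [] → Silent a
        silent-path [] z sz _ _ (here refl) = sz
        silent-path (y ∷ []) z sz adjacent ∉p₂ (here refl) = silent-step (adjacent (here refl)) (∉p₂ (here refl)) sz
        silent-path (y ∷ []) z sz adjacent ∉p₂ (there (here refl)) = sz
        silent-path (y ∷ y′ ∷ l) z sz adjacent ∉p₂ (here refl) = silent-step (adjacent (here refl)) (∉p₂ (here refl))
          (silent-path (y′ ∷ l) z sz (adjacent ∘ there) (∉p₂ ∘ there) (here refl))
        silent-path (y ∷ y′ ∷ l) z sz adjacent ∉p₂ (there a∈) =
          silent-path (y′ ∷ l) z sz (adjacent ∘ there) (∉p₂ ∘ there) a∈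

        ∉p₂-front : ∀ {a} → a ∈ g ++ u ∷ [] → a ∉ p₂
        ∉p₂-front a∈ a∈₂ with ∈-++⁻ g a∈
        ... | inj₂ (here refl) = adj⇒≢ Auw (p₁∩p₂ (∈-++⁺ʳ g (here refl)) a∈₂)
        ... | inj₁ a∈g with parts | p₁∩p₂ (∈-++⁺ˡ a∈g) a∈₂
        ...   | _ , _ , _ , _ , disj , _ | refl = disj a∈g (there (there (∈-++⁺ʳ r₁ (here refl))))

        ∉p₂-back : ∀ {a} → a ∈ r₂ → a ∉ p₂
        ∉p₂-back a∈ a∈₂ with parts | p₁∩p₂ (∈-++⁺ʳ g (there (there a∈))) a∈₂
        ... | _ , _ , w≢ ∷ _ , _ | refl = All.lookup w≢ a∈ refl

        silent-front : ∀ {a} → a ∈ g ++ u ∷ [] → Silent a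
        silent-front = silent-path g u (λ ub → Q-around (∉p₂-front (∈-++⁺ʳ g (here refl))) Auw ub Quw)
          (λ e∈ → adj-sym (inside (proj₁ (full (α⊆ e∈))))) (∉p₂-front ∘ ∈-++⁺ˡ)

        silent-back : ∀ {a} → a ∈ r₂ ++ h ∷ [] → Silent a
        silent-back = silent-path r₂ h (silent-front (first∈ g))
          (λ e∈ → adj-sym (inside (proj₁ (full (ω⊆ (links-∷ (r₂ ++ h ∷ []) e∈)))))) ∉p₂-back

        Q-p₁ : ∀ {a b} → (a , b) ∈ clinks p₁ → Q b a ≡ false
        Q-p₁ e∈ with p₁-⁻ e∈
        ... | inj₁ e∈α = silent-front (links-target∈ (g ++ u ∷ []) e∈α) (inside (proj₁ (full (α⊆ e∈α))))
        ... | inj₂ (inj₁ refl) = trans (sym (Q-balanced Auw (∉p₂-front (∈-++⁺ʳ g (here refl))))) Quw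
        ... | inj₂ (inj₂ e∈ω) = silent-back (links-target (r₂ ++ h ∷ []) e∈ω) (inside (proj₁ (full (ω⊆ e∈ω))))

        -- An edge with A on both sides is not on p₂: the links of p₂ are links of the walk, with S
        -- on one side only, except for (w , x), which is a dart of the removed triangle.
        A-balanced : ∀ {a b} → A a b ≡ true → A b a ≡ true → Q a b ≡ Q b a
        A-balanced {a} {b} t t′ = decidable-stable (Q a b Boolₚ.≟ Q b a) (λ ne → absurd (Q-boundary (inside (A⊆S t)) ne))
          where
            absurd : ¬ ((a , b) ∈~ clinks p₂)
            absurd (inj₁ e∈) with p₂-⁻ e∈
            ... | inj₁ e∈β = true≢false (A⊆S t) (proj₂ (full (β⊆ e∈β)))
            ... | inj₂ refl = A⁻ t (there (there (here refl)))
            absurd (inj₂ e∈) with p₂-⁻ e∈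
            ... | inj₁ e∈β = true≢false (A⊆S t′) (proj₂ (full (β⊆ e∈β)))
            ... | inj₂ refl = A⁻ t′ (there (there (here refl)))

        notQ : DartSet
        notQ a b = not (Q a b)

      S₁ S₂ : DartSet
      S₁ = A ∩ notQ
      S₂ = A ∩ Q

      S₁⊆A : S₁ ⊆ᴰ A
      S₁⊆A t = proj₁ (∩-true t)

      S₂⊆A : S₂ ⊆ᴰ A
      S₂⊆A t = proj₁ (∩-true t)

      private
        Q₁ : ∀ {a b} → S₁ a b ≡ true → Q a b ≡ false
        Q₁ {a} {b} t = not-true (proj₂ (∩-true {A a b} t))

        Q₂ : ∀ {a b} → S₂ a b ≡ true → Q a b ≡ true
        Q₂ {a} {b} t = proj₂ (∩-true {A a b} t)

      disjoint : ∀ {a b} → S₁ a b ≡ true → S₂ a b ≡ false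
      disjoint {a} {b} t = ¬true⇒false (λ t′ → true≢false (Q₂ t′) (Q₁ {a} {b} t))

      covers : ∀ {a b} → S a b ≡ true → (a , b) ∈ tri ⊎ S₁ a b ≡ true ⊎ S₂ a b ≡ true
      covers {a} {b} s = go ((a , b) ∈ᴱ? tri) (Q a b Boolₚ.≟ true)
        where
          go : Dec ((a , b) ∈ tri) → Dec (Q a b ≡ true) → _
          go (yes e∈) _ = inj₁ e∈
          go (no e∉) (yes q) = inj₂ (inj₂ (∩⁺ (A⁺ s e∉) q))
          go (no e∉) (no q) = inj₂ (inj₁ (∩⁺ (A⁺ s e∉) (cong not (¬true⇒false q))))

      private
        outside : ∀ {B : DartSet} {a b} → A a b ≡ false → (A ∩ B) a b ≡ false
        outside {B} {a} {b} f = cong (_∧ B a b) f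

        boundary₂ : ∀ {a b} → S₂ b a ≡ true → S₂ a b ≡ false → (a , b) ∈ clinks p₂
        boundary₂ {a} {b} t f with ∩-true t | ∩-false f
        ... | At , Qt | inj₂ (At′ , Qf) = ⊥-elim (true≢false Qt (trans (A-balanced At At′) Qf))
        ... | At , Qt | inj₁ Af with boundary-parts At Af
        ...   | inj₁ e∈ = ⊥-elim (true≢false Qt (Q-p₁ e∈))
        ...   | inj₂ e∈ = e∈

        chord-side : Q x w ≡ true → S x w ≡ true → S₂ x w ≡ true × S₂ w x ≡ false
        chord-side Qxw Sxw = ∩⁺ (A⁺ Sxw (λ
          { (here eq) → adj⇒≢ Auw (sym (,-injectiveʳ eq))
          ; (there (here eq)) → adj⇒≢ Axu (,-injectiveˡ eq)
          ; (there (there (here eq))) → adj⇒≢ Awx (sym (,-injectiveˡ eq)) })) Qxw ,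
          outside {Q} (A-tri (there (there (here refl))))

        -- The boundary of S₂ passes through the chord, cannot stop, and stays on p₂, so it runs
        -- through all of p₂.
        full₂ : Q x w ≡ true → S x w ≡ true → Full p₂ S₂
        full₂ Qxw Sxw e∈ with p₂-⁻ e∈
        ... | inj₂ refl = chord-side Qxw Sxw
        ... | inj₁ e∈β = propagate (λ a b → S₂ b a ≡ true × S₂ a b ≡ false) p₂ (r₁ ++ w ∷ [])
                (λ e∈ → p₂-⁺ (inj₁ e∈)) unique₂ (λ { (t , f) → next t f }) (λ { (t , f) → boundary₂ t f })
                (chord-side Qxw Sxw) e∈β
          where
            next : ∀ {a b} → S₂ b a ≡ true → S₂ a b ≡ false → ∃ λ c → S₂ c b ≡ true × S₂ b c ≡ false
            next t f with boundary-continues (∩-closed {A} {Q} A-closed Q-closed) (adj-sym (inside (A⊆S (S₂⊆A t)))) t f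
            ... | c , _ , t′ , f′ = c , t′ , f′

      region₂ : Region p₂ S₂
      region₂ = record
        { unique = unique₂
        ; inside = λ t → inside (A⊆S (S₂⊆A t))
        ; closed = ∩-closed {A} {Q} A-closed Q-closed
        ; triangle = λ t → triangle (A⊆S (S₂⊆A t))
        ; boundary = boundary₂
        ; full = full-or-degenerate chord
        }
        where
          full-or-degenerate : (r₁ ≡ [] × (∀ a b → Q a b ≡ false)) ⊎ (Q x w ≡ true × S x w ≡ true) →
            Full p₂ S₂ ⊎ Degenerate p₂ S₂
          full-or-degenerate (inj₁ (eq , Qf)) = inj₂ ((x , w , cong (λ t → x ∷ t ++ w ∷ []) eq) ,
            λ a b → ¬true⇒false (λ t → true≢false (Q₂ t) (Qf a b)))
          full-or-degenerate (inj₂ (Qxw , Sxw)) = inj₁ (full₂ Qxw Sxw)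

      private
        notQ-closed : Closed notQ
        notQ-closed = not-closed Q-closed

        not-p₂ : ∀ {a b} → S₁ b a ≡ true → (a , b) ∉ clinks p₂
        not-p₂ {a} {b} t e∈ with chord
        ... | inj₂ (Qxw , Sxw) = true≢false (Q₂ (proj₁ (full₂ Qxw Sxw e∈))) (Q₁ {b} {a} t)
        ... | inj₁ (eq , _) with p₂-⁻ e∈
        ...   | inj₁ e∈β with subst (λ t → (a , b) ∈ links (x ∷ t ++ w ∷ [])) eq e∈β
        ...     | here refl = A⁻ (S₁⊆A t) (there (there (here refl)))
        not-p₂ t e∈ | inj₁ (eq , _) | inj₂ refl = true≢false (A⊆S (S₁⊆A t))
          (proj₂ (full (β⊆ (subst (λ t → (x , w) ∈ links (x ∷ t ++ w ∷ [])) (sym eq) (here refl)))))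

        boundary₁ : ∀ {a b} → S₁ b a ≡ true → S₁ a b ≡ false → (a , b) ∈ clinks p₁
        boundary₁ {a} {b} t f with ∩-true t | ∩-false f
        ... | At , Qt | inj₂ (At′ , Qf) =
          ⊥-elim (true≢false (not-false Qf) (trans (A-balanced At′ At) (not-true Qt)))
        ... | At , Qt | inj₁ Af with boundary-parts At Af
        ...   | inj₁ e∈ = e∈
        ...   | inj₂ e∈ = ⊥-elim (not-p₂ t e∈)

        full₁ : (w , u) ∉ clinks p → Full p₁ S₁
        full₁ wu∉ e∈ = member₁ (p₁-⁻ e∈)
          where
            xw∉ : ¬ ((x , w) ∈ α ⊎ (x , w) ∈ ω)
            xw∉ xw∈ with parts | xw∈
            ... | _ , _ , _ , _ , disj , _ | inj₁ e∈α = disj (links-source g e∈α) (there (here refl))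
            ... | _ , _ , _ , _ , _ , disj | inj₂ e∈ω = disj (here refl) (links-source (w ∷ r₂) e∈ω)
            old : ∀ {a b} → (a , b) ∈ clinks p → (a , b) ∈ α ⊎ (a , b) ∈ ω → notQ b a ≡ true →
              S₁ b a ≡ true × S₁ a b ≡ false
            old ab∈ αω nq = ∩⁺ (A⁺ (proj₁ (full ab∈))
                (λ { (here refl) → ux-other ([ inj₁ , (λ e → inj₂ (rest-⁺ (inj₂ e))) ]′ αω)
                   ; (there (here refl)) → wu∉ ab∈
                   ; (there (there (here refl))) → xw∉ αω })) nq ,
              outside {notQ} (A-outside (proj₂ (full ab∈)))
            member₁ : ∀ {a b} → (a , b) ∈ α ⊎ (a , b) ≡ (u , w) ⊎ (a , b) ∈ ω → S₁ b a ≡ true × S₁ a b ≡ false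
            member₁ (inj₁ e∈α) = old (α⊆ e∈α) (inj₁ e∈α) (cong not (Q-p₁ (p₁-⁺ (inj₁ e∈α))))
            member₁ (inj₂ (inj₂ e∈ω)) = old (ω⊆ e∈ω) (inj₂ e∈ω) (cong not (Q-p₁ (p₁-⁺ (inj₂ (inj₂ e∈ω)))))
            member₁ (inj₂ (inj₁ refl)) = ∩⁺
              (A⁺ (decidable-stable (S w u Boolₚ.≟ true) (λ ne → wu∉ (boundary Suw (¬true⇒false ne))))
                (λ { (here eq) → adj⇒≢ Awx (,-injectiveˡ eq)
                   ; (there (here eq)) → adj⇒≢ Auw (,-injectiveʳ eq)
                   ; (there (there (here eq))) → adj⇒≢ Axu (sym (,-injectiveʳ eq)) }))
              (cong not (Q-p₁ (p₁-⁺ (inj₂ (inj₁ refl))))) ,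
              outside {notQ} (A-tri (there (here refl)))

        -- Since (w , u) is a link of the walk, it is the closing one and p₁ is just this edge.
        -- Neither of its darts is a boundary dart of S₁, so S₁ is all or nothing by connectedness,
        -- and it lacks the triangle.
        degenerate₁ : (w , u) ∈ clinks p → Degenerate p₁ S₁
        degenerate₁ wu∈ with closing-link g u (x ∷ r₁) w r₂ unique wu∈
        ... | refl , refl = (u , w , refl) , empty
          where
            no-boundary : ∀ {a b} → S₁ b a ≡ true → S₁ a b ≢ false
            no-boundary t f with boundary₁ t f
            ... | here refl = true≢false (A⊆S (S₁⊆A t)) (proj₂ (full wu∈))
            ... | there (here refl) = A⁻ (S₁⊆A t) (there (here refl))
            balanced : ∀ a b → Adj a b → S₁ a b ≡ S₁ b a
            balanced a b ab with S₁ a b in eq | S₁ b a in eq′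
            ... | true | true = refl
            ... | false | false = refl
            ... | true | false = ⊥-elim (no-boundary eq eq′)
            ... | false | true = ⊥-elim (no-boundary eq′ eq)
            empty : ∀ a b → S₁ a b ≡ false
            empty a b = ¬true⇒false (λ t → true≢false t (trans
              (no-boundary⇒constant (∩-closed {A} {notQ} A-closed notQ-closed) connected balanced
                a b x u (inside (A⊆S (S₁⊆A t))) Axu)
              (outside {notQ} (A-tri (here refl)))))

      region₁ : Region p₁ S₁
      region₁ = record
        { unique = unique₁
        ; inside = λ t → inside (A⊆S (S₁⊆A t))
        ; closed = ∩-closed {A} {notQ} A-closed notQ-closed
        ; triangle = λ t → triangle (A⊆S (S₁⊆A t))
        ; boundary = boundary₁
        ; full = full-or-degenerate
        }
        where
          full-or-degenerate : Full p₁ S₁ ⊎ Degenerate p₁ S₁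
          full-or-degenerate with (w , u) ∈ᴱ? clinks p
          ... | yes wu∈ = inj₂ (degenerate₁ wu∈)
          ... | no wu∉ = inj₁ (full₁ wu∉)

  -- In `spoke-free` the spoke to w is left out, because xw is the root edge of the second disk. The
  -- last case of `covers` takes care of the fan's darts opposite x, whose edges lie on the walk of
  -- the first disk.
  record FanSplit (g : List V) (u x : V) (l : List V) (S : DartSet) : Set where
    field
      us : List V
      w : V
      r₁ r₂ : List V
      S₁ S₂ : DartSet
      l≡ : l ≡ r₁ ++ w ∷ r₂
      region₁ : Region (g ++ u ∷ us ++ w ∷ r₂) S₁
      region₂ : Region (x ∷ r₁ ++ w ∷ []) S₂
      S₁⊆S : S₁ ⊆ᴰ S
      S₂⊆S : S₂ ⊆ᴰ S
      disjoint : ∀ {a b} → S₁ a b ≡ true → S₂ a b ≡ false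
      spoke-free : ∀ {y} → y ∈ u ∷ us → (S₁ x y ≡ false × S₁ y x ≡ false) × (S₂ x y ≡ false × S₂ y x ≡ false)
      us-new : ∀ {y} → y ∈ us → y ∉ g ++ u ∷ x ∷ l
      spoke-inside : ∀ {y} → y ∈ u ∷ us ++ w ∷ [] → S x y ≡ true ⊎ S y x ≡ true
      covers : ∀ {a b} → S a b ≡ true → (S₁ a b ≡ true ⊎ S₁ b a ≡ true) ⊎ (S₂ a b ≡ true ⊎ S₂ b a ≡ true) ⊎
        (∃ λ y → y ∈ u ∷ us ++ w ∷ [] × ((a , b) ≡ (x , y) ⊎ (a , b) ≡ (y , x))) ⊎
        (a , b) ∈~ clinks (g ++ u ∷ us ++ w ∷ r₂)

  -- The faces at x, in rotation order from the link (u , x) until a vertex of the boundary recurs.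
  fan-split : ∀ fuel g u x l S → Region (g ++ u ∷ x ∷ l) S → Full (g ++ u ∷ x ∷ l) S → count S ≤ fuel →
    (∀ {z} → z ∈ g → S z x ≡ false) → FanSplit g u x l S
  fan-split zero g u x l S region full le _ = ⊥-elim (ℕₚ.n≮0 (ℕₚ.<-≤-trans count-A le))
    where open Peel region full
  fan-split (suc fuel) g u x l S region full le passed with r u x ∈? l
  ... | yes w∈ with ∈-∃++ w∈
  ...   | r₁ , r₂ , refl = record
      { us = []
      ; w = w
      ; r₁ = r₁
      ; r₂ = r₂
      ; S₁ = S₁ Q separates
      ; S₂ = S₂ Q separates
      ; l≡ = refl
      ; region₁ = region₁ Q separates
      ; region₂ = region₂ Q separates
      ; S₁⊆S = λ t → A⊆S (S₁⊆A Q separates t)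
      ; S₂⊆S = λ t → A⊆S (S₂⊆A Q separates t)
      ; disjoint = disjoint Q separates
      ; spoke-free = λ { (here refl) →
          (¬true⇒false (λ t → A⁻ (S₁⊆A Q separates t) (here refl)) ,
           ¬true⇒false (λ t → true≢false (A⊆S (S₁⊆A Q separates t)) Sux)) ,
          (¬true⇒false (λ t → A⁻ (S₂⊆A Q separates t) (here refl)) ,
           ¬true⇒false (λ t → true≢false (A⊆S (S₂⊆A Q separates t)) Sux)) }
      ; us-new = λ ()
      ; spoke-inside = λ { (here refl) → inj₁ Sxu ; (there (here refl)) → inj₂ Swx }
      ; covers = cover
      }
    where
      open Split {g} {u} {x} {r₁} {r₂} {S} region full
      Q : DartSet
      Q = proj₁ separator
      separates : Separator Q
      separates = proj₂ separator
      cover : ∀ {a b} → S a b ≡ true → _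
      cover s with covers Q separates s
      ... | inj₂ (inj₁ t) = inj₁ (inj₁ t)
      ... | inj₂ (inj₂ t) = inj₂ (inj₁ (inj₁ t))
      ... | inj₁ (here refl) = inj₂ (inj₂ (inj₁ (u , here refl , inj₁ refl)))
      ... | inj₁ (there (here refl)) = inj₂ (inj₂ (inj₂ (inj₁ (clinks-++⁺ g u (w ∷ r₂) (inj₂ (here refl))))))
      ... | inj₁ (there (there (here refl))) = inj₂ (inj₂ (inj₁ (w , there (here refl) , inj₂ refl)))
  fan-split (suc fuel) g u x l S region full le passed | no w∉l = record
      { us = w ∷ F.us
      ; w = F.w
      ; r₁ = F.r₁
      ; r₂ = F.r₂
      ; S₁ = F.S₁
      ; S₂ = F.S₂
      ; l≡ = F.l≡
      ; region₁ = subst (λ t → Region t F.S₁) (assoc (F.us ++ F.w ∷ F.r₂)) F.region₁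
      ; region₂ = F.region₂
      ; S₁⊆S = λ t → A⊆S (F.S₁⊆S t)
      ; S₂⊆S = λ t → A⊆S (F.S₂⊆S t)
      ; disjoint = F.disjoint
      ; spoke-free = λ { (here refl) →
          (¬true⇒false (λ t → A⁻ (F.S₁⊆S t) (here refl)) , ¬true⇒false (λ t → true≢false (A⊆S (F.S₁⊆S t)) Sux)) ,
          (¬true⇒false (λ t → A⁻ (F.S₂⊆S t) (here refl)) , ¬true⇒false (λ t → true≢false (A⊆S (F.S₂⊆S t)) Sux))
          ; (there y∈) → F.spoke-free y∈ }
      ; us-new = λ { (here refl) → w∉ ; (there y∈) y∈p → F.us-new y∈
          (subst (_ ∈_) (sym (assoc (x ∷ l))) (widen y∈p)) }
      ; spoke-inside = λ { (here refl) → inj₁ Sxu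
          ; (there y∈) → [ (λ t → inj₁ (A⊆S t)) , (λ t → inj₂ (A⊆S t)) ]′ (F.spoke-inside y∈) }
      ; covers = cover
      }
    where
      open Peel region full
      -- The vertices of g had their turn as u, so their darts to x lie outside S, unlike (w , x).
      -- This is why the fan cannot run back into its own earlier part.
      w∉ : w ∉ p
      w∉ w∈ with ∈-++⁻ g w∈
      ... | inj₁ w∈g = true≢false Swx (passed w∈g)
      ... | inj₂ (here eq) = adj⇒≢ Auw (sym eq)
      ... | inj₂ (there (here eq)) = adj⇒≢ Awx eq
      ... | inj₂ (there (there w∈l)) = w∉l w∈l
      assoc : ∀ t → (g ++ u ∷ []) ++ w ∷ t ≡ g ++ u ∷ w ∷ t
      assoc t = ++-assoc g (u ∷ []) (w ∷ t)
      widen : ∀ {y} → y ∈ g ++ u ∷ x ∷ l → y ∈ g ++ u ∷ w ∷ x ∷ l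
      widen y∈ with ∈-++⁻ g y∈
      ... | inj₁ y∈g = ∈-++⁺ˡ y∈g
      ... | inj₂ (here refl) = ∈-++⁺ʳ g (here refl)
      ... | inj₂ (there y∈′) = ∈-++⁺ʳ g (there (there y∈′))
      rest : FanSplit (g ++ u ∷ []) w x l A
      rest = fan-split fuel (g ++ u ∷ []) w x l A
        (subst (λ t → Region t A) (sym (assoc (x ∷ l))) (peeled w∉))
        (subst (λ t → Full t A) (sym (assoc (x ∷ l))) (peeled-full w∉))
        (ℕₚ.≤-pred (ℕₚ.<-≤-trans count-A le))
        (λ z∈ → [ (λ z∈g → A-outside (passed z∈g)) , (λ { (here refl) → A-outside Sux }) ]′ (∈-++⁻ g z∈))
      module F = FanSplit rest
      cover : ∀ {a b} → S a b ≡ true → _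
      cover {a} {b} s with (a , b) ∈ᴱ? tri
      ... | no e∉ with F.covers (A⁺ s e∉)
      ...   | inj₁ t = inj₁ t
      ...   | inj₂ (inj₁ t) = inj₂ (inj₁ t)
      ...   | inj₂ (inj₂ (inj₁ (y , y∈ , eq))) = inj₂ (inj₂ (inj₁ (y , there y∈ , eq)))
      ...   | inj₂ (inj₂ (inj₂ e∈)) = inj₂ (inj₂ (inj₂ (subst (λ t → (a , b) ∈~ clinks t) (assoc (F.us ++ F.w ∷ F.r₂)) e∈)))
      cover s | yes (here refl) = inj₂ (inj₂ (inj₁ (u , here refl , inj₁ refl)))
      cover s | yes (there (here refl)) = inj₂ (inj₂ (inj₂ (inj₁ (clinks-++⁺ g u (w ∷ F.us ++ F.w ∷ F.r₂) (inj₂ (here refl))))))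
      cover s | yes (there (there (here refl))) = inj₂ (inj₂ (inj₁ (w , there (here refl) , inj₂ refl)))

-- Monomials of small degree on a disk

lastOf : ∀ {A : Set} → A → List A → A
lastOf x [] = x
lastOf x (y ∷ l) = lastOf y l

lastOf-++ : ∀ {A : Set} (x : A) l w r → lastOf x (l ++ w ∷ r) ≡ lastOf w r
lastOf-++ x [] w r = refl
lastOf-++ x (y ∷ l) w r = lastOf-++ y l w r

lastOf∈ : ∀ {A : Set} (x : A) l → lastOf x l ∈ x ∷ l
lastOf∈ x [] = here refl
lastOf∈ x (y ∷ l) = there (lastOf∈ y l)

module NiceMonomials {n m : ℕ} (σ : Fin n → Fin n → Bool) (G : SimpleGraph n) (c : Fin (3 + m) → Fin n)
  (N : NearTriangulation G m c) where

  open Monomials σ hiding (V; E)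
  open Fan σ
  open NearTriangulation N
  open Sphere G c N
  open Regions G c N
  open import Data.List.Membership.DecPropositional (_≟_ {n}) using (_∈?_)

  Within : DartSet → V → V → Set
  Within S u v = S u v ≡ true ⊎ S v u ≡ true

  Touched : DartSet → V → Set
  Touched S v = ∃ λ y → S v y ≡ true

  Root : V → List V → E → Set
  Root b q e = e ∈~ (b , lastOf b q) ∷ []

  -- The last four fields say that L lists each edge of the disk other than the root edge exactly
  -- once, in an arbitrary direction. The vertices b and `lastOf b q` play the parts of v₂ and v₁.
  record Nice (b : V) (q : List V) (S : DartSet) : Set where
    field
      L : List E
      d : V → ℤ
      coef≢0 : coef L d ≢ 0ℤ
      d-first : d b ≡ 0ℤ
      d-last : d (lastOf b q) ≡ 0ℤ
      d-boundary : ∀ {v} → v ∈ b ∷ q → d v ℤ.≤ + 2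
      d-all : ∀ v → d v ℤ.≤ + 4
      within : ∀ {u v} → (u , v) ∈ L → Within S u v
      not-root : ∀ {e} → e ∈ L → ¬ Root b q e
      covers : ∀ {u v} → S u v ≡ true → (u , v) ∈~ L ⊎ Root b q (u , v)
      distinct : AllPairs _≁_ L

  nice-degenerate : ∀ {b q S} → Degenerate (b ∷ q) S → Nice b q S
  nice-degenerate ((_ , _ , refl) , empty) = record
    { L = []
    ; d = λ _ → 0ℤ
    ; coef≢0 = λ eq → 1≢0 (trans (sym (indicator-true (zero? (λ _ → 0ℤ)) (λ _ → refl))) eq)
    ; d-first = refl
    ; d-last = refl
    ; d-boundary = λ _ → ℤ.+≤+ z≤n
    ; d-all = λ _ → ℤ.+≤+ z≤n
    ; within = λ ()
    ; not-root = λ ()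
    ; covers = λ t → ⊥-elim (true≢false t (empty _ _))
    ; distinct = []
    }
    where
      1≢0 : 1ℤ ≢ 0ℤ
      1≢0 ()

  spokes-distinct : ∀ x ys → x ∉ ys → Unique ys → AllPairs _≁_ (spokes x ys)
  spokes-distinct x [] _ _ = []
  spokes-distinct x (y ∷ ys) x∉ (y≢ ∷ uq) = ∉~⇒≁ absurd ∷ spokes-distinct x ys (x∉ ∘ there) uq
    where
      absurd : ¬ ((x , y) ∈~ spokes x ys)
      absurd (inj₁ e∈) with ∈-map⁻ (x ,_) e∈
      ... | y′ , y∈ , refl = All.lookup y≢ y∈ refl
      absurd (inj₂ e∈) with ∈-map⁻ (x ,_) e∈
      ... | y′ , y∈ , eq = x∉ (here (sym (,-injectiveˡ eq)))

  module _ {p T} (region : Region p T) where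
    open Region region

    within-touches : ∀ {u v} → Within T u v → Touched T u
    within-touches (inj₁ t) = _ , t
    within-touches (inj₂ t) = _ , trans (sym (closed (inside t))) t

    -- At a vertex off the walk either all faces are in T or none, since a change during rotation
    -- would put a boundary dart there; one dart outside T decides.
    untouched : ∀ {z y} → z ∉ p → Adj z y → T z y ≡ false → ¬ Touched T z
    untouched z∉ zy f (y′ , t) with leaving-dart closed (inside t) zy t f
    ... | c , _ , t′ , f′ = z∉ (clinks-target p (boundary t′ f′))

  module _ {b x l S} (region : Region (b ∷ x ∷ l) S) (full : Full (b ∷ x ∷ l) S) (F : FanSplit [] b x l S) where

    open FanSplit F

    module _ (N₁ : Nice b (us ++ w ∷ r₂) S₁) (N₂ : Nice x (r₁ ++ w ∷ []) S₂) where

      private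
        module R = Region region
        module R₁ = Region region₁
        module R₂ = Region region₂
        module N₁ = Nice N₁
        module N₂ = Nice N₂

        p p₁ p₂ : List V
        p = b ∷ x ∷ l
        p₁ = b ∷ us ++ w ∷ r₂
        p₂ = x ∷ r₁ ++ w ∷ []

        a : V
        a = lastOf w r₂

        last₁ : lastOf b (us ++ w ∷ r₂) ≡ a
        last₁ = lastOf-++ b us w r₂

        last₂ : lastOf x (r₁ ++ w ∷ []) ≡ w
        last₂ = lastOf-++ x r₁ w []

        last : lastOf b (x ∷ l) ≡ a
        last = trans (cong (lastOf x) l≡) (lastOf-++ x r₁ w r₂)

        r₁⊆ : ∀ {z} → z ∈ r₁ → z ∈ l
        r₁⊆ {z} z∈ = subst (z ∈_) (sym l≡) (∈-++⁺ˡ z∈)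

        wr₂⊆ : ∀ {z} → z ∈ w ∷ r₂ → z ∈ l
        wr₂⊆ {z} z∈ = subst (z ∈_) (sym l≡) (∈-++⁺ʳ r₁ z∈)

        l-unique : Unique (r₁ ++ w ∷ r₂)
        l-unique with R.unique
        ... | _ ∷ _ ∷ uq = subst Unique l≡ uq

        b∉xl : b ∉ x ∷ l
        b∉xl b∈ with R.unique
        ... | b≢ ∷ _ = All.lookup b≢ b∈ refl

        x∉l : x ∉ l
        x∉l x∈ with R.unique
        ... | _ ∷ x≢ ∷ _ = All.lookup x≢ x∈ refl

        r₁∩wr₂ : ∀ {z} → z ∈ r₁ → z ∉ w ∷ r₂
        r₁∩wr₂ = proj₂ (proj₂ (unique-++⁻ r₁ l-unique))

        w∉r₂ : w ∉ r₂
        w∉r₂ w∈ with proj₁ (proj₂ (unique-++⁻ r₁ l-unique))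
        ... | w≢ ∷ _ = All.lookup w≢ w∈ refl

        x≢b : x ≢ b
        x≢b eq = b∉xl (here (sym eq))

        x≢w : x ≢ w
        x≢w refl = x∉l (wr₂⊆ (here refl))

        x∉us : x ∉ us
        x∉us x∈ = us-new x∈ (there (here refl))

        b∉us : b ∉ us
        b∉us b∈ = us-new b∈ (here refl)

        x∉p₁ : x ∉ p₁
        x∉p₁ (here eq) = x≢b eq
        x∉p₁ (there x∈) with ∈-++⁻ us x∈
        ... | inj₁ x∈us = x∉us x∈us
        ... | inj₂ x∈w = x∉l (wr₂⊆ x∈w)

        p₂⊆p : ∀ {z} → z ∈ p₂ → z ∈ x ∷ l
        p₂⊆p (here refl) = here refl
        p₂⊆p (there z∈) with ∈-++⁻ r₁ z∈
        ... | inj₁ z∈r₁ = there (r₁⊆ z∈r₁)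
        ... | inj₂ (here refl) = there (wr₂⊆ (here refl))

        us⊆p₁ : ∀ {z} → z ∈ us → z ∈ p₁
        us⊆p₁ z∈ = there (∈-++⁺ˡ z∈)

        wr₂⊆p₁ : ∀ {z} → z ∈ w ∷ r₂ → z ∈ p₁
        wr₂⊆p₁ z∈ = there (∈-++⁺ʳ us z∈)

        us-parts : Unique (b ∷ us ++ w ∷ [])
        us-parts with unique-++⁻ (b ∷ us) R₁.unique
        ... | ubus , _ , disj = unique-++⁺ ubus ([] ∷ []) (λ { z∈ (here refl) → disj z∈ (here refl) })

        us≢w : ∀ {z} → z ∈ us → z ≢ w
        us≢w z∈ refl = us-new z∈ (there (there (wr₂⊆ (here refl))))

        exits : ∀ {z} → z ∈ p → ∃ λ y → Adj z y × S z y ≡ false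
        exits z∈ with csuccessor p z∈
        ... | y , e∈ = y , adj-sym (R.inside (proj₁ (full e∈))) , proj₂ (full e∈)

        smaller : ∀ {T : DartSet} → T ⊆ᴰ S → ∀ {z y} → S z y ≡ false → T z y ≡ false
        smaller sub f = ¬true⇒false (λ t → true≢false (sub t) f)

        Axb : Adj x b
        Axb = R.inside (proj₁ (full (here refl)))

        x-free₁ : ¬ Touched S₁ x
        x-free₁ = untouched region₁ x∉p₁ Axb (proj₁ (proj₁ (spoke-free (here refl))))

        r₁-free₁ : ∀ {z} → z ∈ r₁ → ¬ Touched S₁ z
        r₁-free₁ {z} z∈ with exits (there (there (r₁⊆ z∈)))
        ... | y , zy , f = untouched region₁ z∉ zy (smaller S₁⊆S f)
          where
            z∉ : z ∉ p₁
            z∉ (here refl) = b∉xl (there (r₁⊆ z∈))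
            z∉ (there z∈₁) with ∈-++⁻ us z∈₁
            ... | inj₁ z∈us = us-new z∈us (there (there (r₁⊆ z∈)))
            ... | inj₂ z∈w = r₁∩wr₂ z∈ z∈w

        front-free₂ : ∀ {z} → z ∈ b ∷ us → ¬ Touched S₂ z
        front-free₂ {z} z∈ = untouched region₂ (z∉ z∈) zx (proj₂ (proj₂ (spoke-free z∈)))
          where
            z∉ : z ∈ b ∷ us → z ∉ p₂
            z∉ (here refl) z∈₂ = b∉xl (p₂⊆p z∈₂)
            z∉ (there z∈us) z∈₂ = us-new z∈us (there (p₂⊆p z∈₂))
            zx : Adj z x
            zx = [ adj-sym ∘ R.inside , R.inside ]′ (spoke-inside (∈-++⁺ˡ z∈))

        r₂-free₂ : ∀ {z} → z ∈ r₂ → ¬ Touched S₂ z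
        r₂-free₂ {z} z∈ with exits (there (there (wr₂⊆ (there z∈))))
        ... | y , zy , f = untouched region₂ z∉ zy (smaller S₂⊆S f)
          where
            z∉ : z ∉ p₂
            z∉ (here refl) = x∉l (wr₂⊆ (there z∈))
            z∉ (there z∈₂) with ∈-++⁻ r₁ z∈₂
            ... | inj₁ z∈r₁ = r₁∩wr₂ z∈r₁ (there z∈)
            ... | inj₂ (here refl) = w∉r₂ z∈

        -- A vertex touched by S₂ that is not on p₁ has a dart outside S₁ and so is untouched by S₁;
        -- and apart from w, no vertex of p₁ is touched by S₂.
        both-touched : ∀ {z} → Touched S₁ z → Touched S₂ z → z ≡ w
        both-touched {z} t₁ t₂@(y , t) with z ≟ w | z ∈? b ∷ us | z ∈? r₂
        ... | yes eq | _ | _ = eq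
        ... | no _ | yes z∈ | _ = ⊥-elim (front-free₂ z∈ t₂)
        ... | no _ | no _ | yes z∈ = ⊥-elim (r₂-free₂ z∈ t₂)
        ... | no z≢w | no z∉ | no z∉r₂ = ⊥-elim (untouched region₁ z∉p₁ (R₂.inside t)
                                            (¬true⇒false (λ t′ → true≢false t (disjoint t′))) t₁)
          where
            z∉p₁ : z ∉ p₁
            z∉p₁ z∈ with ∈-++⁻ (b ∷ us) z∈
            ... | inj₁ z∈₁ = z∉ z∈₁
            ... | inj₂ (here eq) = z≢w eq
            ... | inj₂ (there z∈r₂) = z∉r₂ z∈r₂

        touches₁ : ∀ {e v} → e ∈ N₁.L → Touches v e → Touched S₁ v
        touches₁ e∈ (inj₁ refl) = within-touches region₁ (N₁.within e∈)
        touches₁ e∈ (inj₂ refl) = within-touches region₁ ([ inj₂ , inj₁ ]′ (N₁.within e∈))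

        touches₂ : ∀ {e v} → e ∈ N₂.L → Touches v e → Touched S₂ v
        touches₂ e∈ (inj₁ refl) = within-touches region₂ (N₂.within e∈)
        touches₂ e∈ (inj₂ refl) = within-touches region₂ ([ inj₂ , inj₁ ]′ (N₂.within e∈))

        support₁ : ∀ {v} → ¬ Touched S₁ v → N₁.d v ≡ 0ℤ
        support₁ {v} free = coef-avoids N₁.L N₁.d N₁.coef≢0 v (λ e e∈ t → free (touches₁ e∈ t))

        support₂ : ∀ {v} → ¬ Touched S₂ v → N₂.d v ≡ 0ℤ
        support₂ {v} free = coef-avoids N₂.L N₂.d N₂.coef≢0 v (λ e e∈ t → free (touches₂ e∈ t))

        d₂-x : N₂.d x ≡ 0ℤ
        d₂-x = N₂.d-first

        d₂-w : N₂.d w ≡ 0ℤ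
        d₂-w = subst (λ t → N₂.d t ≡ 0ℤ) last₂ N₂.d-last

        -- The order is that of `fan`, where the factors of xb and xw precede the spokes to us.
        spoke-ends : List V
        spoke-ends = b ∷ w ∷ us

        L₁ : List E
        L₁ = spokes x spoke-ends ++ N₁.L

        fanned : ∃ λ d′ → coef L₁ d′ ≢ 0ℤ × d′ x ℤ.≤ + 2 ×
          (∀ v → v ≢ x → v ∉ us → d′ v ≡ N₁.d v) × (∀ v → v ≢ x → d′ v ℤ.≤ N₁.d v ℤ.+ + 2)
        fanned = fan x b w us N₁.L N₁.d x∉us (λ e e∈ t → x-free₁ (touches₁ e∈ t)) x≢b x≢w b∉us us-unique
          N₁.coef≢0 N₁.d-first
          where
            us-unique : Unique us
            us-unique with R₁.unique
            ... | _ ∷ uq = proj₁ (unique-++⁻ us uq)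

        d₁ : V → ℤ
        d₁ = proj₁ fanned

        d₁-other : ∀ {v} → v ≢ x → v ∉ us → d₁ v ≡ N₁.d v
        d₁-other = proj₁ (proj₂ (proj₂ (proj₂ fanned))) _

        -- The factors of L₁ and N₂.L can share only the variables of x and w. These are the ends of
        -- the root edge of the second disk, where N₂.d vanishes.
        separated : ∀ v → N₂.d v ≡ 0ℤ ⊎ (Avoids v L₁ × d₁ v ≡ 0ℤ)
        separated v with v ≟ x | v ≟ w | coef-support N₂.L N₂.d N₂.coef≢0 v
        ... | yes refl | _ | _ = inj₁ d₂-x
        ... | no _ | yes refl | _ = inj₁ d₂-w
        ... | no _ | no _ | inj₁ z = inj₁ z
        ... | no v≢x | no v≢w | inj₂ (e , e∈ , t) = inj₂ (avoids , coef-avoids L₁ d₁ (proj₁ (proj₂ fanned)) v avoids)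
          where
            t₂ : Touched S₂ v
            t₂ = touches₂ e∈ t
            not-end : v ∉ spoke-ends
            not-end (here refl) = front-free₂ (here refl) t₂
            not-end (there (here refl)) = v≢w refl
            not-end (there (there v∈)) = front-free₂ (there v∈) t₂
            avoids : Avoids v L₁
            avoids e′ e′∈ t′ with ∈-++⁻ (spokes x spoke-ends) e′∈
            ... | inj₂ e′∈₁ = v≢w (both-touched (touches₁ e′∈₁ t′) t₂)
            ... | inj₁ e′∈s with ∈-map⁻ (x ,_) {xs = spoke-ends} e′∈s | t′
            ...   | y , y∈ , refl | inj₁ eq = v≢x (sym eq)
            ...   | y , y∈ , refl | inj₂ refl = not-end y∈

        d′ : V → ℤ
        d′ = d₁ ⊞ N₂.d

        d′-₁ : ∀ {v} → N₂.d v ≡ 0ℤ → d′ v ≡ d₁ v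
        d′-₁ {v} z = trans (cong (λ t → d₁ v ℤ.+ t) z) (ℤₚ.+-identityʳ (d₁ v))

        d′-₂ : ∀ {v} → d₁ v ≡ 0ℤ → d′ v ≡ N₂.d v
        d′-₂ {v} z = trans (cong (ℤ._+ N₂.d v) z) (ℤₚ.+-identityˡ (N₂.d v))

        d′-N₁ : ∀ {v} → v ≢ x → v ∉ us → N₂.d v ≡ 0ℤ → d′ v ≡ N₁.d v
        d′-N₁ v≢x v∉ z = trans (d′-₁ z) (d₁-other v≢x v∉)

        wr₂-N₁ : ∀ {v} → v ∈ w ∷ r₂ → d′ v ≡ N₁.d v
        wr₂-N₁ {v} v∈ = d′-N₁ (λ { refl → x∉l (wr₂⊆ v∈) }) (λ v∈us → us-new v∈us (there (there (wr₂⊆ v∈)))) (zero₂ v∈)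
          where
            zero₂ : ∀ {v} → v ∈ w ∷ r₂ → N₂.d v ≡ 0ℤ
            zero₂ (here refl) = d₂-w
            zero₂ (there v∈r₂) = support₂ (r₂-free₂ v∈r₂)

        b-N₁ : d′ b ≡ N₁.d b
        b-N₁ = d′-N₁ (x≢b ∘ sym) b∉us (support₂ (front-free₂ (here refl)))

        x≤2 : d′ x ℤ.≤ + 2
        x≤2 = subst (ℤ._≤ + 2) (sym (d′-₁ d₂-x)) (proj₁ (proj₂ (proj₂ fanned)))

        boundary≤2 : ∀ {v} → v ∈ p → d′ v ℤ.≤ + 2
        boundary≤2 (here refl) = subst (ℤ._≤ + 2) (sym b-N₁) (N₁.d-boundary (here refl))
        boundary≤2 (there (here refl)) = x≤2
        boundary≤2 {v} (there (there v∈)) with ∈-++⁻ r₁ (subst (v ∈_) l≡ v∈)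
        ... | inj₂ v∈w = subst (ℤ._≤ + 2) (sym (wr₂-N₁ v∈w)) (N₁.d-boundary (wr₂⊆p₁ v∈w))
        ... | inj₁ v∈r₁ = subst (ℤ._≤ + 2) (sym (d′-₂ (trans
                (d₁-other (λ { refl → x∉l v∈ }) (λ v∈us → us-new v∈us (there (there v∈))))
                (support₁ (r₁-free₁ v∈r₁)))))
                (N₂.d-boundary (there (∈-++⁺ˡ v∈r₁)))

        all≤4 : ∀ v → d′ v ℤ.≤ + 4
        all≤4 v with separated v
        ... | inj₂ (_ , z) = subst (ℤ._≤ + 4) (sym (d′-₂ z)) (N₂.d-all v)
        ... | inj₁ z with v ≟ x | v ∈? us
        ...   | yes refl | _ = ℤₚ.≤-trans x≤2 (ℤ.+≤+ (s≤s (s≤s z≤n)))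
        ...   | no v≢x | no v∉ = subst (ℤ._≤ + 4) (sym (d′-N₁ v≢x v∉ z)) (N₁.d-all v)
        ...   | no v≢x | yes v∈ = subst (ℤ._≤ + 4) (sym (d′-₁ z))
                (ℤₚ.≤-trans (proj₂ (proj₂ (proj₂ (proj₂ fanned))) v v≢x)
                  (ℤₚ.+-monoˡ-≤ (+ 2) (N₁.d-boundary (us⊆p₁ v∈))))

        ends⊆ : ∀ {y} → y ∈ spoke-ends → y ∈ b ∷ us ++ w ∷ []
        ends⊆ (here refl) = here refl
        ends⊆ (there (here refl)) = there (∈-++⁺ʳ us (here refl))
        ends⊆ (there (there y∈)) = there (∈-++⁺ˡ y∈)

        ends⊇ : ∀ {y} → y ∈ b ∷ us ++ w ∷ [] → y ∈ spoke-ends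
        ends⊇ (here refl) = here refl
        ends⊇ (there y∈) with ∈-++⁻ us y∈
        ... | inj₁ y∈us = there (there y∈us)
        ... | inj₂ (here refl) = there (here refl)

        x∉ends : x ∉ spoke-ends
        x∉ends (here eq) = x≢b eq
        x∉ends (there (here eq)) = x≢w eq
        x∉ends (there (there x∈)) = x∉us x∈

        ends-unique : Unique spoke-ends
        ends-unique with us-parts
        ... | b≢ ∷ uq =
          ((λ { refl → All.lookup b≢ (∈-++⁺ʳ us (here refl)) refl }) ∷ All.tabulate (λ z∈ → All.lookup b≢ (∈-++⁺ˡ z∈)))
          ∷ All.tabulate (λ z∈ → us≢w z∈ ∘ sym) ∷ proj₁ (unique-++⁻ us uq)

        L : List E
        L = L₁ ++ N₂.L

        data Part (e : E) : Set where
          spoke  : ∀ y → y ∈ spoke-ends → e ≡ (x , y) → Part e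
          first-disk  : e ∈ N₁.L → Part e
          second-disk : e ∈ N₂.L → Part e

        part : ∀ {e} → e ∈ L → Part e
        part e∈ with ∈-++⁻ L₁ e∈
        ... | inj₂ e∈₂ = second-disk e∈₂
        ... | inj₁ e∈₁ with ∈-++⁻ (spokes x spoke-ends) e∈₁
        ...   | inj₂ e∈N₁ = first-disk e∈N₁
        ...   | inj₁ e∈s with ∈-map⁻ (x ,_) {xs = spoke-ends} e∈s
        ...     | y , y∈ , eq = spoke y y∈ eq

        spoke∈L : ∀ {y} → y ∈ spoke-ends → (x , y) ∈ L
        spoke∈L y∈ = ∈-++⁺ˡ (∈-++⁺ˡ (∈-map⁺ (x ,_) y∈))

        N₁⊆L : ∀ {e} → e ∈ N₁.L → e ∈ L
        N₁⊆L e∈ = ∈-++⁺ˡ (∈-++⁺ʳ (spokes x spoke-ends) e∈)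

        N₂⊆L : ∀ {e} → e ∈ N₂.L → e ∈ L
        N₂⊆L e∈ = ∈-++⁺ʳ L₁ e∈

        within-L : ∀ {u v} → (u , v) ∈ L → Within S u v
        within-L e∈ with part e∈
        ... | spoke y y∈ refl = spoke-inside (ends⊆ y∈)
        ... | first-disk e∈₁ = [ inj₁ ∘ S₁⊆S , inj₂ ∘ S₁⊆S ]′ (N₁.within e∈₁)
        ... | second-disk e∈₂ = [ inj₁ ∘ S₂⊆S , inj₂ ∘ S₂⊆S ]′ (N₂.within e∈₂)

        root⇒root₁ : ∀ {e} → Root b (x ∷ l) e → Root b (us ++ w ∷ r₂) e
        root⇒root₁ {e} = subst (λ t → e ∈~ (b , t) ∷ []) (trans last (sym last₁))

        root₁⇒root : ∀ {e} → Root b (us ++ w ∷ r₂) e → Root b (x ∷ l) e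
        root₁⇒root {e} = subst (λ t → e ∈~ (b , t) ∷ []) (trans last₁ (sym last))

        a∈ : a ∈ l
        a∈ = wr₂⊆ (lastOf∈ w r₂)

        not-root-L : ∀ {e} → e ∈ L → ¬ Root b (x ∷ l) e
        not-root-L e∈ root with part e∈
        ... | first-disk e∈₁ = N₁.not-root e∈₁ (root⇒root₁ root)
        not-root-L e∈ (inj₁ (here refl)) | spoke y y∈ eq = x≢b (sym (,-injectiveˡ eq))
        not-root-L e∈ (inj₂ (here eq′)) | spoke y y∈ refl = x∉l (subst (_∈ l) (sym (trans (,-injectiveʳ eq′) last)) a∈)
        not-root-L e∈ (inj₁ (here refl)) | second-disk e∈₂ = front-free₂ (here refl) (touches₂ e∈₂ (inj₁ refl))
        not-root-L e∈ (inj₂ (here eq)) | second-disk e∈₂ = front-free₂ (here refl) (touches₂ e∈₂ (inj₂ (,-injectiveˡ eq)))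

        covers₁ : ∀ {u v} → S₁ u v ≡ true → (u , v) ∈~ L ⊎ Root b (x ∷ l) (u , v)
        covers₁ t with N₁.covers t
        ... | inj₁ (inj₁ e∈) = inj₁ (inj₁ (N₁⊆L e∈))
        ... | inj₁ (inj₂ e∈) = inj₁ (inj₂ (N₁⊆L e∈))
        ... | inj₂ root = inj₂ (root₁⇒root root)

        covers₂ : ∀ {u v} → S₂ u v ≡ true → (u , v) ∈~ L
        covers₂ {u} {v} t with N₂.covers t
        ... | inj₁ (inj₁ e∈) = inj₁ (N₂⊆L e∈)
        ... | inj₁ (inj₂ e∈) = inj₂ (N₂⊆L e∈)
        ... | inj₂ root with subst (λ t → (u , v) ∈~ (x , t) ∷ []) last₂ root
        -- The root edge of the second disk is missing from N₂.L; it is supplied as the spoke xw.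
        ...   | inj₁ (here refl) = inj₁ (spoke∈L (there (here refl)))
        ...   | inj₂ (here refl) = inj₂ (spoke∈L (there (here refl)))

        flip : ∀ {u v} → (u , v) ∈~ L ⊎ Root b (x ∷ l) (u , v) → (v , u) ∈~ L ⊎ Root b (x ∷ l) (v , u)
        flip (inj₁ e∈) = inj₁ (∈~-swap e∈)
        flip (inj₂ e∈) = inj₂ (∈~-swap e∈)

        -- A link of p₁ borders a face of S₁ unless p₁ is a single edge, and that edge is the root.
        covers-p₁ : ∀ {u v} → (u , v) ∈ clinks p₁ → (u , v) ∈~ L ⊎ Root b (x ∷ l) (u , v)
        covers-p₁ {u} {v} e∈ with R₁.full
        ... | inj₁ full₁ = flip (covers₁ (proj₁ (full₁ e∈)))
        ... | inj₂ ((b′ , a′ , eq) , _) = inj₂ (root₁⇒root (degenerate-root _ eq e∈))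
          where
            degenerate-root : ∀ q → b ∷ q ≡ b′ ∷ a′ ∷ [] → (u , v) ∈ clinks (b ∷ q) → Root b q (u , v)
            degenerate-root _ refl (here refl) = inj₁ (here refl)
            degenerate-root _ refl (there (here refl)) = inj₂ (here refl)

        covers-L : ∀ {u v} → S u v ≡ true → (u , v) ∈~ L ⊎ Root b (x ∷ l) (u , v)
        covers-L t with FanSplit.covers F t
        ... | inj₁ (inj₁ t₁) = covers₁ t₁
        ... | inj₁ (inj₂ t₁) = flip (covers₁ t₁)
        ... | inj₂ (inj₁ (inj₁ t₂)) = inj₁ (covers₂ t₂)
        ... | inj₂ (inj₁ (inj₂ t₂)) = inj₁ (∈~-swap (covers₂ t₂))
        ... | inj₂ (inj₂ (inj₁ (y , y∈ , inj₁ refl))) = inj₁ (inj₁ (spoke∈L (ends⊇ y∈)))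
        ... | inj₂ (inj₂ (inj₁ (y , y∈ , inj₂ refl))) = inj₁ (inj₂ (spoke∈L (ends⊇ y∈)))
        ... | inj₂ (inj₂ (inj₂ (inj₁ e∈))) = covers-p₁ e∈
        ... | inj₂ (inj₂ (inj₂ (inj₂ e∈))) = flip (covers-p₁ e∈)

        disjoint-spoke-N₁ : ∀ {y} → ¬ ((x , y) ∈~ N₁.L)
        disjoint-spoke-N₁ (inj₁ e∈) = x-free₁ (touches₁ e∈ (inj₁ refl))
        disjoint-spoke-N₁ (inj₂ e∈) = x-free₁ (touches₁ e∈ (inj₂ refl))

        disjoint-spoke-N₂ : ∀ {y} → y ∈ spoke-ends → ¬ ((x , y) ∈~ N₂.L)
        disjoint-spoke-N₂ (there (here refl)) (inj₁ e∈) =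
          N₂.not-root e∈ (subst (λ t → (x , w) ∈~ (x , t) ∷ []) (sym last₂) (inj₁ (here refl)))
        disjoint-spoke-N₂ (there (here refl)) (inj₂ e∈) =
          N₂.not-root e∈ (subst (λ t → (w , x) ∈~ (x , t) ∷ []) (sym last₂) (inj₂ (here refl)))
        disjoint-spoke-N₂ (here refl) (inj₁ e∈) = front-free₂ (here refl) (touches₂ e∈ (inj₂ refl))
        disjoint-spoke-N₂ (here refl) (inj₂ e∈) = front-free₂ (here refl) (touches₂ e∈ (inj₁ refl))
        disjoint-spoke-N₂ (there (there y∈)) (inj₁ e∈) = front-free₂ (there y∈) (touches₂ e∈ (inj₂ refl))
        disjoint-spoke-N₂ (there (there y∈)) (inj₂ e∈) = front-free₂ (there y∈) (touches₂ e∈ (inj₁ refl))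

        -- Both ends of a common edge would be touched by both disks, hence equal to w.
        disjoint-N₁-N₂ : ∀ {e} → e ∈ N₁.L → ¬ (e ∈~ N₂.L)
        disjoint-N₁-N₂ {u , v} e∈ e∈~ = adj⇒≢ ([ R₁.inside , adj-sym ∘ R₁.inside ]′ (N₁.within e∈)) (trans
          (both-touched (touches₁ e∈ (inj₁ refl)) (touch e∈~ (inj₁ refl)))
          (sym (both-touched (touches₁ e∈ (inj₂ refl)) (touch e∈~ (inj₂ refl)))))
          where
            touch : ∀ {z} → (u , v) ∈~ N₂.L → Touches z (u , v) → Touched S₂ z
            touch (inj₁ e∈₂) t = touches₂ e∈₂ t
            touch (inj₂ e∈₂) (inj₁ eq) = touches₂ e∈₂ (inj₂ eq)
            touch (inj₂ e∈₂) (inj₂ eq) = touches₂ e∈₂ (inj₁ eq)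

        distinct-L : AllPairs _≁_ L
        distinct-L = AllPairsₚ.++⁺
          (AllPairsₚ.++⁺ (spokes-distinct x spoke-ends x∉ends ends-unique) N₁.distinct
            (All.tabulate (λ e∈ → ∉~⇒≁ (spoke-N₁ e∈))))
          N₂.distinct
          (All.tabulate (λ e∈ → ∉~⇒≁ (L₁-N₂ e∈)))
          where
            spoke-N₁ : ∀ {e} → e ∈ spokes x spoke-ends → ¬ (e ∈~ N₁.L)
            spoke-N₁ e∈ with ∈-map⁻ (x ,_) {xs = spoke-ends} e∈
            ... | y , y∈ , refl = disjoint-spoke-N₁
            L₁-N₂ : ∀ {e} → e ∈ L₁ → ¬ (e ∈~ N₂.L)
            L₁-N₂ e∈ with ∈-++⁻ (spokes x spoke-ends) e∈
            ... | inj₂ e∈₁ = disjoint-N₁-N₂ e∈₁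
            ... | inj₁ e∈s with ∈-map⁻ (x ,_) {xs = spoke-ends} e∈s
            ...   | y , y∈ , refl = disjoint-spoke-N₂ y∈

      nice-step : Nice b (x ∷ l) S
      nice-step = record
        { L = L
        ; d = d′
        ; coef≢0 = λ eq → *-≢0 (proj₁ (proj₂ fanned)) N₂.coef≢0
                     (trans (sym (coef-++ L₁ N₂.L d₁ N₂.d N₂.coef≢0 separated)) eq)
        ; d-first = trans b-N₁ N₁.d-first
        ; d-last = subst (λ t → d′ t ≡ 0ℤ) (sym last)
                     (trans (wr₂-N₁ (lastOf∈ w r₂)) (subst (λ t → N₁.d t ≡ 0ℤ) last₁ N₁.d-last))
        ; d-boundary = boundary≤2
        ; d-all = all≤4
        ; within = within-L
        ; not-root = not-root-L
        ; covers = covers-L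
        ; distinct = distinct-L
        }

  nice : ∀ fuel b q S → Region (b ∷ q) S → count S ≤ fuel → Nice b q S
  nice fuel b q S region le with Region.full region
  nice fuel b q S region le | inj₂ degenerate = nice-degenerate degenerate
  -- The closed walk through one vertex is a loop, and the graph has none.
  nice fuel b [] S region le | inj₁ full =
    ⊥-elim (adj⇒≢ (Region.inside region (proj₁ (full (here refl)))) refl)
  nice fuel b (x ∷ l) S region le | inj₁ full = go fuel le
    where
      F : FanSplit [] b x l S
      F = fan-split (count S) [] b x l S region full ℕₚ.≤-refl (λ ())
      open FanSplit F
      -- The dart (x , b) is in S but, being a spoke, in neither part.
      smaller₁ : count S₁ < count S
      smaller₁ = count-< {S₁} {S} S₁⊆S (proj₁ (full (here refl))) (proj₁ (proj₁ (spoke-free (here refl))))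
      smaller₂ : count S₂ < count S
      smaller₂ = count-< {S₂} {S} S₂⊆S (proj₁ (full (here refl))) (proj₁ (proj₂ (spoke-free (here refl))))
      go : ∀ fuel → count S ≤ fuel → Nice b (x ∷ l) S
      go zero le = ⊥-elim (ℕₚ.n≮0 (ℕₚ.<-≤-trans smaller₁ le))
      go (suc fuel) le = nice-step region full F
        (nice fuel b (us ++ w ∷ r₂) S₁ region₁ (ℕₚ.≤-pred (ℕₚ.<-≤-trans smaller₁ le)))
        (nice fuel x (r₁ ++ w ∷ []) S₂ region₂ (ℕₚ.≤-pred (ℕₚ.<-≤-trans smaller₂ le)))

-- The outer cycle as the boundary of a disk

csuc-inject₁ : ∀ {k} (i : Fin k) → csuc (inject₁ i) ≡ suc i
csuc-inject₁ {k} i = Finₚ.toℕ-injective (begin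
    toℕ (csuc (inject₁ i))           ≡⟨ Finₚ.toℕ-fromℕ< (m%n<n (suc (toℕ (inject₁ i))) (suc k)) ⟩
    suc (toℕ (inject₁ i)) % suc k    ≡⟨ cong (λ t → suc t % suc k) (Finₚ.toℕ-inject₁ i) ⟩
    suc (toℕ i) % suc k              ≡⟨ m<n⇒m%n≡m (s≤s (Finₚ.toℕ<n i)) ⟩
    suc (toℕ i)                      ∎)
  where open ≡-Reasoning

csuc-fromℕ : ∀ k → csuc (fromℕ k) ≡ zero
csuc-fromℕ k = Finₚ.toℕ-injective (begin
    toℕ (csuc (fromℕ k))           ≡⟨ Finₚ.toℕ-fromℕ< (m%n<n (suc (toℕ (fromℕ k))) (suc k)) ⟩
    suc (toℕ (fromℕ k)) % suc k    ≡⟨ cong (λ t → suc t % suc k) (Finₚ.toℕ-fromℕ k) ⟩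
    suc k % suc k                  ≡⟨ n%n≡0 (suc k) ⟩
    0                              ∎)
  where open ≡-Reasoning

-- This uses that the cycle has at least three vertices. It implies that the reverse of an outer
-- dart is never outer, so that the disk lies along its whole boundary walk.
csuc²≢ : ∀ {m} (i : Fin (3 + m)) → csuc (csuc i) ≢ i
csuc²≢ i eq with view i
csuc²≢ {m} _ eq | ‵fromℕ with trans (sym (cong csuc (csuc-fromℕ (2 + m)))) eq
... | eq′ with trans (sym (csuc-inject₁ {2 + m} zero)) eq′
...   | ()
csuc²≢ {m} _ eq | ‵inject₁ i with view i
... | ‵inject₁ j with trans (sym (trans (cong csuc (csuc-inject₁ (inject₁ j))) (csuc-inject₁ (suc j)))) eq
...   | eq′ = ℕₚ.<⇒≢ (ℕₚ.n≤1+n _) (sym (trans (cong toℕ eq′)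
                (trans (Finₚ.toℕ-inject₁ (inject₁ j)) (Finₚ.toℕ-inject₁ j))))
csuc²≢ {m} _ eq | ‵inject₁ _ | ‵fromℕ
  with trans (sym (trans (cong csuc (csuc-inject₁ (fromℕ (1 + m)))) (csuc-fromℕ (2 + m)))) eq
... | ()

module _ {A : Set} where

  links-tabulate⁻ : ∀ {m} (f : Fin (suc m) → A) z {e} → e ∈ links (tabulate f ++ z ∷ []) →
    (∃ λ j → e ≡ (f (inject₁ j) , f (suc j))) ⊎ e ≡ (f (fromℕ m) , z)
  links-tabulate⁻ {zero} f z (here eq) = inj₂ eq
  links-tabulate⁻ {suc m} f z (here eq) = inj₁ (zero , eq)
  links-tabulate⁻ {suc m} f z (there e∈) with links-tabulate⁻ (f ∘ suc) z e∈
  ... | inj₁ (j , eq) = inj₁ (suc j , eq)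
  ... | inj₂ eq = inj₂ eq

  links-tabulate⁺ : ∀ {m} (f : Fin (suc m) → A) z {e} →
    (∃ λ j → e ≡ (f (inject₁ j) , f (suc j))) ⊎ e ≡ (f (fromℕ m) , z) → e ∈ links (tabulate f ++ z ∷ [])
  links-tabulate⁺ {zero} f z (inj₂ eq) = here eq
  links-tabulate⁺ {suc m} f z (inj₁ (zero , eq)) = here eq
  links-tabulate⁺ {suc m} f z (inj₁ (suc j , eq)) = there (links-tabulate⁺ (f ∘ suc) z (inj₁ (j , eq)))
  links-tabulate⁺ {suc m} f z (inj₂ eq) = there (links-tabulate⁺ (f ∘ suc) z (inj₂ eq))

module Disk {n m : ℕ} (G : SimpleGraph n) (c : Fin (3 + m) → Fin n) (N : NearTriangulation G m c) where

  open NearTriangulation N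
  open Sphere G c N
  open Regions G c N

  private
    c₀ c₁ : V
    c₀ = c zero
    c₁ = c (suc zero)

    c⁺ : Fin (2 + m) → V
    c⁺ i = c (suc i)

    c⁺⁺ : Fin (1 + m) → V
    c⁺⁺ i = c (suc (suc i))

    cycle-dart : Fin (3 + m) → E
    cycle-dart i = c i , c (csuc i)

  -- The walk runs from v₂ = `c (suc zero)` round to v₁ = `c zero`, so that its closing link is e,
  -- the root edge.
  boundary-tail : List V
  boundary-tail = tabulate c⁺⁺ ++ c₀ ∷ []

  boundary-walk : List V
  boundary-walk = c₁ ∷ boundary-tail

  disk : DartSet
  disk u v = adj G u v ∧ not (member outer u v)

  private
    walk-++ : clinks boundary-walk ≡ links (tabulate c⁺ ++ c₀ ∷ c₁ ∷ [])
    walk-++ = cong links (++-assoc (tabulate c⁺) (c₀ ∷ []) (c₁ ∷ []))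

    walk⁻ : ∀ {e} → e ∈ clinks boundary-walk → ∃ λ i → e ≡ cycle-dart i
    walk⁻ {e} e∈ with links-++⁻ (tabulate c⁺) (c₁ ∷ []) (subst (e ∈_) walk-++ e∈)
    ... | inj₂ (here eq) = zero , trans eq (cong (λ t → c₀ , c t) (sym (csuc-inject₁ zero)))
    ... | inj₁ e∈′ with links-tabulate⁻ c⁺ c₀ e∈′
    ...   | inj₁ (j , eq) = suc (inject₁ j) ,
              trans eq (cong (λ t → c (suc (inject₁ j)) , c t) (sym (csuc-inject₁ (suc j))))
    ...   | inj₂ eq = fromℕ (2 + m) , trans eq (cong (λ t → c (fromℕ (2 + m)) , c t) (sym (csuc-fromℕ (2 + m))))

    walk⁺ : ∀ i → cycle-dart i ∈ clinks boundary-walk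
    walk⁺ i = subst (cycle-dart i ∈_) (sym walk-++) (go (view i))
      where
        go : ∀ {i} → View i → cycle-dart i ∈ links (tabulate c⁺ ++ c₀ ∷ c₁ ∷ [])
        go ‵fromℕ = links-++⁺ˡ (tabulate c⁺) (c₁ ∷ []) (links-tabulate⁺ c⁺ c₀
          (inj₂ (cong (λ t → c (fromℕ (2 + m)) , c t) (csuc-fromℕ (2 + m)))))
        go (‵inject₁ zero) = links-++⁺ʳ (tabulate c⁺) (here (cong (λ t → c₀ , c t) (csuc-inject₁ {2 + m} zero)))
        go (‵inject₁ (suc j)) = links-++⁺ˡ (tabulate c⁺) (c₁ ∷ []) (links-tabulate⁺ c⁺ c₀
          (inj₁ (j , cong (λ t → c (suc (inject₁ j)) , c t) (csuc-inject₁ (suc j)))))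

    reversed∉outer : ∀ i → (c (csuc i) , c i) ∉ outer
    reversed∉outer i e∈ with ∈-map⁻ _ e∈
    ... | j , _ , eq with cycle-inj _ _ (,-injectiveˡ eq)
    ...   | refl = csuc²≢ i (sym (cycle-inj _ _ (,-injectiveʳ eq)))

    disk⁻ : ∀ {u v} → disk u v ≡ true → Adj u v × (u , v) ∉ outer
    disk⁻ {u} {v} t = proj₁ (∩-true t) ,
      λ e∈ → true≢false (member⁺ e∈) (not-true (proj₂ (∩-true {adj G u v} t)))

  disk-adj : ∀ {u v} → disk u v ≡ true → Adj u v
  disk-adj = proj₁ ∘ disk⁻

  disk⁺ : ∀ {u v} → Adj u v → (u , v) ∉ outer → disk u v ≡ true
  disk⁺ a ∉o = ∩⁺ a (cong not (¬true⇒false (∉o ∘ member⁻)))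

  disk-outer : ∀ {u v} → (u , v) ∈ outer → disk u v ≡ false
  disk-outer e∈ = ¬true⇒false (λ t → proj₂ (disk⁻ t) e∈)

  disk-full : Full boundary-walk disk
  disk-full e∈ with walk⁻ e∈
  ... | i , refl = disk⁺ (adj-sym (cycle-adj i)) (reversed∉outer i) , disk-outer (∈-outer i)

  disk-region : Region boundary-walk disk
  disk-region = record
    { unique = Unique.++⁺ (Unique.tabulate⁺ (λ eq → Finₚ.suc-injective (cycle-inj _ _ eq))) ([] ∷ [])
        (λ { (z∈ , here eq) → fresh z∈ eq })
    ; inside = disk-adj
    ; closed = λ {u} {v} a → cong₂ _∧_ (trans a (sym (r-adj a))) (cong not (outer-closed a))
    ; triangle = λ t → inner-triangle (proj₁ (disk⁻ t)) (proj₂ (disk⁻ t))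
    ; boundary = λ {u} {v} t f → on-walk (∈-map⁻ _ (outer-side (adj-sym (proj₁ (disk⁻ t))) f))
    ; full = inj₁ disk-full
    }
    where
      fresh : ∀ {z} → z ∈ tabulate c⁺ → z ≢ c₀
      fresh z∈ eq with ∈-tabulate⁻ {f = c⁺} z∈
      ... | i , refl with cycle-inj _ _ eq
      ...   | ()
      outer-closed : Closed (member outer)
      outer-closed = member-closed (λ _ → outer-next)
        (λ {u} {v} a e∈ → decidable-stable ((u , v) ∈? outer) (λ ∉o → inner-next a ∉o e∈))
        where open import Data.List.Membership.DecPropositional (≡-dec (_≟_ {n}) (_≟_ {n})) using (_∈?_)
      outer-side : ∀ {u v} → Adj u v → disk u v ≡ false → (u , v) ∈ outer
      outer-side a f with ∩-false f
      ... | inj₁ f′ = ⊥-elim (true≢false a f′)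
      ... | inj₂ (_ , f′) = member⁻ (not-false f′)
      on-walk : ∀ {e} → (∃ λ i → i ∈ allFin (3 + m) × e ≡ cycle-dart i) → e ∈ clinks boundary-walk
      on-walk (i , _ , refl) = walk⁺ i

  lastOf-boundary : lastOf c₁ boundary-tail ≡ c₀
  lastOf-boundary = lastOf-++ c₁ (tabulate c⁺⁺) c₀ []

  ∈-boundary-walk : ∀ i → c i ∈ boundary-walk
  ∈-boundary-walk zero = ∈-++⁺ʳ (tabulate c⁺) (here refl)
  ∈-boundary-walk (suc i) = ∈-++⁺ˡ (∈-tabulate⁺ {f = c⁺} i)

  -- Every edge has an inner dart, as the reverse of an outer dart is inner; so the edges of the
  -- disk are all the edges of G.
  adj-disk : ∀ {u v} → Adj u v → disk u v ≡ true ⊎ disk v u ≡ true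
  adj-disk {u} {v} a with disk u v Boolₚ.≟ true
  ... | yes t = inj₁ t
  ... | no ne = inj₂ (decidable-stable (disk v u Boolₚ.≟ true) (λ ne′ →
    true≢false (disk⁺ a (λ e∈ → ne′ (proj₁ (disk-full (outer⊆ e∈))))) (¬true⇒false ne)))
    where
      outer⊆ : ∀ {e} → e ∈ outer → e ∈ clinks boundary-walk
      outer⊆ e∈ with ∈-map⁻ _ e∈
      ... | i , _ , refl = walk⁺ i

-- From monomials to orientations

module OrientEdges {n : ℕ} (σ : Fin n → Fin n → Bool) (σ-sym : ∀ u v → σ u v ≡ σ v u) where

  open Monomials σ
  open Orientations σ

  Reorients : E → E → Set
  Reorients e f = f ≡ e ⊎ f ≡ swap e

  sgn-sym : ∀ u v → sgn u v ≡ sgn v u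
  sgn-sym u v rewrite σ-sym u v = refl

  sgn² : ∀ u v → sgn u v ℤ.* sgn u v ≡ 1ℤ
  sgn² u v with σ u v
  ... | true = refl
  ... | false = refl

  -- Reversing a factor extracts a sign: x_u + s·x_v = s·(x_v + s·x_u) because s² = 1, where s is
  -- the same in both directions by the symmetry of σ. A scalar k is enough to carry nonvanishing
  -- from L to A.
  coef-reorient : ∀ {L A} → Pointwise Reorients L A → ∃ λ k → ∀ d → coef L d ≡ k ℤ.* coef A d
  coef-reorient [] = 1ℤ , λ d → sym (ℤₚ.*-identityˡ _)
  coef-reorient {(u , v) ∷ L} {_ ∷ A} (inj₁ refl ∷ rs) with coef-reorient rs
  ... | k , eq = k , λ d → trans (cong₂ (λ a b → a ℤ.+ sgn u v ℤ.* b) (eq (d ⊖ u)) (eq (d ⊖ v)))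
                             (lemma k (coef A (d ⊖ u)) (coef A (d ⊖ v)) (sgn u v))
    where
      lemma : ∀ k a b s → k ℤ.* a ℤ.+ s ℤ.* (k ℤ.* b) ≡ k ℤ.* (a ℤ.+ s ℤ.* b)
      lemma = solve-∀
  coef-reorient {(u , v) ∷ L} {_ ∷ A} (inj₂ refl ∷ rs) with coef-reorient rs
  ... | k , eq = k ℤ.* sgn u v , λ d → begin
        coef L (d ⊖ u) ℤ.+ sgn u v ℤ.* coef L (d ⊖ v)
      ≡⟨ cong₂ (λ a b → a ℤ.+ sgn u v ℤ.* b) (eq (d ⊖ u)) (eq (d ⊖ v)) ⟩
        k ℤ.* coef A (d ⊖ u) ℤ.+ sgn u v ℤ.* (k ℤ.* coef A (d ⊖ v))
      ≡⟨ cong (λ t → t ℤ.+ sgn u v ℤ.* (k ℤ.* coef A (d ⊖ v)))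
           (sym (trans (cong (ℤ._* (k ℤ.* coef A (d ⊖ u))) (sgn² u v)) (ℤₚ.*-identityˡ _))) ⟩
        sgn u v ℤ.* sgn u v ℤ.* (k ℤ.* coef A (d ⊖ u)) ℤ.+ sgn u v ℤ.* (k ℤ.* coef A (d ⊖ v))
      ≡⟨ lemma k (coef A (d ⊖ u)) (coef A (d ⊖ v)) (sgn u v) ⟩
        k ℤ.* sgn u v ℤ.* (coef A (d ⊖ v) ℤ.+ sgn u v ℤ.* coef A (d ⊖ u))
      ≡⟨ cong (λ t → k ℤ.* sgn u v ℤ.* (coef A (d ⊖ v) ℤ.+ t ℤ.* coef A (d ⊖ u))) (sgn-sym u v) ⟩
        k ℤ.* sgn u v ℤ.* coef ((v , u) ∷ A) d ∎
    where
      open ≡-Reasoning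
      lemma : ∀ k a b s → s ℤ.* s ℤ.* (k ℤ.* a) ℤ.+ s ℤ.* (k ℤ.* b) ≡ k ℤ.* s ℤ.* (b ℤ.+ s ℤ.* a)
      lemma = solve-∀

  -- A nonzero coefficient has at least one choice of a variable from each factor that produces the
  -- monomial; the chosen vertex becomes the tail of the arc.
  reorientation : ∀ L d → coef L d ≢ 0ℤ → ∃ λ A → Pointwise Reorients L A × (∀ v → tails A v ≡ d v)
  reorientation [] d ne = [] , [] , λ v → sym (unit≢0 ne v)
  reorientation ((a , b) ∷ L) d ne with coef-∷≢0 a b L d ne
  ... | inj₁ ne′ with reorientation L (d ⊖ a) ne′
  ...   | A , rs , eq = (a , b) ∷ A , inj₁ refl ∷ rs ,
          λ v → trans (cong (λ t → δ a v ℤ.+ t) (eq v)) (cancel (δ a v) (d v))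
    where
      cancel : ∀ x y → x ℤ.+ (y ℤ.- x) ≡ y
      cancel = solve-∀
  reorientation ((a , b) ∷ L) d ne | inj₂ ne′ with reorientation L (d ⊖ b) ne′
  ...   | A , rs , eq = (b , a) ∷ A , inj₂ refl ∷ rs ,
          λ v → trans (cong (λ t → δ b v ℤ.+ t) (eq v)) (cancel (δ b v) (d v))
    where
      cancel : ∀ x y → x ℤ.+ (y ℤ.- x) ≡ y
      cancel = solve-∀

  tails-↭ : ∀ {A B} → A ↭ B → ∀ v → tails A v ≡ tails B v
  tails-↭ ↭.refl v = refl
  tails-↭ (↭.prep (a , _) p) v = cong (λ t → δ a v ℤ.+ t) (tails-↭ p v)
  tails-↭ (↭.swap (a , _) (b , _) p) v =
    trans (cong (λ t → δ a v ℤ.+ (δ b v ℤ.+ t)) (tails-↭ p v)) (lemma (δ a v) (δ b v) _)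
    where
      lemma : ∀ x y z → x ℤ.+ (y ℤ.+ z) ≡ y ℤ.+ (x ℤ.+ z)
      lemma = solve-∀
  tails-↭ (↭.trans p q) v = trans (tails-↭ p v) (tails-↭ q v)

  ∈-reorient⁻ : ∀ {L A e} → Pointwise Reorients L A → e ∈ A → e ∈~ L
  ∈-reorient⁻ (inj₁ refl ∷ _) (here refl) = inj₁ (here refl)
  ∈-reorient⁻ (inj₂ refl ∷ _) (here refl) = inj₂ (here refl)
  ∈-reorient⁻ (_ ∷ rs) (there e∈) = [ inj₁ ∘ there , inj₂ ∘ there ]′ (∈-reorient⁻ rs e∈)

  ∈-reorient⁺ : ∀ {L A e} → Pointwise Reorients L A → e ∈ L → e ∈~ A
  ∈-reorient⁺ (inj₁ refl ∷ _) (here refl) = inj₁ (here refl)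
  ∈-reorient⁺ (inj₂ refl ∷ _) (here refl) = inj₂ (here refl)
  ∈-reorient⁺ (_ ∷ rs) (there e∈) = [ inj₁ ∘ there , inj₂ ∘ there ]′ (∈-reorient⁺ rs e∈)

  distinct-reorient : ∀ {L A} → Pointwise Reorients L A → AllPairs _≁_ L → AllPairs _≁_ A
  distinct-reorient [] [] = []
  distinct-reorient {e ∷ L} {f ∷ A} (ef ∷ rs) (e≁ ∷ ds) =
      ∉~⇒≁ (λ f∈ → f∉ ef ([ ∈-reorient⁻ rs , ∈~-swap ∘ ∈-reorient⁻ rs ]′ f∈)) ∷ distinct-reorient rs ds
    where
      e∉ : ¬ (e ∈~ L)
      e∉ (inj₁ e∈) = proj₁ (All.lookup e≁ e∈) refl
      e∉ (inj₂ e∈) = proj₂ (All.lookup e≁ e∈) refl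
      f∉ : Reorients e f → ¬ (f ∈~ L)
      f∉ (inj₁ refl) f∈ = e∉ f∈
      f∉ (inj₂ refl) f∈ = e∉ (∈~-swap f∈)

  distinct-antisymmetric : ∀ {A : List E} {u v} → AllPairs _≁_ A → u ≢ v → (u , v) ∈ A → (v , u) ∉ A
  distinct-antisymmetric _ u≢v (here refl) (here eq) = u≢v (sym (,-injectiveˡ eq))
  distinct-antisymmetric (e≁ ∷ _) u≢v (here refl) (there e∈) = proj₂ (All.lookup e≁ e∈) refl
  distinct-antisymmetric (e≁ ∷ _) u≢v (there e∈) (here refl) = proj₂ (All.lookup e≁ e∈) refl
  distinct-antisymmetric (_ ∷ ds) u≢v (there e∈) (there e∈′) = distinct-antisymmetric ds u≢v e∈ e∈′

  arcs-unique : ∀ {G : SimpleGraph n} {a b} (D : OrientationMinus G a b) → Unique (arcs D)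
  arcs-unique D = Unique.filter⁺ _ (Unique.cartesianProduct⁺ (Unique.allFin⁺ n) (Unique.allFin⁺ n))

  ∈-arcs⁺ : ∀ {G : SimpleGraph n} {a b} (D : OrientationMinus G a b) {u v} → arc D u v ≡ true → (u , v) ∈ arcs D
  ∈-arcs⁺ D {u} {v} t =
    ∈-filterᵇ⁺ (λ p → arc D (proj₁ p) (proj₂ p)) (∈-cartesianProduct⁺ (∈-allFin u) (∈-allFin v)) t

  ∈-arcs⁻ : ∀ {G : SimpleGraph n} {a b} (D : OrientationMinus G a b) {u v} → (u , v) ∈ arcs D → arc D u v ≡ true
  ∈-arcs⁻ D e∈ = proj₂ (∈-filterᵇ⁻ (λ p → arc D (proj₁ p) (proj₂ p)) {xs = allPairs n} e∈)

  outdeg-≤-tails : ∀ {G : SimpleGraph n} {a b} (D : OrientationMinus G a b) v → + outdeg D v ℤ.≤ tails (arcs D) v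
  outdeg-≤-tails D v = subst (+ outdeg D v ℤ.≤_) (sym (tails-outdegree (arcs D) v)) (ℤ.+≤+
    (subst (_≤ outdegree (arcs D) v) (length-map (v ,_) out)
      (unique-⊆-length (Unique.map⁺ (λ { refl → refl }) (Unique.filter⁺ _ (Unique.allFin⁺ n))) sub)))
    where
      out : List V
      out = filterᵇ (λ w → arc D v w) (allFin n)
      ⌊v≟v⌋ : ⌊ v ≟ v ⌋ ≡ true
      ⌊v≟v⌋ with v ≟ v
      ... | yes _ = refl
      ... | no v≢v = ⊥-elim (v≢v refl)
      sub : ∀ {e} → e ∈ map (v ,_) out → e ∈ filterᵇ (λ p → ⌊ proj₁ p ≟ v ⌋) (arcs D)
      sub e∈ with ∈-map⁻ (v ,_) {xs = out} e∈
      ... | w , w∈ , refl = ∈-filterᵇ⁺ (λ p → ⌊ proj₁ p ≟ v ⌋)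
        (∈-arcs⁺ D (proj₂ (∈-filterᵇ⁻ (λ w → arc D v w) {xs = allFin n} w∈))) ⌊v≟v⌋

theorem3p2 : ∀ {n m} (G : SimpleGraph n) (σ : Fin n → Fin n → Bool) →
    (∀ u v → σ u v ≡ σ v u) →
    (c : Fin (3 + m) → Fin n) → NearTriangulation G m c →
    Σ (OrientationMinus G (c zero) (c (suc zero))) λ D →
    (σEE σ D ≢ σOE σ D)
    × outdeg D (c zero) ≡ 0
    × outdeg D (c (suc zero)) ≡ 0
    × (∀ (i : Fin (1 + m)) → outdeg D (c (suc (suc i))) ≤ 2)
    × (∀ v → (∀ i → c i ≢ v) → outdeg D v ≤ 4)
theorem3p2 {n} {m} G σ σ-sym c N =
    D , coef≢0⇒σEE≢σOE D coef-arcs≢0 ,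
    outdeg-zero (subst (λ t → d t ≡ 0ℤ) lastOf-boundary d-last) ,
    outdeg-zero d-first ,
    (λ i → outdeg-bound (d-boundary (∈-boundary-walk (suc (suc i))))) ,
    (λ v _ → outdeg-bound (d-all v))
  where
    open Monomials σ using (coef; coef-cong; coef-↭)
    open Orientations σ
    open OrientEdges σ σ-sym
    open Sphere G c N
    open Regions G c N using (count)
    open Disk G c N
    open NiceMonomials σ G c N

    N₀ : Nice (c (suc zero)) boundary-tail disk
    N₀ = nice (count disk) (c (suc zero)) boundary-tail disk disk-region ℕₚ.≤-refl
    open Nice N₀

    oriented : ∃ λ A → Pointwise Reorients L A × (∀ v → tails A v ≡ d v)
    oriented = reorientation L d coef≢0

    A : List E
    A = proj₁ oriented

    L~A : Pointwise Reorients L A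
    L~A = proj₁ (proj₂ oriented)

    A-distinct : AllPairs _≁_ A
    A-distinct = distinct-reorient L~A distinct

    A-adj : ∀ {u v} → (u , v) ∈ A → Adj u v
    A-adj e∈ with ∈-reorient⁻ L~A e∈
    ... | inj₁ e∈L = [ disk-adj , adj-sym ∘ disk-adj ]′ (within e∈L)
    ... | inj₂ e∈L = [ adj-sym ∘ disk-adj , disk-adj ]′ (within e∈L)

    root : ∀ {e} → e ≡ (c zero , c (suc zero)) ⊎ e ≡ (c (suc zero) , c zero) → Root (c (suc zero)) boundary-tail e
    root {e} eq = subst (λ t → e ∈~ (c (suc zero) , t) ∷ []) (sym lastOf-boundary) (go eq)
      where
        go : e ≡ (c zero , c (suc zero)) ⊎ e ≡ (c (suc zero) , c zero) → e ∈~ (c (suc zero) , c zero) ∷ []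
        go (inj₁ refl) = inj₂ (here refl)
        go (inj₂ refl) = inj₁ (here refl)

    root⁻ : ∀ {u v} → Root (c (suc zero)) boundary-tail (u , v) →
      (u ≡ c zero × v ≡ c (suc zero)) ⊎ (u ≡ c (suc zero) × v ≡ c zero)
    root⁻ {u} {v} rt with subst (λ t → (u , v) ∈~ (c (suc zero) , t) ∷ []) lastOf-boundary rt
    ... | inj₁ (here refl) = inj₂ (refl , refl)
    ... | inj₂ (here refl) = inj₁ (refl , refl)

    A-not-root : ∀ {e} → e ∈ A → ¬ Root (c (suc zero)) boundary-tail e
    A-not-root e∈ rt with ∈-reorient⁻ L~A e∈
    ... | inj₁ e∈L = not-root e∈L rt
    ... | inj₂ e∈L = not-root e∈L (∈~-swap rt)

    A-covers : ∀ {u v} → Adj u v → ¬ Root (c (suc zero)) boundary-tail (u , v) → (u , v) ∈~ A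
    A-covers a ¬root with adj-disk a
    ... | inj₁ t = [ [ ∈-reorient⁺ L~A , ∈~-swap ∘ ∈-reorient⁺ L~A ]′ , ⊥-elim ∘ ¬root ]′ (covers t)
    ... | inj₂ t = [ [ ∈~-swap ∘ ∈-reorient⁺ L~A , ∈-reorient⁺ L~A ]′ , ⊥-elim ∘ ¬root ∘ ∈~-swap ]′ (covers t)

    absent : ∀ {u v} → (u , v) ∉ A → member A u v ≡ false
    absent e∉ = Boolₚ.¬-not (e∉ ∘ member⁻)

    D : OrientationMinus G (c zero) (c (suc zero))
    D = record
      { arc = member A
      ; arc-edge = λ u v t → A-adj (member⁻ t)
      ; arc-not-e₁ = absent (λ e∈ → A-not-root e∈ (root (inj₁ refl)))
      ; arc-not-e₂ = absent (λ e∈ → A-not-root e∈ (root (inj₂ refl)))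
      ; arc-one = λ u v a ¬e → [
          (λ e∈ → inj₁ (member⁺ e∈ , absent (distinct-antisymmetric A-distinct (adj⇒≢ a) e∈))) ,
          (λ e∈ → inj₂ (absent (distinct-antisymmetric A-distinct (adj⇒≢ a ∘ sym) e∈) , member⁺ e∈))
        ]′ (A-covers a (¬e ∘ root⁻))
      }

    -- Both lists are free of repetitions and have the same members, so the coefficients agree, as
    -- do the outdegrees prescribed by d.
    arcs↭A : arcs D ↭ A
    arcs↭A = ∼bag⇒↭ (unique∧set⇒bag (arcs-unique D) (AllPairs.map proj₁ A-distinct)
      (mk⇔ (λ e∈ → member⁻ (∈-arcs⁻ D e∈)) (λ e∈ → ∈-arcs⁺ D (member⁺ e∈))))

    tails≡d : ∀ v → tails (arcs D) v ≡ d v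
    tails≡d v = trans (tails-↭ arcs↭A v) (proj₂ (proj₂ oriented) v)

    coef-arcs≢0 : coef (arcs D) (tails (arcs D)) ≢ 0ℤ
    coef-arcs≢0 eq with coef-reorient L~A
    ... | k , scaled = coef≢0 (trans (scaled d) (trans (cong (λ t → k ℤ.* t)
      (trans (sym (coef-↭ arcs↭A d)) (trans (coef-cong (arcs D) (sym ∘ tails≡d)) eq))) (ℤₚ.*-zeroʳ k)))

    outdeg-bound : ∀ {v k} → d v ℤ.≤ + k → outdeg D v ≤ k
    outdeg-bound {v} {k} le = ℤₚ.drop‿+≤+ (ℤₚ.≤-trans (outdeg-≤-tails D v) (subst (ℤ._≤ + k) (sym (tails≡d v)) le))

    outdeg-zero : ∀ {v} → d v ≡ 0ℤ → outdeg D v ≡ 0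
    outdeg-zero z = ℕₚ.n≤0⇒n≡0 (outdeg-bound (ℤₚ.≤-reflexive z))
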